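{- Let $T\in\mathcal F$ be a trigraph with no balanced skew-partition and let $X$ be a fragment of $T$ (in the sense including homogeneous pairs). Then the block of decomposition $T_X$ has no balanced skew-partition.
   Context: Trigraphs: finite $V(T)$ with $\theta:\binom{V(T)}{2}\to\{ -1,0,1\}$; $u,v$ strongly adjacent if $\theta(uv)=1$, strongly antiadjacent if $-1$, a switchable pair if $0$; adjacent (neighbours) if $\theta\in\{0,1\}$, antiadjacent (antineighbours) if $\theta\in\{ -1,0\}$. Complement $\overline T$: $-\theta$; $T|X$: induced trigraph. Strongly complete/anticomplete: strongly adjacent/antiadjacent to every vertex of a set. Full realization: graph on $V(T)$ of adjacent pairs. $X$ connected: full realization of $T|X$ connected; anticonnected: complement of graph on $X$ of strongly adjacent pairs connected; components = maximal connected subsets. Path: distinct $p_1,\dots,p_k$, consecutive adjacent, non-consecutive antiadjacent (length $k-1$, interior = inner vertices). Hole: $h_1,\dots,h_k$, $k\ge4$, $h_i,h_j$ adjacent iff $|i-j|\in\{1,k-1\}$, else antiadjacent. Antipath/antihole: complement is a path/hole in $\overline T$. Berge: no odd hole, no odd antihole. Skew-partition: partition $(A,B)$ of $V(T)$, $A$ not connected, $B$ not anticonnected; balanced if no path of odd length $>1$ with ends in $B$ and interior in $A$ and no antipath of odd length $>1$ with ends in $A$ and interior in $B$. $\mathcal F$: Berge trigraphs such that each component of the graph $\Sigma(T)$ of switchable pairs has at most two edges and each vertex $v$ of $\Sigma(T)$-degree two with $\Sigma(T)$-neighbours $x,y$ is either strongly complete to $V(T)\setminus\{v,x,y\}$ with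 $x,y$ strongly adjacent, or strongly anticomplete to $V(T)\setminus\{v,x,y\}$ with $x,y$ strongly antiadjacent. $2$-join: partition $(X_1,X_2)$ with disjoint $A_1,B_1,C_1,A_2,B_2,C_2$ (split), $X_i=A_i\cup B_i\cup C_i$, $A_i,B_i\neq\emptyset$, no switchable pair between $X_1,X_2$, $A_1$ strongly complete to $A_2$, $B_1$ strongly complete to $B_2$, all other pairs between $X_1,X_2$ strongly antiadjacent, $|X_i|\ge3$, and if $|A_i|=|B_i|=1$ the full realization of $T|X_i$ is not a path of length two between the vertices of $A_i$ and $B_i$; proper if each component of $T|X_i$ meets $A_i$ and $B_i$. (Proper) complement $2$-join: (proper) $2$-join of $\overline T$, same split. In a Berge trigraph, for a proper $2$-join all paths from $A_i$ to $B_i$ with interior in $C_i$ ($i=1,2$) have the same length parity, called odd/even accordingly; complement $2$-joins have the parity of the $2$-join of $\overline T$. Proper homogeneous pair: disjoint nonempty $A,B\subseteq V(T)$ such that, letting $A_1$ ($A_2$) be the set of vertices of $V(T)\setminus(A\cup B)$ strongly complete (strongly anticomplete) to $A$ and $B_1,B_2$ likewise for $B$: $|A|>1$, $|B|>1$; $A_1\cup A_2=B_1\cup B_2=V(T)\setminus(A\cup B)$; every vertex of $A$ has a neighbour and an antineighbour in $B$ and vice versa; and $A_1\cap B_1$, $A_1\cap B_2$, $A_2\cap B_1$, $A_2\cap B_2$ are nonempty. Its split is $(A,B,C,D,E,F)$ with $C=A_1\cap B_2$, $D=A_2\cap B_1$, $E=A_1\cap B_1$, $F=A_2\cap B_2$.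 Fragment: $X\subseteq V(T)$ such that $(X,V(T)\setminus X)$ is a proper $2$-join or a proper complement $2$-join of $T$, or $X=A\cup B$ or $X=V(T)\setminus(A\cup B)$ for a proper homogeneous pair $(A,B)$. Blocks $T_X$, adding new marker vertices with all unspecified new pairs strongly antiadjacent. For $X=X_1$ of a $2$-join with split $(A_1,B_1,C_1,A_2,B_2,C_2)$, start from $T|X_1$: odd $2$-join: add $a,b$, $a$ strongly complete to $A_1$, $b$ strongly complete to $B_1$, $ab$ switchable; even $2$-join: add $a,b,c$, $a$ strongly complete to $A_1$, $b$ strongly complete to $B_1$, $ac,cb$ switchable; odd complement $2$-join: add $a,b$, $a$ strongly complete to $B_1\cup C_1$, $b$ strongly complete to $A_1\cup C_1$, $ab$ switchable; even complement $2$-join: add $a,b,c$, $a$ strongly complete to $B_1\cup C_1$, $b$ strongly complete to $A_1\cup C_1$, $c$ strongly complete to $X_1$, $ac,cb$ switchable, $ab$ strongly adjacent. For $X=A\cup B$: start from $T|(A\cup B)$, add $c$ strongly complete to $A$ and $d$ strongly complete to $B$ with $cd$ switchable. For $X=C\cup D\cup E\cup F$: start from $T|X$, add $a$ strongly complete to $C\cup E$ and $b$ strongly complete to $D\cup E$ with $ab$ switchable. -}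

module Defs where

open import Data.Nat using (ℕ; zero; suc; _≤_; _<_)
open import Data.Fin using (Fin; zero; suc; toℕ; fromℕ)
open import Data.Product using (Σ; ∃; _×_; _,_; proj₁; proj₂)
open import Data.Sum using (_⊎_; inj₁; inj₂)
open import Data.Unit using (⊤; tt)
open import Data.Empty using (⊥)
open import Data.Bool using (Bool; true; false)
open import Relation.Nullary using (¬_)
open import Relation.Binary.PropositionalEquality using (_≡_; _≢_; refl; cong)

-- Trigraphs
-- θ(uv) ∈ {1, -1, 0}:  pos = 1 (strongly adjacent),
-- neg = -1 (strongly antiadjacent), swi = 0 (switchable pair).
-- The value θ u u on the diagonal is meaningless and never used
-- (all notions below only look at pairs of distinct vertices, or are
-- insensitive to the diagonal).

data Adj : Set where
  pos neg swi : Adj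

record Trigraph (V : Set) : Set where
  field
    θ     : V → V → Adj
    θ-sym : ∀ u v → θ u v ≡ θ v u
open Trigraph public

negA : Adj → Adj
negA pos = neg
negA neg = pos
negA swi = swi

complement : ∀ {V} → Trigraph V → Trigraph V
complement T = record { θ = λ u v → negA (θ T u v)
                      ; θ-sym = λ u v → cong negA (θ-sym T u v) }

module _ {V : Set} (T : Trigraph V) where
  StronglyAdjacent StronglyAntiadjacent Switchable : V → V → Set
  StronglyAdjacent u v = θ T u v ≡ pos
  StronglyAntiadjacent u v = θ T u v ≡ neg
  Switchable u v = θ T u v ≡ swi

  Adjacent Antiadjacent : V → V → Set
  Adjacent u v = θ T u v ≡ pos ⊎ θ T u v ≡ swi
  Antiadjacent u v = θ T u v ≡ neg ⊎ θ T u v ≡ swi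

data Walk {V : Set} (R : V → V → Set) (X : V → Set) : V → V → Set where
  here : ∀ {u} → X u → Walk R X u u
  step : ∀ {u w v} → X u → R u w → Walk R X w v → Walk R X u v

Connected : ∀ {V} → Trigraph V → (V → Set) → Set
Connected T X = ∀ u v → X u → X v → Walk (Adjacent T) X u v

-- X is anticonnected: the complement of the graph on X of strongly
-- adjacent pairs is connected; its edges are exactly the pairs that are
-- not strongly adjacent, i.e. the adjacent pairs of the complement trigraph.
Anticonnected : ∀ {V} → Trigraph V → (V → Set) → Set
Anticonnected T X = Connected (complement T) X

data Parity : Set where
  evenP oddP : Parity

parity : ℕ → Parity
parity zero = evenP
parity (suc zero) = oddP
parity (suc (suc n)) = parity n

record Path {V : Set} (T : Trigraph V) (k : ℕ) : Set where
  field
    vtx  : Fin (suc k) → V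
    inj  : ∀ i j → vtx i ≡ vtx j → i ≡ j
    cons : ∀ i j → toℕ j ≡ suc (toℕ i) → Adjacent T (vtx i) (vtx j)
    nonc : ∀ i j → suc (suc (toℕ i)) ≤ toℕ j → Antiadjacent T (vtx i) (vtx j)
open Path public

first : ∀ {V} {T : Trigraph V} {k} → Path T k → V
first P = vtx P zero

last : ∀ {V} {T : Trigraph V} {k} → Path T k → V
last {k = k} P = vtx P (fromℕ k)

InteriorIn : ∀ {V} {T : Trigraph V} {k} → Path T k → (V → Set) → Set
InteriorIn {k = k} P X = ∀ i → 0 < toℕ i → toℕ i < k → X (vtx P i)

CycNext : (k : ℕ) → Fin k → Fin k → Set
CycNext k i j = toℕ j ≡ suc (toℕ i) ⊎ (suc (toℕ i) ≡ k × toℕ j ≡ 0)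

record Hole {V : Set} (T : Trigraph V) (k : ℕ) : Set where
  field
    four≤k : 4 ≤ k
    hv     : Fin k → V
    hinj   : ∀ i j → hv i ≡ hv j → i ≡ j
    hadj   : ∀ i j → CycNext k i j → Adjacent T (hv i) (hv j)
    hanti  : ∀ i j → i ≢ j → ¬ CycNext k i j → ¬ CycNext k j i →
             Antiadjacent T (hv i) (hv j)

Berge : ∀ {V} → Trigraph V → Set
Berge T = (∀ k → parity k ≡ oddP → ¬ Hole T k)
        × (∀ k → parity k ≡ oddP → ¬ Hole (complement T) k)

-- Skew-partitions.  A partition (A , B) of V is given by A : V → Bool,
-- with B the set of vertices where A is false.

InA InB : ∀ {V : Set} → (V → Bool) → V → Set
InA A v = A v ≡ true
InB A v = A v ≡ false

SkewPartition : ∀ {V} → Trigraph V → (V → Bool) → Set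
SkewPartition T A = ¬ Connected T (InA A) × ¬ Anticonnected T (InB A)

Balanced : ∀ {V} → Trigraph V → (V → Bool) → Set
Balanced T A =
    (∀ k (P : Path T k) → parity k ≡ oddP → 1 < k →
       InB A (first P) → InB A (last P) → InteriorIn P (InA A) → ⊥)
  × (∀ k (P : Path (complement T) k) → parity k ≡ oddP → 1 < k →
       InA A (first P) → InA A (last P) → InteriorIn P (InB A) → ⊥)

HasBalancedSkewPartition : ∀ {V} → Trigraph V → Set
HasBalancedSkewPartition {V} T =
  Σ (V → Bool) λ A → SkewPartition T A × Balanced T A

module _ {V : Set} (T : Trigraph V) where
  SwEdge : V → V → Set
  SwEdge u v = u ≢ v × Switchable T u v

  SameEdge : V → V → V → V → Set
  SameEdge u₁ v₁ u₂ v₂ = (u₁ ≡ u₂ × v₁ ≡ v₂) ⊎ (u₁ ≡ v₂ × v₁ ≡ u₂)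

  SReach : V → V → Set
  SReach = Walk (Switchable T) (λ _ → ⊤)

  ComponentsAtMostTwoEdges : Set
  ComponentsAtMostTwoEdges =
    ∀ u₁ v₁ u₂ v₂ u₃ v₃ →
      SwEdge u₁ v₁ → SwEdge u₂ v₂ → SwEdge u₃ v₃ →
      ¬ SameEdge u₁ v₁ u₂ v₂ → ¬ SameEdge u₁ v₁ u₃ v₃ → ¬ SameEdge u₂ v₂ u₃ v₃ →
      SReach u₁ u₂ → SReach u₁ u₃ → ⊥

  DegreeTwoCondition : Set
  DegreeTwoCondition =
    ∀ v x y → x ≢ y → SwEdge v x → SwEdge v y →
      (∀ w → SwEdge v w → w ≡ x ⊎ w ≡ y) →
        (θ T x y ≡ pos × (∀ w → w ≢ v → w ≢ x → w ≢ y → θ T v w ≡ pos))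
      ⊎ (θ T x y ≡ neg × (∀ w → w ≢ v → w ≢ x → w ≢ y → θ T v w ≡ neg))

InF : ∀ {V} → Trigraph V → Set
InF T = Berge T × ComponentsAtMostTwoEdges T × DegreeTwoCondition T

-- 2-joins.  A split (A₁,B₁,C₁,A₂,B₂,C₂) is a map V → Side × Kind.

data Side : Set where
  s₁ s₂ : Side

data Kind : Set where
  kA kB kC : Kind

Split : Set → Set
Split V = V → Side × Kind

crossVal : Kind → Kind → Adj
crossVal kA kA = pos
crossVal kB kB = pos
crossVal _ _ = neg

module _ {V : Set} (T : Trigraph V) (sp : Split V) where
  OnSide : Side → V → Set
  OnSide s v = proj₁ (sp v) ≡ s

  In : Side → Kind → V → Set
  In s κ v = sp v ≡ (s , κ)

  record IsTwoJoin : Set where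
    field
      A-nonempty : ∀ s → ∃ λ v → In s kA v
      B-nonempty : ∀ s → ∃ λ v → In s kB v
      cross : ∀ u v → OnSide s₁ u → OnSide s₂ v →
              θ T u v ≡ crossVal (proj₂ (sp u)) (proj₂ (sp v))
      size : ∀ s → ∃ λ x → ∃ λ y → ∃ λ z →
               OnSide s x × OnSide s y × OnSide s z × x ≢ y × x ≢ z × y ≢ z
      -- if A_i = {a}, B_i = {b}, the full realization of T|X_i is not a
      -- path of length two between a and b
      not-short-path : ∀ s a b → In s kA a → (∀ v → In s kA v → v ≡ a) →
                       In s kB b → (∀ v → In s kB v → v ≡ b) →
                       ¬ (∃ λ c → In s kC c × (∀ v → In s kC v → v ≡ c) ×
                                  Adjacent T a c × Adjacent T c b ×
                                  θ T a b ≡ neg)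

  IsProper : Set
  IsProper = ∀ s v → OnSide s v →
      (∃ λ a → In s kA a × Walk (Adjacent T) (OnSide s) v a)
    × (∃ λ b → In s kB b × Walk (Adjacent T) (OnSide s) v b)

  IsProperTwoJoin : Set
  IsProperTwoJoin = IsTwoJoin × IsProper

  TwoJoinParity : Parity → Set
  TwoJoinParity p = ∀ s k (P : Path T k) → In s kA (first P) →
                    In s kB (last P) → InteriorIn P (In s kC) → parity k ≡ p

-- Proper homogeneous pairs, given with their split (A,B,C,D,E,F):
-- C = A₁∩B₂, D = A₂∩B₁, E = A₁∩B₁, F = A₂∩B₂.

data HClass : Set where
  hA hB hC hD hE hF : HClass

module _ {V : Set} (T : Trigraph V) (cls : V → HClass) where
  Cl : HClass → V → Set
  Cl h v = cls v ≡ h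

  record IsProperHomogeneousPair : Set where
    field
      A-big : ∃ λ x → ∃ λ y → Cl hA x × Cl hA y × x ≢ y
      B-big : ∃ λ x → ∃ λ y → Cl hB x × Cl hB y × x ≢ y
      A₁ : ∀ v a → Cl hA a → Cl hC v ⊎ Cl hE v → θ T v a ≡ pos
      A₂ : ∀ v a → Cl hA a → Cl hD v ⊎ Cl hF v → θ T v a ≡ neg
      B₁ : ∀ v b → Cl hB b → Cl hD v ⊎ Cl hE v → θ T v b ≡ pos
      B₂ : ∀ v b → Cl hB b → Cl hC v ⊎ Cl hF v → θ T v b ≡ neg
      A-mixed : ∀ a → Cl hA a → (∃ λ b → Cl hB b × Adjacent T a b)
                               × (∃ λ b → Cl hB b × Antiadjacent T a b)
      B-mixed : ∀ b → Cl hB b → (∃ λ a → Cl hA a × Adjacent T b a)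
                               × (∃ λ a → Cl hA a × Antiadjacent T b a)
      C-nonempty : ∃ (Cl hC)
      D-nonempty : ∃ (Cl hD)
      E-nonempty : ∃ (Cl hE)
      F-nonempty : ∃ (Cl hF)

data Fragment {V : Set} (T : Trigraph V) : Set where
  -- X = X₁ of a proper 2-join of parity p
  twoJoin   : (sp : Split V) → IsProperTwoJoin T sp →
              (p : Parity) → TwoJoinParity T sp p → Fragment T
  -- X = X₁ of a proper complement 2-join (parity taken in the complement)
  coTwoJoin : (sp : Split V) → IsProperTwoJoin (complement T) sp →
              (p : Parity) → TwoJoinParity (complement T) sp p → Fragment T
  -- X = A ∪ B for a proper homogeneous pair (A,B)
  hpInner   : (cls : V → HClass) → IsProperHomogeneousPair T cls → Fragment T
  -- X = V ∖ (A ∪ B) = C ∪ D ∪ E ∪ F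
  hpOuter   : (cls : V → HClass) → IsProperHomogeneousPair T cls → Fragment T

-- Blocks: T|X plus k marker vertices (Fin k).  f v i = θ between an
-- original vertex v ∈ X and marker i; m = θ among markers.

extend : ∀ {V} (T : Trigraph V) (P : V → Set) (k : ℕ)
         (f : V → Fin k → Adj) (m : Fin k → Fin k → Adj) →
         (∀ i j → m i j ≡ m j i) → Trigraph (Σ V P ⊎ Fin k)
extend {V} T P k f m msym = record { θ = th ; θ-sym = ths }
  where
  th : Σ V P ⊎ Fin k → Σ V P ⊎ Fin k → Adj
  th (inj₁ (u , _)) (inj₁ (v , _)) = θ T u v
  th (inj₁ (u , _)) (inj₂ i) = f u i
  th (inj₂ i) (inj₁ (u , _)) = f u i
  th (inj₂ i) (inj₂ j) = m i j
  ths : ∀ x y → th x y ≡ th y x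
  ths (inj₁ (u , _)) (inj₁ (v , _)) = θ-sym T u v
  ths (inj₁ _) (inj₂ _) = refl
  ths (inj₂ _) (inj₁ _) = refl
  ths (inj₂ i) (inj₂ j) = msym i j

m2 : Fin 2 → Fin 2 → Adj
m2 zero (suc zero) = swi
m2 (suc zero) zero = swi
m2 _ _ = neg

m2-sym : ∀ i j → m2 i j ≡ m2 j i
m2-sym zero zero = refl
m2-sym zero (suc zero) = refl
m2-sym (suc zero) zero = refl
m2-sym (suc zero) (suc zero) = refl

-- three markers a = 0, b = 1, c = 2 with ac, cb switchable and ab given
m3 : Adj → Fin 3 → Fin 3 → Adj
m3 ab zero (suc zero) = ab
m3 ab (suc zero) zero = ab
m3 ab zero (suc (suc zero)) = swi
m3 ab (suc (suc zero)) zero = swi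
m3 ab (suc zero) (suc (suc zero)) = swi
m3 ab (suc (suc zero)) (suc zero) = swi
m3 ab _ _ = neg

m3-sym : ∀ ab i j → m3 ab i j ≡ m3 ab j i
m3-sym ab zero zero = refl
m3-sym ab zero (suc zero) = refl
m3-sym ab zero (suc (suc zero)) = refl
m3-sym ab (suc zero) zero = refl
m3-sym ab (suc zero) (suc zero) = refl
m3-sym ab (suc zero) (suc (suc zero)) = refl
m3-sym ab (suc (suc zero)) zero = refl
m3-sym ab (suc (suc zero)) (suc zero) = refl
m3-sym ab (suc (suc zero)) (suc (suc zero)) = refl

fOdd : Kind → Fin 2 → Adj
fOdd kA zero = pos
fOdd kB (suc zero) = pos
fOdd _ _ = neg

fEven : Kind → Fin 3 → Adj
fEven kA zero = pos
fEven kB (suc zero) = pos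
fEven _ _ = neg

fCoOdd : Kind → Fin 2 → Adj
fCoOdd kB zero = pos
fCoOdd kC zero = pos
fCoOdd kA (suc zero) = pos
fCoOdd kC (suc zero) = pos
fCoOdd _ _ = neg

fCoEven : Kind → Fin 3 → Adj
fCoEven kB zero = pos
fCoEven kC zero = pos
fCoEven kA (suc zero) = pos
fCoEven kC (suc zero) = pos
fCoEven _ (suc (suc zero)) = pos
fCoEven _ _ = neg

fInner : HClass → Fin 2 → Adj
fInner hA zero = pos
fInner hB (suc zero) = pos
fInner _ _ = neg

InAB : HClass → Set
InAB hA = ⊤
InAB hB = ⊤
InAB _ = ⊥

fOuter : HClass → Fin 2 → Adj
fOuter hC zero = pos
fOuter hE zero = pos
fOuter hD (suc zero) = pos
fOuter hE (suc zero) = pos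
fOuter _ _ = neg

InCDEF : HClass → Set
InCDEF hA = ⊥
InCDEF hB = ⊥
InCDEF _ = ⊤

nMarkers : ∀ {V} {T : Trigraph V} → Fragment T → ℕ
nMarkers (twoJoin _ _ evenP _) = 3
nMarkers (twoJoin _ _ oddP _) = 2
nMarkers (coTwoJoin _ _ evenP _) = 3
nMarkers (coTwoJoin _ _ oddP _) = 2
nMarkers (hpInner _ _) = 2
nMarkers (hpOuter _ _) = 2

FragmentSet : ∀ {V} {T : Trigraph V} → Fragment T → V → Set
FragmentSet (twoJoin sp _ _ _) v = proj₁ (sp v) ≡ s₁
FragmentSet (coTwoJoin sp _ _ _) v = proj₁ (sp v) ≡ s₁
FragmentSet (hpInner cls _) v = InAB (cls v)
FragmentSet (hpOuter cls _) v = InCDEF (cls v)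

BlockV : ∀ {V} {T : Trigraph V} → Fragment T → Set
BlockV {V} φ = Σ V (FragmentSet φ) ⊎ Fin (nMarkers φ)

block : ∀ {V} (T : Trigraph V) (φ : Fragment T) → Trigraph (BlockV φ)
block T φ@(twoJoin sp _ evenP _) =
  extend T (FragmentSet φ) 3 (λ v → fEven (proj₂ (sp v))) (m3 neg) (m3-sym neg)
block T φ@(twoJoin sp _ oddP _) =
  extend T (FragmentSet φ) 2 (λ v → fOdd (proj₂ (sp v))) m2 m2-sym
block T φ@(coTwoJoin sp _ evenP _) =
  extend T (FragmentSet φ) 3 (λ v → fCoEven (proj₂ (sp v))) (m3 pos) (m3-sym pos)
block T φ@(coTwoJoin sp _ oddP _) =
  extend T (FragmentSet φ) 2 (λ v → fCoOdd (proj₂ (sp v))) m2 m2-sym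
block T φ@(hpInner cls _) =
  extend T (FragmentSet φ) 2 (λ v → fInner (cls v)) m2 m2-sym
block T φ@(hpOuter cls _) =
  extend T (FragmentSet φ) 2 (λ v → fOuter (cls v)) m2 m2-sym

{-# OPTIONS --safe #-}
module Submission where

open import Defs
open import Data.Nat using (ℕ; zero; suc; _+_; _∸_; _≤_; _<_; z≤n; s≤s; _≤?_)
open import Data.Nat.Properties
open import Data.Fin using (Fin; zero; suc; toℕ; fromℕ)
open import Data.Fin.Properties using (toℕ-injective; toℕ<n; toℕ-fromℕ)
open import Data.Bool using (Bool; true; false; not; if_then_else_; _xor_)
open import Data.Bool.Properties using (¬-not; not-¬; not-involutive; xor-same) renaming (_≟_ to _≟ᵇ_)
open import Data.Product using (Σ; ∃; _×_; _,_; proj₁; proj₂)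
open import Data.Sum using (_⊎_; inj₁; inj₂)
open import Data.Sum.Properties using (inj₂-injective)
open import Data.Unit using (tt)
open import Data.Empty using (⊥; ⊥-elim)
open import Function using (_∘_)
open import Relation.Nullary using (¬_; Dec; yes; no; does; ¬?)
open import Relation.Nullary.Decidable using (decidable-stable; ¬¬-excluded-middle)
open import Relation.Binary.PropositionalEquality using (_≡_; _≢_; refl; sym; trans; cong; cong₂; subst; subst₂; ≢-sym)
open import Relation.Binary.Definitions using (tri<; tri≈; tri>)

-- Let X be a fragment of T and f the map from V(T) to the vertices of T_X fixing X and sending
-- every other vertex to a marker.  Pulling back a balanced skew-partition of T_X along f gives a
-- skew-partition of T, because switchable marker pairs force the markers into compatible parts.
-- An odd path (or antipath) of T that violates balance is sent by f to one of T_X: it meets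
-- V(T) \ X in at most one vertex per attachment set, or in a single link between two attachment sets,
-- which is shortened to the marker path of the same parity.  The other
-- configurations have the wrong parity, or are completed to an odd hole by some vertex of X.

-- Parity

-- The obstacle is that `f` sends a whole attachment set to one marker, so the image of a path is a
-- path only if each set is met at most once. What limits the meetings is strong completeness: a
-- vertex of X that sees one vertex of an attachment set sees all of it, but on a path it is
-- strongly adjacent only to its neighbours. In a 2-join at least one end marker lies on the side
-- that is not connected, since a vertex in another anticomponent would otherwise be attached to
-- both ends. Outside a homogeneous pair such vertices exist, and when both markers are on the other
-- side the complement is used. Complementation exchanges the two sides, and paths with antipaths.
-- Everything is therefore stated for a pair of values and a pair of colours, and complement 2-joins
-- are further instances. That a side is not connected is a negative statement, while the transfer
-- needs an explicit separation of that side. The goal is a negation, so the separation may be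
-- chosen under a double negation, and this is where the finiteness of V(T) enters.

odd≢even : ∀ {a} → a ≡ oddP → a ≡ evenP → ⊥
odd≢even refl ()

even⊎odd : ∀ a → a ≡ evenP ⊎ a ≡ oddP
even⊎odd evenP = inj₁ refl
even⊎odd oddP = inj₂ refl

parity-even-+ : ∀ d k → parity d ≡ evenP → parity (d + k) ≡ parity k
parity-even-+ zero k e = refl
parity-even-+ (suc (suc d)) k e = parity-even-+ d k e

parity-suc : ∀ d → parity (suc d) ≡ oddP → parity d ≡ evenP
parity-suc zero e = refl
parity-suc (suc (suc d)) e = parity-suc d e

parity-same-+ : ∀ i j → parity i ≡ parity j → parity (i + j) ≡ evenP
parity-same-+ zero j e = sym e
parity-same-+ (suc zero) zero ()
parity-same-+ (suc zero) (suc zero) e = refl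
parity-same-+ (suc zero) (suc (suc j)) e = parity-same-+ (suc zero) j e
parity-same-+ (suc (suc i)) j e = parity-same-+ i j e

odd>1⇒≥3 : ∀ k → parity k ≡ oddP → 1 < k → 3 ≤ k
odd>1⇒≥3 (suc (suc (suc k))) e l = s≤s (s≤s (s≤s z≤n))
odd>1⇒≥3 (suc zero) e (s≤s ())

-- Bounded search

module _ {Q : ℕ → Set} (Q? : ∀ i → Dec (Q i)) where

  firstUpTo : ∀ k → (∀ i → i ≤ k → ¬ Q i) ⊎ ∃ λ s → s ≤ k × Q s × (∀ i → i < s → ¬ Q i)
  firstUpTo zero with Q? 0
  ... | yes q = inj₂ (0 , z≤n , q , λ _ ())
  ... | no ¬q = inj₁ λ { zero _ → ¬q }
  firstUpTo (suc k) with firstUpTo k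
  ... | inj₂ (s , s≤k , q , b) = inj₂ (s , m≤n⇒m≤1+n s≤k , q , b)
  ... | inj₁ none with Q? (suc k)
  ...   | yes q = inj₂ (suc k , ≤-refl , q , λ i i<s → none i (≤-pred i<s))
  ...   | no ¬q = inj₁ λ i i≤ → above i (m≤n⇒m<n∨m≡n i≤)
    where
    above : ∀ i → i < suc k ⊎ i ≡ suc k → ¬ Q i
    above i (inj₁ (s≤s i≤k)) = none i i≤k
    above i (inj₂ refl) = ¬q

  lastUpTo : ∀ k → (∀ i → i ≤ k → ¬ Q i) ⊎ ∃ λ t → t ≤ k × Q t × (∀ i → t < i → i ≤ k → ¬ Q i)
  lastUpTo k with Q? k
  lastUpTo k | yes q = inj₂ (k , ≤-refl , q , λ i k<i i≤k _ → <⇒≱ k<i i≤k)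
  lastUpTo zero | no ¬q = inj₁ λ { zero _ → ¬q }
  lastUpTo (suc k) | no ¬q with lastUpTo k
  ... | inj₁ none = inj₁ λ i i≤ → above i (m≤n⇒m<n∨m≡n i≤)
    where
    above : ∀ i → i < suc k ⊎ i ≡ suc k → ¬ Q i
    above i (inj₁ (s≤s i≤k)) = none i i≤k
    above i (inj₂ refl) = ¬q
  ... | inj₂ (t , t≤k , q , b) = inj₂ (t , m≤n⇒m≤1+n t≤k , q , λ i t<i i≤ → above i t<i (m≤n⇒m<n∨m≡n i≤))
    where
    above : ∀ i → t < i → i < suc k ⊎ i ≡ suc k → ¬ Q i
    above i t<i (inj₁ (s≤s i≤k)) = b i t<i i≤k
    above i t<i (inj₂ refl) = ¬q

-- Paths indexed by ℕ

-- Paths of T are the case y = pos, n = neg, and antipaths the case y = neg,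
-- n = pos; so complementing T amounts to exchanging y and n.
record ℕPath {V : Set} (θ : V → V → Adj) (y n : Adj) (k : ℕ) (p : ℕ → V) : Set where
  field
    dis : ∀ {i j} → i < j → j ≤ k → p i ≢ p j
    adj : ∀ {i} → i < k → θ (p i) (p (suc i)) ≢ n
    ant : ∀ {i j} → suc i < j → j ≤ k → θ (p i) (p j) ≢ y

subpath : ∀ {V : Set} {θ : V → V → Adj} {y n k p} → ℕPath θ y n k p →
          ∀ s m → m + s ≤ k → ℕPath θ y n m (λ i → p (i + s))
subpath P s m le = record
  { dis = λ i<j j≤m → dis (+-monoˡ-< s i<j) (≤-trans (+-monoˡ-≤ s j≤m) le)
  ; adj = λ i<m → adj (≤-trans (+-monoˡ-≤ s i<m) le)
  ; ant = λ i<j j≤m → ant (+-monoˡ-< s i<j) (≤-trans (+-monoˡ-≤ s j≤m) le) }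
  where open ℕPath P

∸-step : ∀ {i k} → i < k → k ∸ i ≡ suc (k ∸ suc i)
∸-step {i} {suc k} (s≤s i≤k) = +-∸-assoc 1 i≤k

module _ {V : Set} {θ : V → V → Adj} (θ-sym′ : ∀ u v → θ u v ≡ θ v u) {y n : Adj} where

  reversePath : ∀ {k p} → ℕPath θ y n k p → ℕPath θ y n k (λ i → p (k ∸ i))
  reversePath {k} {p} P = record
    { dis = λ {i} {j} i<j j≤k e → dis (∸-monoʳ-< i<j j≤k) (m∸n≤m k i) (sym e)
    ; adj = λ {i} i<k e → adj {k ∸ suc i} (subst (_≤ k) (∸-step i<k) (m∸n≤m k i))
        (trans (θ-sym′ _ _) (trans (cong (λ j → θ (p j) (p (k ∸ suc i))) (sym (∸-step i<k))) e))
    ; ant = λ {i} {j} i<j j≤k e →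
        ant (subst (suc (suc (k ∸ j)) ≤_) (sym (∸-step (≤-trans (<-trans (n<1+n i) i<j) j≤k)))
               (s≤s (∸-monoʳ-< i<j j≤k)))
          (m∸n≤m k i) (trans (θ-sym′ _ _) e) }
    where open ℕPath P

  -- The counting tool of the proof: `ant` forbids the value `y` between vertices that are not
  -- consecutive. A path vertex strongly complete to a set thus leaves at most two positions for
  -- that set.
  near : ∀ {k p} → ℕPath θ y n k p → ∀ {i j} → i ≤ k → j ≤ k → i ≢ j →
         θ (p i) (p j) ≡ y → j ≡ suc i ⊎ i ≡ suc j
  near P {i} {j} i≤k j≤k i≢j e with <-cmp i j
  ... | tri≈ _ i≡j _ = ⊥-elim (i≢j i≡j)
  ... | tri< i<j _ _ with m≤n⇒m<n∨m≡n i<j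
  ...   | inj₁ far = ⊥-elim (ℕPath.ant P far j≤k e)
  ...   | inj₂ eq = inj₁ (sym eq)
  near P {i} {j} i≤k j≤k i≢j e | tri> _ _ j<i with m≤n⇒m<n∨m≡n j<i
  ...   | inj₁ far = ⊥-elim (ℕPath.ant P far i≤k (trans (θ-sym′ _ _) e))
  ...   | inj₂ eq = inj₂ (sym eq)

  -- Together with `cherryPath`, this builds the shortest links, so that the parity of a join can be
  -- read off from one or two adjacencies found inside an antipath.
  edgePath : ∀ {u v} → u ≢ v → θ u v ≢ n → ∃ λ p → ℕPath θ y n 1 p × p 0 ≡ u × p 1 ≡ v
  edgePath {u} {v} u≢v uv = p , record
    { dis = λ { {zero} {suc zero} _ _ → u≢v ; {_} {suc (suc _)} _ (s≤s ()) ; {suc _} {suc zero} (s≤s ()) _ }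
    ; adj = λ { {zero} _ → uv ; {suc _} (s≤s ()) }
    ; ant = λ { {_} {suc zero} (s≤s ()) _ ; {_} {suc (suc _)} _ (s≤s ()) } } , refl , refl
    where
    p : ℕ → V
    p zero = u
    p (suc _) = v

  cherryPath : ∀ {u v w} → u ≢ v → v ≢ w → u ≢ w → θ u v ≢ n → θ v w ≢ n → θ u w ≢ y →
               ∃ λ p → ℕPath θ y n 2 p × p 0 ≡ u × p 1 ≡ v × p 2 ≡ w
  cherryPath {u} {v} {w} uv vw uw auv avw auw = p , record
    { dis = λ { {zero} {suc zero} _ _ → uv ; {zero} {suc (suc zero)} _ _ → uw
              ; {suc zero} {suc (suc zero)} _ _ → vw
              ; {suc _} {suc zero} (s≤s ()) _ ; {suc (suc _)} {suc (suc zero)} (s≤s (s≤s ())) _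
              ; {_} {suc (suc (suc _))} _ (s≤s (s≤s ())) }
    ; adj = λ { {zero} _ → auv ; {suc zero} _ → avw ; {suc (suc _)} (s≤s (s≤s ())) }
    ; ant = λ { {zero} {suc (suc zero)} _ _ → auw ; {_} {suc zero} (s≤s ()) _
              ; {suc _} {suc (suc zero)} (s≤s (s≤s ())) _
              ; {_} {suc (suc (suc _))} _ (s≤s (s≤s ())) } } , refl , refl , refl
    where
    p : ℕ → V
    p zero = u
    p (suc zero) = v
    p (suc (suc _)) = w

-- Translation between the two encodings of paths

at : ∀ k → ℕ → Fin (suc k)
at k zero = zero
at zero (suc i) = zero
at (suc k) (suc i) = suc (at k i)

toℕ-at : ∀ {k i} → i ≤ k → toℕ (at k i) ≡ i
toℕ-at {i = zero} _ = refl
toℕ-at {suc k} {suc i} (s≤s i≤k) = cong suc (toℕ-at i≤k)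

at-last : ∀ k → at k k ≡ fromℕ k
at-last zero = refl
at-last (suc k) = cong suc (at-last k)

adjacent⇒≢neg : ∀ {a} → a ≡ pos ⊎ a ≡ swi → a ≢ neg
adjacent⇒≢neg (inj₁ refl) ()
adjacent⇒≢neg (inj₂ refl) ()

antiadjacent⇒≢pos : ∀ {a} → a ≡ neg ⊎ a ≡ swi → a ≢ pos
antiadjacent⇒≢pos (inj₁ refl) ()
antiadjacent⇒≢pos (inj₂ refl) ()

≢neg⇒adjacent : ∀ {a} → a ≢ neg → a ≡ pos ⊎ a ≡ swi
≢neg⇒adjacent {pos} _ = inj₁ refl
≢neg⇒adjacent {neg} e = ⊥-elim (e refl)
≢neg⇒adjacent {swi} _ = inj₂ refl

≢pos⇒antiadjacent : ∀ {a} → a ≢ pos → a ≡ neg ⊎ a ≡ swi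
≢pos⇒antiadjacent {pos} e = ⊥-elim (e refl)
≢pos⇒antiadjacent {neg} _ = inj₁ refl
≢pos⇒antiadjacent {swi} _ = inj₂ refl

negA-pos : ∀ {a} → negA a ≡ pos → a ≡ neg
negA-pos {neg} _ = refl

negA-neg : ∀ {a} → negA a ≡ neg → a ≡ pos
negA-neg {pos} _ = refl

complementPath : ∀ {V : Set} {θ : V → V → Adj} {k p} →
                 ℕPath θ neg pos k p → ℕPath (λ u v → negA (θ u v)) pos neg k p
complementPath P = record
  { dis = dis ; adj = λ i<k e → adj i<k (negA-neg e) ; ant = λ i<j j≤k e → ant i<j j≤k (negA-pos e) }
  where open ℕPath P

uncomplementPath : ∀ {V : Set} {θ : V → V → Adj} {k p} →
                   ℕPath (λ u v → negA (θ u v)) pos neg k p → ℕPath θ neg pos k p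
uncomplementPath P = record
  { dis = dis ; adj = λ i<k e → adj i<k (cong negA e) ; ant = λ i<j j≤k e → ant i<j j≤k (cong negA e) }
  where open ℕPath P

module _ {V : Set} {T : Trigraph V} where

  toℕPath : ∀ {k} (P : Path T k) → ℕPath (θ T) pos neg k (vtx P ∘ at k)
  toℕPath P = record
    { dis = λ i<j j≤k e → <-irrefl
        (trans (sym (toℕ-at (≤-trans (<⇒≤ i<j) j≤k))) (trans (cong toℕ (inj P _ _ e)) (toℕ-at j≤k))) i<j
    ; adj = λ i<k → adjacent⇒≢neg (cons P _ _ (trans (toℕ-at i<k) (cong suc (sym (toℕ-at (<⇒≤ i<k))))))
    ; ant = λ i<j j≤k → antiadjacent⇒≢pos (nonc P _ _
        (subst₂ (λ a b → suc (suc a) ≤ b) (sym (toℕ-at (≤-trans (<⇒≤ (<-trans (n<1+n _) i<j)) j≤k))) (sym (toℕ-at j≤k)) i<j)) }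

  fromℕPath : ∀ {k p} → ℕPath (θ T) pos neg k p → Path T k
  fromℕPath {k} {p} P = record
    { vtx = p ∘ toℕ
    ; inj = injective
    ; cons = λ i j e → ≢neg⇒adjacent (subst (λ a → θ T (p (toℕ i)) (p a) ≢ neg) (sym e)
               (adj (≤-pred (subst (_< suc k) e (toℕ<n j)))))
    ; nonc = λ i j i<j → ≢pos⇒antiadjacent (ant i<j (≤-pred (toℕ<n j))) }
    where
    open ℕPath P
    injective : ∀ i j → p (toℕ i) ≡ p (toℕ j) → i ≡ j
    injective i j e with <-cmp (toℕ i) (toℕ j)
    ... | tri< i<j _ _ = ⊥-elim (dis i<j (≤-pred (toℕ<n j)) e)
    ... | tri≈ _ i≡j _ = toℕ-injective i≡j
    ... | tri> _ _ j<i = ⊥-elim (dis j<i (≤-pred (toℕ<n i)) (sym e))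

-- Consequence of Bergeness: a path of odd length > 1 has no apex
-- joined exactly to its two ends, as this would close an odd hole.
NoCap : {V : Set} → (V → V → Adj) → Adj → Adj → Set
NoCap {V} θ y n = ∀ {k p} (x : V) → ℕPath θ y n k p → parity k ≡ oddP → 1 < k →
  (∀ i → i ≤ k → x ≢ p i) → θ x (p 0) ≢ n → θ x (p k) ≢ n →
  (∀ i → 0 < i → i < k → θ x (p i) ≢ y) → ⊥

capHole : ∀ {V} {T : Trigraph V} {k p} (x : V) → ℕPath (θ T) pos neg k p → 1 < k →
  (∀ i → i ≤ k → x ≢ p i) → θ T x (p 0) ≢ neg → θ T x (p k) ≢ neg →
  (∀ i → 0 < i → i < k → θ T x (p i) ≢ pos) → Hole T (2 + k)
capHole {V} {T} {k} {p} x P 1<k x∉ x0 xk xi = record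
  { four≤k = s≤s (s≤s 1<k) ; hv = hv ; hinj = hinj ; hadj = hadj ; hanti = hanti }
  where
  open ℕPath P
  hv : Fin (2 + k) → V
  hv zero = x
  hv (suc i) = p (toℕ i)
  le : (i : Fin (suc k)) → toℕ i ≤ k
  le i = ≤-pred (toℕ<n i)
  hinj : ∀ i j → hv i ≡ hv j → i ≡ j
  hinj zero zero e = refl
  hinj zero (suc j) e = ⊥-elim (x∉ _ (le j) e)
  hinj (suc i) zero e = ⊥-elim (x∉ _ (le i) (sym e))
  hinj (suc i) (suc j) e = cong suc (Path.inj (fromℕPath {T = T} P) i j e)
  hadj : ∀ i j → CycNext (2 + k) i j → Adjacent T (hv i) (hv j)
  hadj zero (suc zero) (inj₁ e) = ≢neg⇒adjacent x0
  hadj zero (suc (suc j)) (inj₁ ())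
  hadj (suc i) (suc j) (inj₁ e) = Path.cons (fromℕPath {T = T} P) i j (suc-injective e)
  hadj zero zero (inj₂ (() , _))
  hadj (suc i) zero (inj₂ (e , _)) = ≢neg⇒adjacent λ e′ →
    xk (trans (θ-sym T _ _) (trans (cong (λ a → θ T (p a) x) (sym (suc-injective (suc-injective e)))) e′))
  hanti : ∀ i j → i ≢ j → ¬ CycNext (2 + k) i j → ¬ CycNext (2 + k) j i → Antiadjacent T (hv i) (hv j)
  apex : ∀ j → ¬ CycNext (2 + k) zero (suc j) → ¬ CycNext (2 + k) (suc j) zero → θ T x (p (toℕ j)) ≢ pos
  apex j a b = xi _ (n≢0⇒n>0 λ e → a (inj₁ (cong suc e)))
    (≤∧≢⇒< (le j) λ e → b (inj₂ (cong (2 +_) e , refl)))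
  hanti zero zero i≢j _ _ = ⊥-elim (i≢j refl)
  hanti zero (suc j) _ a b = ≢pos⇒antiadjacent (apex j a b)
  hanti (suc i) zero _ a b = ≢pos⇒antiadjacent λ e → apex i b a (trans (θ-sym T _ _) e)
  hanti (suc i) (suc j) i≢j a b = ≢pos⇒antiadjacent λ e → far e
    where
    far : θ T (p (toℕ i)) (p (toℕ j)) ≡ pos → ⊥
    far e with near (θ-sym T) P (le i) (le j) (λ q → i≢j (cong suc (toℕ-injective q))) e
    ... | inj₁ q = a (inj₁ (cong suc q))
    ... | inj₂ q = b (inj₁ (cong suc q))

berge⇒noCap : ∀ {V} (T : Trigraph V) → Berge T → NoCap (θ T) pos neg
-- The apex and the `k + 1` path vertices form a hole of length `2 + k`, whose parity computes to
-- that of `k`.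
berge⇒noCap T (noHole , _) {k} x P o 1<k a b c d = noHole (2 + k) o (capHole {T = T} x P 1<k a b c d)

berge⇒noAnticap : ∀ {V} (T : Trigraph V) → Berge T → NoCap (θ T) neg pos
berge⇒noAnticap T (_ , noHole) {k} x P o 1<k a b c d = noHole (2 + k) o
  (capHole {T = complement T} x (complementPath P) 1<k a (b ∘ negA-neg) (c ∘ negA-neg)
     (λ i q r e → d i q r (negA-pos e)))

-- Balanced skew-partitions with a chosen splitting of both sides

-- y, n: values of strongly adjacent and strongly antiadjacent pairs;
-- l, r: colours of the side that is not connected and of the side that is not anticonnected.
data Sign : Adj → Adj → Bool → Bool → Set where
  plain        : Sign pos neg true false
  complemented : Sign neg pos false true

module _ {y n : Adj} {l r : Bool} where

  y≢n : Sign y n l r → y ≢ n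
  y≢n plain ()
  y≢n complemented ()

  swi≢y : Sign y n l r → swi ≢ y
  swi≢y plain ()
  swi≢y complemented ()

  swi≢n : Sign y n l r → swi ≢ n
  swi≢n plain ()
  swi≢n complemented ()

  l≢r : Sign y n l r → l ≢ r
  l≢r plain ()
  l≢r complemented ()

  l⊎r : Sign y n l r → ∀ b → b ≡ l ⊎ b ≡ r
  l⊎r plain true = inj₁ refl
  l⊎r plain false = inj₂ refl
  l⊎r complemented true = inj₂ refl
  l⊎r complemented false = inj₁ refl

  flipSign : Sign y n l r → Sign n y r l
  flipSign plain = complemented
  flipSign complemented = plain

NoOddPath : {V : Set} → (V → V → Adj) → Adj → Adj → Bool → Bool → (V → Bool) → Set
NoOddPath θ y n l r χ = ∀ {k p} → ℕPath θ y n k p → parity k ≡ oddP → 1 < k →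
  χ (p 0) ≡ r → χ (p k) ≡ r → (∀ i → 0 < i → i < k → χ (p i) ≡ l) → ⊥

-- ix distinguishes two nonempty unions of components of the side l
-- and two nonempty unions of anticomponents of the side r.
record BalancedSplit {V : Set} (θ : V → V → Adj) (y n : Adj) (l r : Bool) (χ ix : V → Bool) : Set where
  field
    sepL : ∀ {u v} → χ u ≡ l → χ v ≡ l → ix u ≢ ix v → θ u v ≡ n
    sepR : ∀ {u v} → χ u ≡ r → χ v ≡ r → ix u ≢ ix v → θ u v ≡ y
    inhL : ∀ i → ∃ λ v → χ v ≡ l × ix v ≡ i
    inhR : ∀ i → ∃ λ v → χ v ≡ r × ix v ≡ i
    noPath : NoOddPath θ y n l r χ
    noAntipath : NoOddPath θ n y r l χ

-- The record is symmetric under complementation, so each statement proved for one sign also covers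
-- the other.
flipSplit : ∀ {V : Set} {θ : V → V → Adj} {y n l r χ ix} →
            BalancedSplit θ y n l r χ ix → BalancedSplit θ n y r l χ ix
flipSplit S = record { sepL = sepR ; sepR = sepL ; inhL = inhR ; inhR = inhL
                     ; noPath = noAntipath ; noAntipath = noPath }
  where open BalancedSplit S

-- Joins

data Cls : Set where
  kept mid : Cls
  end : Bool → Cls

end-injective : ∀ {K K′} → end K ≡ end K′ → K ≡ K′
end-injective refl = refl

val : Adj → Adj → Bool → Adj
val y n true = y
val y n false = n

-- A common generalisation of a 2-join (θ′ being the block of the side kept,
-- and end true, end false, mid the sets A₂, B₂, C₂) and of a homogeneous
-- pair (end true, end false), where a kept vertex may see both ends.
record Join {V V′ : Set} (θ : V → V → Adj) (θ′ : V′ → V′ → Adj) (y n : Adj) (par : Parity) : Set where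
  field
    θ-symm : ∀ u v → θ u v ≡ θ v u
    θ′-symm : ∀ u v → θ′ u v ≡ θ′ v u
    cls : V → Cls
    sees : V → Bool → Bool
    θ-end : ∀ {u v K} → cls u ≡ kept → cls v ≡ end K → θ u v ≡ val y n (sees u K)
    θ-mid : ∀ {u v} → cls u ≡ kept → cls v ≡ mid → θ u v ≡ n
    f : V → V′
    mk : Bool → V′
    mc : V′
    f-end : ∀ {v K} → cls v ≡ end K → f v ≡ mk K
    f-mid : ∀ {v} → cls v ≡ mid → f v ≡ mc
    f-inj : ∀ {u v} → cls u ≡ kept → cls v ≡ kept → f u ≡ f v → u ≡ v
    f≢mk : ∀ {u} K → cls u ≡ kept → f u ≢ mk K
    mk≢mk : ∀ K → mk K ≢ mk (not K)
    θ′-kept : ∀ {u v} → cls u ≡ kept → cls v ≡ kept → θ′ (f u) (f v) ≡ θ u v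
    θ′-end : ∀ {u} K → cls u ≡ kept → θ′ (f u) (mk K) ≡ val y n (sees u K)
    odd-mk : par ≡ oddP → ∀ K → θ′ (mk K) (mk (not K)) ≡ swi
    even-mk : par ≡ evenP → ∀ K → θ′ (mk K) (mk (not K)) ≡ n
    even-mc : par ≡ evenP → ∀ K → θ′ (mk K) mc ≡ swi
    even-mk≢mc : par ≡ evenP → ∀ K → mk K ≢ mc
    even-kept : ∀ {u} → par ≡ evenP → cls u ≡ kept → θ′ (f u) mc ≡ n
    even-f≢mc : ∀ {u} → par ≡ evenP → cls u ≡ kept → f u ≢ mc
    linkParity : ∀ {k p} K → ℕPath θ y n k p → cls (p 0) ≡ end K → cls (p k) ≡ end (not K) →
                 (∀ i → 0 < i → i < k → cls (p i) ≡ mid) → parity k ≡ par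
    private-neighbour : ∀ K → ∃ λ z → cls z ≡ kept × sees z K ≡ true × sees z (not K) ≡ false
    end-inhabited : ∀ K → ∃ λ v → cls v ≡ end K
    cover : ∀ w → (∃ λ v → cls v ≡ kept × w ≡ f v) ⊎ (∃ λ K → w ≡ mk K) ⊎ w ≡ mc

-- Colours of the markers of a join

module Markers {V V′ : Set} {θ : V → V → Adj} {θ′ : V′ → V′ → Adj} {y n l r par}
  (sg : Sign y n l r) (J : Join θ θ′ y n par)
  {χ′ ix′ : V′ → Bool} (S : BalancedSplit θ′ y n l r χ′ ix′)
  where

  open Join J
  open BalancedSplit S

  mk-mk≢y : ∀ K → θ′ (mk K) (mk (not K)) ≢ y
  mk-mk≢y K e with even⊎odd par
  ... | inj₁ q = y≢n sg (trans (sym e) (even-mk q K))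
  ... | inj₂ q = swi≢y sg (trans (sym (odd-mk q K)) e)

  -- A switchable pair is both adjacent and antiadjacent, so neither the components of one side nor
  -- the anticomponents of the other can separate it.
  ix-mc : par ≡ evenP → χ′ mc ≡ l → ∀ K → χ′ (mk K) ≡ l → ix′ mc ≡ ix′ (mk K)
  ix-mc ev χmc K χK with ix′ (mk K) ≟ᵇ ix′ mc
  ... | yes e = sym e
  ... | no ne = ⊥-elim (swi≢n sg (trans (sym (even-mc ev K)) (sepL χK χmc ne)))

  -- In an odd join the end markers are themselves switchable; in an even join the third marker,
  -- also coloured `l`, ties them together.
  ix-mk : χ′ mc ≡ l → ∀ K → χ′ (mk K) ≡ l → χ′ (mk (not K)) ≡ l → ix′ (mk (not K)) ≡ ix′ (mk K)
  ix-mk χmc K χK χK′ with even⊎odd par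
  ... | inj₁ ev = trans (sym (ix-mc ev χmc (not K) χK′)) (ix-mc ev χmc K χK)
  ... | inj₂ od with ix′ (mk K) ≟ᵇ ix′ (mk (not K))
  ...   | yes e = sym e
  ...   | no ne = ⊥-elim (swi≢n sg (trans (sym (odd-mk od K)) (sepL χK χK′ ne)))

  -- No vertex has value `y` to `mc`: kept vertices have `n` and the end markers `swi`. On the side
  -- `r` it would need this value to every vertex of the other part.
  mc-left : par ≡ evenP → χ′ mc ≡ l
  mc-left ev with l⊎r sg (χ′ mc)
  ... | inj₁ e = e
  ... | inj₂ χmc with inhR (not (ix′ mc))
  ...   | w , χw , ixw = ⊥-elim (impossible (cover w))
    where
    ne : ix′ w ≢ ix′ mc
    ne e = not-¬ refl (trans (sym e) ixw)
    impossible : (∃ λ v → cls v ≡ kept × w ≡ f v) ⊎ (∃ λ K → w ≡ mk K) ⊎ w ≡ mc → ⊥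
    impossible (inj₁ (v , c , refl)) = y≢n sg (trans (sym (sepR χw χmc ne)) (even-kept ev c))
    impossible (inj₂ (inj₁ (K , refl))) = swi≢y sg (trans (sym (even-mc ev K)) (sepR χw χmc ne))
    impossible (inj₂ (inj₂ refl)) = ne refl

  -- Two end markers coloured `r` lie in one part, as their value is not `y`. A vertex of the other
  -- part can then only be a kept vertex seeing both ends. The hypothesis `exclusive` rules this
  -- out; it fails for vertices complete to both members of a homogeneous pair.
  not-both-right : (∀ {u} → cls u ≡ kept → sees u true ≡ true → sees u false ≡ true → ⊥) →
                   χ′ mc ≡ l ⊎ (∃ λ K → mc ≡ mk K) →
                   χ′ (mk true) ≡ r → χ′ (mk false) ≡ r → ⊥
  not-both-right exclusive mc-case χt χf with inhR (not (ix′ (mk true)))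
  ... | w , χw , ixw = impossible (cover w)
    where
    same : ix′ (mk true) ≡ ix′ (mk false)
    same with ix′ (mk true) ≟ᵇ ix′ (mk false)
    ... | yes e = e
    ... | no ne = ⊥-elim (mk-mk≢y true (sepR χt χf ne))
    ne : ix′ w ≢ ix′ (mk true)
    ne e = not-¬ refl (trans (sym e) ixw)
    not-mk : ∀ K → w ≢ mk K
    not-mk true refl = ne refl
    not-mk false refl = ne (sym same)
    not-mc : χ′ mc ≡ l ⊎ (∃ λ K → mc ≡ mk K) → w ≢ mc
    not-mc (inj₁ e) q = l≢r sg (trans (sym e) (trans (cong χ′ (sym q)) χw))
    not-mc (inj₂ (K , e)) q = not-mk K (trans q e)
    seen : ∀ {u K} → θ′ (f u) (mk K) ≡ y → cls u ≡ kept → sees u K ≡ true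
    seen {u} {K} e c with sees u K in q
    ... | true = refl
    ... | false = ⊥-elim (y≢n sg (trans (sym e) (trans (θ′-end K c) (cong (val y n) q))))
    impossible : (∃ λ v → cls v ≡ kept × w ≡ f v) ⊎ (∃ λ K → w ≡ mk K) ⊎ w ≡ mc → ⊥
    impossible (inj₁ (v , c , refl)) = exclusive c (seen (sepR χw χt ne) c)
      (seen (sepR χw χf (λ e → ne (trans e (sym same)))) c)
    impossible (inj₂ (inj₁ (K , e))) = not-mk K e
    impossible (inj₂ (inj₂ e)) = not-mc mc-case e

-- Pulling a split back along a join when the marker of `end K₀` is coloured `l`

module JoinTransfer {V V′ : Set} {θ : V → V → Adj} {θ′ : V′ → V′ → Adj} {y n l r par}
  (sg : Sign y n l r) (J : Join θ θ′ y n par)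
  (noCap : NoCap θ y n) (noAnticap : NoCap θ n y)
  {χ′ ix′ : V′ → Bool} (S : BalancedSplit θ′ y n l r χ′ ix′)
  (K₀ : Bool) (χK₀ : χ′ (Join.mk J K₀) ≡ l)
  (χmc : χ′ (Join.mc J) ≡ l) (ixmc : ix′ (Join.mc J) ≡ ix′ (Join.mk J K₀))
  (ixK₁ : χ′ (Join.mk J (not K₀)) ≡ l → ix′ (Join.mk J (not K₀)) ≡ ix′ (Join.mk J K₀))
  where

  open Join J
  open BalancedSplit S
  open Markers sg J S using (mk-mk≢y)

  χ ix : V → Bool
  χ = χ′ ∘ f
  ix = ix′ ∘ f

  kept? : ∀ v → Dec (cls v ≡ kept)
  kept? v with cls v
  ... | kept = yes refl
  ... | mid = no λ ()
  ... | end _ = no λ ()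

  end? : ∀ K v → Dec (cls v ≡ end K)
  end? K v with cls v
  ... | kept = no λ ()
  ... | mid = no λ ()
  ... | end K′ with K′ ≟ᵇ K
  ...   | yes refl = yes refl
  ...   | no K′≢K = no (K′≢K ∘ end-injective)

  clash : ∀ {v a b} → cls v ≡ a → cls v ≡ b → a ≢ b → ⊥
  clash e₁ e₂ a≢b = a≢b (trans (sym e₁) e₂)

  end-clash : ∀ {v} K → cls v ≡ end K → cls v ≡ end (not K) → ⊥
  end-clash K e₁ e₂ = not-¬ refl (end-injective (trans (sym e₁) e₂))

  data View (v : V) : Set where
    isKept : cls v ≡ kept → View v
    isMid : cls v ≡ mid → View v
    isEnd₀ : cls v ≡ end K₀ → View v
    isEnd₁ : cls v ≡ end (not K₀) → View v

  view : ∀ v → View v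
  view v with cls v in eq
  ... | kept = isKept eq
  ... | mid = isMid eq
  ... | end K with K ≟ᵇ K₀
  ...   | yes refl = isEnd₀ eq
  ...   | no K≢K₀ = isEnd₁ (trans eq (cong end (¬-not K≢K₀)))

  l-r : ∀ {b} → b ≡ l → b ≡ r → ⊥
  l-r e₁ e₂ = l≢r sg (trans (sym e₁) e₂)

  χ-end : ∀ {v K} → cls v ≡ end K → χ v ≡ χ′ (mk K)
  χ-end e = cong χ′ (f-end e)

  χ-end₀ : ∀ {v} → cls v ≡ end K₀ → χ v ≡ l
  χ-end₀ e = trans (χ-end e) χK₀

  χ-mid : ∀ {v} → cls v ≡ mid → χ v ≡ l
  χ-mid e = trans (cong χ′ (f-mid e)) χmc

  r⇒kept⊎end₁ : ∀ {v} → χ v ≡ r → cls v ≡ kept ⊎ cls v ≡ end (not K₀)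
  r⇒kept⊎end₁ {v} e with view v
  ... | isKept c = inj₁ c
  ... | isMid c = ⊥-elim (l-r (χ-mid c) e)
  ... | isEnd₀ c = ⊥-elim (l-r (χ-end₀ c) e)
  ... | isEnd₁ c = inj₂ c

  θ-seen : ∀ {u v K} → cls u ≡ kept → cls v ≡ end K → sees u K ≡ true → θ u v ≡ y
  θ-seen cu cv e = trans (θ-end cu cv) (cong (val y n) e)

  θ-unseen : ∀ {u v K} → cls u ≡ kept → cls v ≡ end K → sees u K ≡ false → θ u v ≡ n
  θ-unseen cu cv e = trans (θ-end cu cv) (cong (val y n) e)

  ≢n⇒sees : ∀ {u v K} → cls u ≡ kept → cls v ≡ end K → θ u v ≢ n → sees u K ≡ true
  ≢n⇒sees {u} {v} {K} cu cv ne with sees u K in eq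
  ... | true = refl
  ... | false = ⊥-elim (ne (θ-unseen cu cv eq))

  ≢y⇒¬sees : ∀ {u v K} → cls u ≡ kept → cls v ≡ end K → θ u v ≢ y → sees u K ≡ false
  ≢y⇒¬sees {u} {v} {K} cu cv ne with sees u K in eq
  ... | false = refl
  ... | true = ⊥-elim (ne (θ-seen cu cv eq))

  ≢-symm : ∀ {u v a} → θ u v ≢ a → θ v u ≢ a
  ≢-symm ne e = ne (trans (θ-symm _ _) e)

  -- Such a pair is itself a link, of length one.
  linked⇒odd : ∀ {u v} K → cls u ≡ end K → cls v ≡ end (not K) → θ u v ≢ n → par ≡ oddP
  linked⇒odd {u} {v} K cu cv ne
    with edgePath θ-symm {y = y} (λ u≡v → end-clash K cu (trans (cong cls u≡v) cv)) ne
  ... | p , P , e₀ , e₁ = sym (linkParity K P (trans (cong cls e₀) cu) (trans (cong cls e₁) cv)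
          λ { (suc _) _ (s≤s ()) })

  -- Collapsing mid onto mc preserves adjacency to kept vertices only when mc is a marker of its own.
  Faithful : V → Set
  Faithful v = cls v ≡ mid → par ≡ evenP

  transferˡ : ∀ {u v} → u ≢ v → cls u ≡ kept → Faithful v → f u ≢ f v × θ′ (f u) (f v) ≡ θ u v
  transferˡ {u} {v} u≢v cu ok with cls v in eq
  ... | kept = (u≢v ∘ f-inj cu eq) , θ′-kept cu eq
  ... | mid = (λ e → even-f≢mc (ok refl) cu (trans e (f-mid eq))) ,
              trans (cong (θ′ (f u)) (f-mid eq)) (trans (even-kept (ok refl) cu) (sym (θ-mid cu eq)))
  ... | end K = (λ e → f≢mk K cu (trans e (f-end eq))) ,
                trans (cong (θ′ (f u)) (f-end eq)) (trans (θ′-end K cu) (sym (θ-end cu eq)))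

  transfer : ∀ {u v} → u ≢ v → cls u ≡ kept ⊎ cls v ≡ kept → Faithful u → Faithful v →
             f u ≢ f v × θ′ (f u) (f v) ≡ θ u v
  transfer u≢v (inj₁ cu) _ ok = transferˡ u≢v cu ok
  transfer u≢v (inj₂ cv) ok _ with transferˡ (≢-sym u≢v) cv ok
  ... | ne , e = ≢-sym ne , trans (θ′-symm _ _) (trans e (θ-symm _ _))

  -- Images and contractions of paths

  module _ {a b : Adj} {k : ℕ} {p : ℕ → V} (P : ℕPath θ a b k p) where
    open ℕPath P

    Fits : ℕ → ℕ → Set
    Fits i j = f (p i) ≢ f (p j)
             × (j ≡ suc i → θ′ (f (p i)) (f (p j)) ≢ b)
             × (suc i < j → θ′ (f (p i)) (f (p j)) ≢ a)

    fits : ∀ {i j} → i < j → j ≤ k → cls (p i) ≡ kept ⊎ cls (p j) ≡ kept →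
           Faithful (p i) → Faithful (p j) → Fits i j
    fits i<j j≤k c oki okj with transfer (dis i<j j≤k) c oki okj
    ... | ne , e = ne , (λ { refl e′ → adj j≤k (trans (sym e) e′) }) , (λ far e′ → ant far j≤k (trans (sym e) e′))

    -- Values at a kept vertex are preserved by `transfer`. Only pairs outside the kept side can
    -- collapse or change value, and these are left to the caller.
    image : (∀ i → i ≤ k → Faithful (p i)) →
            (∀ {i j} → i < j → j ≤ k → cls (p i) ≢ kept → cls (p j) ≢ kept → Fits i j) →
            ℕPath θ′ a b k (f ∘ p)
    image ok both = record
      { dis = λ i<j j≤k → proj₁ (all i<j j≤k)
      ; adj = λ i<k → proj₁ (proj₂ (all ≤-refl i<k)) refl
      ; ant = λ far j≤k → proj₂ (proj₂ (all (<-trans (n<1+n _) far) j≤k)) far }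
      where
      all : ∀ {i j} → i < j → j ≤ k → Fits i j
      all {i} {j} i<j j≤k with kept? (p i) | kept? (p j)
      ... | yes c | _ = fits i<j j≤k (inj₁ c) (ok i (≤-trans (<⇒≤ i<j) j≤k)) (ok j j≤k)
      ... | no _ | yes c = fits i<j j≤k (inj₂ c) (ok i (≤-trans (<⇒≤ i<j) j≤k)) (ok j j≤k)
      ... | no c | no c′ = both i<j j≤k c c′

  skip : ℕ → ℕ → ℕ → ℕ
  skip s d i with i ≤? s
  ... | yes _ = i
  ... | no _ = d + i

  skip-≤ : ∀ {s d i} → i ≤ s → skip s d i ≡ i
  skip-≤ {s} {d} {i} i≤s with i ≤? s
  ... | yes _ = refl
  ... | no i≰s = ⊥-elim (i≰s i≤s)

  skip-> : ∀ {s d i} → s < i → skip s d i ≡ d + i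
  skip-> {s} {d} {i} s<i with i ≤? s
  ... | yes i≤s = ⊥-elim (<⇒≱ s<i i≤s)
  ... | no _ = refl

  -- Deleting the d vertices that follow p s, so that p (suc (d + s)) becomes the successor of p s.
  module _ {k : ℕ} {p : ℕ → V} (P : ℕPath θ y n k p) (s d k′ : ℕ) (d+k′≡k : d + k′ ≡ k) (s<k′ : s < k′)
    (ok : ∀ i → i ≤ k → i ≤ s ⊎ d + s < i → Faithful (p i))
    (both : ∀ {i j} → i < j → j ≤ k → i ≤ s ⊎ d + s < i → j ≤ s ⊎ d + s < j →
            cls (p i) ≢ kept → cls (p j) ≢ kept →
            f (p i) ≢ f (p j) × (j ≡ suc i → θ′ (f (p i)) (f (p j)) ≢ n)
            × (suc i < j → i ≢ s ⊎ j ≢ suc (d + s) → θ′ (f (p i)) (f (p j)) ≢ y))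
    (glue : θ′ (f (p s)) (f (p (suc (d + s)))) ≢ n) where
    open ℕPath P

    private
      FitsSkip : ℕ → ℕ → Set
      FitsSkip i j = f (p i) ≢ f (p j)
                   × (j ≡ suc i → θ′ (f (p i)) (f (p j)) ≢ n)
                   × (suc i < j → i ≢ s ⊎ j ≢ suc (d + s) → θ′ (f (p i)) (f (p j)) ≢ y)

      old : ∀ {i j} → i < j → j ≤ k → i ≤ s ⊎ d + s < i → j ≤ s ⊎ d + s < j → FitsSkip i j
      old {i} {j} i<j j≤k ki kj with kept? (p i) | kept? (p j)
      ... | no c | no c′ = both i<j j≤k ki kj c c′
      ... | yes c | _ with fits P i<j j≤k (inj₁ c) (ok i (≤-trans (<⇒≤ i<j) j≤k) ki) (ok j j≤k kj)
      ...   | ne , e₁ , e₂ = ne , e₁ , λ far _ → e₂ far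
      old {i} {j} i<j j≤k ki kj | no _ | yes c
        with fits P i<j j≤k (inj₂ c) (ok i (≤-trans (<⇒≤ i<j) j≤k) ki) (ok j j≤k kj)
      ...   | ne , e₁ , e₂ = ne , e₁ , λ far _ → e₂ far

      q : ℕ → V′
      q i = f (p (skip s d i))

      new : ∀ {i j} → i < j → j ≤ k′ →
            q i ≢ q j × (j ≡ suc i → θ′ (q i) (q j) ≢ n) × (suc i < j → θ′ (q i) (q j) ≢ y)
      new {i} {j} i<j j≤k′ with i ≤? s | j ≤? s
      ... | yes i≤s | yes j≤s with old i<j (≤-trans j≤k′ (subst (k′ ≤_) d+k′≡k (m≤n+m k′ d))) (inj₁ i≤s) (inj₁ j≤s)
      ...   | ne , e₁ , e₂ = ne , e₁ , λ far → e₂ far (inj₁ (<⇒≢ (≤-trans i<j j≤s)))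
      new {i} {j} i<j j≤k′ | no i≰s | yes j≤s = ⊥-elim (i≰s (≤-trans (<⇒≤ i<j) j≤s))
      new {i} {j} i<j j≤k′ | no i≰s | no j≰s
        with old {d + i} {d + j} (+-monoʳ-< d i<j) (subst (d + j ≤_) d+k′≡k (+-monoʳ-≤ d j≤k′))
               (inj₂ (+-monoʳ-< d (≰⇒> i≰s))) (inj₂ (+-monoʳ-< d (≰⇒> j≰s)))
      ...   | ne , e₁ , e₂ = ne , (λ { refl → e₁ (+-suc d i) })
                           , λ far → e₂ (subst (_< d + j) (+-suc d i) (+-monoʳ-< d far))
                                        (inj₁ (≢-sym (<⇒≢ (≤-trans (≰⇒> i≰s) (m≤n+m i d)))))
      -- The indices lie on different sides of the gap. The only new consecutive pair is the one
      -- covered by `glue`, and `apart` shows that a pair still far apart is a different one.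
      new {i} {j} i<j j≤k′ | yes i≤s | no j≰s
        with old {i} {d + j} (≤-trans i<j (m≤n+m j d)) (subst (d + j ≤_) d+k′≡k (+-monoʳ-≤ d j≤k′))
               (inj₁ i≤s) (inj₂ (+-monoʳ-< d (≰⇒> j≰s)))
      ...   | ne , e₁ , e₂ = ne
          , (λ { refl → subst₂ (λ a b → θ′ (f (p a)) (f (p b)) ≢ n)
                   (≤-antisym (≤-pred (≰⇒> j≰s)) i≤s)
                   (trans (cong (λ a → suc (d + a)) (≤-antisym (≤-pred (≰⇒> j≰s)) i≤s)) (sym (+-suc d i))) glue })
          , λ far → e₂ (≤-trans far (m≤n+m j d)) (apart far)
          where
          apart : suc i < j → i ≢ s ⊎ d + j ≢ suc (d + s)
          apart far with i ≟ s
          ... | no i≢s = inj₁ i≢s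
          ... | yes refl = inj₂ λ e → <-irrefl (sym (+-cancelˡ-≡ d j (suc i) (trans e (sym (+-suc d i))))) far

    contract : ℕPath θ′ y n k′ (λ i → f (p (skip s d i)))
    contract = record
      { dis = λ i<j j≤k → proj₁ (new i<j j≤k)
      ; adj = λ i<k → proj₁ (proj₂ (new ≤-refl i<k)) refl
      ; ant = λ far j≤k → proj₂ (proj₂ (new (<-trans (n<1+n _) far) j≤k)) far }

  -- Odd paths through a join, with ends coloured `r` and interior coloured `l`

  module PathHalf {k : ℕ} {p : ℕ → V} (P : ℕPath θ y n k p) (odd : parity k ≡ oddP) (1<k : 1 < k)
    (χ0 : χ (p 0) ≡ r) (χk : χ (p k) ≡ r) (χi : ∀ i → 0 < i → i < k → χ (p i) ≡ l) where
    open ℕPath P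

    direct : (∀ i → i ≤ k → Faithful (p i)) →
             (∀ {i j} → i < j → j ≤ k → cls (p i) ≢ kept → cls (p j) ≢ kept → Fits P i j) → ⊥
    direct ok both = noPath (image P ok both) odd 1<k χ0 χk χi

    -- Deleting an even number `d` of vertices keeps the length odd, and `s < k′` places the gap
    -- before the last vertex, so both path ends survive with their colour.
    finish : ∀ s d k′ → d + k′ ≡ k → s < k′ → parity d ≡ evenP → 1 < k′ →
             ℕPath θ′ y n k′ (λ i → f (p (skip s d i))) → ⊥
    finish s d k′ eq s<k′ ev 1<k′ Q = noPath Q
      (trans (sym (parity-even-+ d k′ ev)) (trans (cong parity eq) odd)) 1<k′
      (trans (cong (χ ∘ p) (skip-≤ {s} {d} z≤n)) χ0)
      (trans (cong (χ ∘ p) (trans (skip-> s<k′) eq)) χk)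
      inner
      where
      inner : ∀ i → 0 < i → i < k′ → χ (p (skip s d i)) ≡ l
      inner i 0<i i<k′ with i ≤? s
      ... | yes _ = χi i 0<i (≤-trans i<k′ (subst (k′ ≤_) eq (m≤n+m k′ d)))
      ... | no _ = χi (d + i) (≤-trans 0<i (m≤n+m i d)) (subst (d + i <_) eq (+-monoʳ-< d i<k′))

    no-kept : ∀ {i K} → cls (p i) ≡ end K → cls (p i) ≢ kept
    no-kept e e′ = clash e e′ λ ()

    -- An `end` vertex is `Faithful` vacuously, so the pair at `s` and `t` is the only one that can
    -- go wrong.
    two-ends : ∀ s t → s ≤ t → ∀ {K K′} → cls (p s) ≡ end K → cls (p t) ≡ end K′ →
               (∀ i → i ≤ k → cls (p i) ≢ kept → i ≡ s ⊎ i ≡ t) → (s < t → Fits P s t) → ⊥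
    two-ends s t s≤t cs ct only pair = direct faithful both
      where
      faithful : ∀ i → i ≤ k → Faithful (p i)
      faithful i i≤k m with only i i≤k (λ e → clash m e λ ())
      ... | inj₁ refl = ⊥-elim (clash m cs λ ())
      ... | inj₂ refl = ⊥-elim (clash m ct λ ())
      both : ∀ {i j} → i < j → j ≤ k → cls (p i) ≢ kept → cls (p j) ≢ kept → Fits P i j
      both {i} {j} i<j j≤k ci cj with only i (≤-trans (<⇒≤ i<j) j≤k) ci | only j j≤k cj
      ... | inj₁ refl | inj₁ refl = ⊥-elim (<-irrefl refl i<j)
      ... | inj₁ refl | inj₂ refl = pair i<j
      ... | inj₂ refl | inj₁ refl = ⊥-elim (<⇒≱ i<j s≤t)
      ... | inj₂ refl | inj₂ refl = ⊥-elim (<-irrefl refl i<j)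

    -- The link has `suc d` edges and parity `par`; it shrinks to one edge between the end markers
    -- if odd and to two edges through `mc` if even, an even loss in both cases. Here `e` is the
    -- length of the rest of the path, and `0 < s + e` keeps the odd contraction longer than one
    -- edge.
    linked : ∀ s d e → suc (d + s) + e ≡ k → ∀ K →
             cls (p s) ≡ end K → cls (p (suc (d + s))) ≡ end (not K) →
             (∀ i → i ≤ k → cls (p i) ≢ kept → s ≤ i × i ≤ suc (d + s)) →
             (∀ i → s < i → i < suc (d + s) → cls (p i) ≡ mid) → 0 < s + e → ⊥
    linked s d e eq K cs ct inside mids 0<s+e = by-parity (even⊎odd par)
      where
      t = suc (d + s)
      t≤k : t ≤ k
      t≤k = subst (t ≤_) eq (m≤m+n t e)
      link : parity (suc d) ≡ par
      link = linkParity K (subpath P s (suc d) t≤k) cs ct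
               λ i 0<i i<d → mids (i + s) (+-monoˡ-≤ s 0<i) (+-monoˡ-< s i<d)
      ff : f (p s) ≢ f (p t)
      ff q = mk≢mk K (trans (sym (f-end cs)) (trans q (f-end ct)))
      θst : θ′ (f (p s)) (f (p t)) ≡ θ′ (mk K) (mk (not K))
      θst = cong₂ θ′ (f-end cs) (f-end ct)

      by-parity : par ≡ evenP ⊎ par ≡ oddP → ⊥
      by-parity (inj₂ par-odd) = finish s d (suc (s + e)) eq′ (s≤s (m≤m+n s e))
          (parity-suc d (trans link par-odd)) (s≤s 0<s+e)
          (contract P s d (suc (s + e)) eq′ (s≤s (m≤m+n s e)) faithful both
            λ q → swi≢n sg (trans (sym (odd-mk par-odd K)) (trans (sym θst) q)))
        where
        eq′ : d + suc (s + e) ≡ k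
        eq′ = trans (+-suc d (s + e)) (trans (cong suc (sym (+-assoc d s e))) eq)
        only : ∀ i → i ≤ k → i ≤ s ⊎ d + s < i → cls (p i) ≢ kept → i ≡ s ⊎ i ≡ t
        only i i≤k (inj₁ i≤s) c = inj₁ (≤-antisym i≤s (proj₁ (inside i i≤k c)))
        only i i≤k (inj₂ t≤i) c = inj₂ (≤-antisym (proj₂ (inside i i≤k c)) t≤i)
        faithful : ∀ i → i ≤ k → i ≤ s ⊎ d + s < i → Faithful (p i)
        faithful i i≤k ki m with only i i≤k ki (λ e → clash m e λ ())
        ... | inj₁ refl = ⊥-elim (clash m cs λ ())
        ... | inj₂ refl = ⊥-elim (clash m ct λ ())
        both : ∀ {i j} → i < j → j ≤ k → i ≤ s ⊎ d + s < i → j ≤ s ⊎ d + s < j →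
               cls (p i) ≢ kept → cls (p j) ≢ kept →
               f (p i) ≢ f (p j) × (j ≡ suc i → θ′ (f (p i)) (f (p j)) ≢ n)
               × (suc i < j → i ≢ s ⊎ j ≢ t → θ′ (f (p i)) (f (p j)) ≢ y)
        both {i} {j} i<j j≤k ki kj ci cj with only i (≤-trans (<⇒≤ i<j) j≤k) ki ci | only j j≤k kj cj
        ... | inj₁ refl | inj₁ refl = ⊥-elim (<-irrefl refl i<j)
        ... | inj₂ refl | inj₁ refl = ⊥-elim (<⇒≱ i<j (m≤n⇒m≤1+n (m≤n+m s d)))
        ... | inj₂ refl | inj₂ refl = ⊥-elim (<-irrefl refl i<j)
        ... | inj₁ refl | inj₂ refl = ff
            , (λ _ q → swi≢n sg (trans (sym (odd-mk par-odd K)) (trans (sym θst) q)))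
            , (λ { _ (inj₁ ne) → ⊥-elim (ne refl) ; _ (inj₂ ne) → ⊥-elim (ne refl) })
      by-parity (inj₁ par-even) = even-case d refl
        where
        even-case : ∀ d₀ → d ≡ d₀ → ⊥
        even-case zero refl = odd≢even (sym link) par-even
        -- An even link has an interior vertex. The last one, at `m`, survives to be sent to `mc`,
        -- and the other `d′` are deleted.
        even-case (suc d′) refl = finish s d′ (suc (suc (s + e))) eq′ s<k′
            (trans link par-even) (s≤s (s≤s z≤n))
            (contract P s d′ (suc (suc (s + e))) eq′ s<k′ (λ _ _ _ _ → par-even) both
              λ q → swi≢n sg (trans (sym θsm) q))
          where
          s<k′ : s < suc (suc (s + e))
          s<k′ = s≤s (m≤n⇒m≤1+n (m≤m+n s e))
          eq′ : d′ + suc (suc (s + e)) ≡ k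
          eq′ = trans (+-suc d′ _) (trans (cong suc (+-suc d′ _)) (trans (cong (2 +_) (sym (+-assoc d′ s e))) eq))
          m = suc (d′ + s)
          cm : cls (p m) ≡ mid
          cm = mids m (s≤s (m≤n+m s d′)) ≤-refl
          θsm : θ′ (f (p s)) (f (p m)) ≡ swi
          θsm = trans (cong₂ θ′ (f-end cs) (f-mid cm)) (even-mc par-even K)
          θmt : θ′ (f (p m)) (f (p t)) ≡ swi
          θmt = trans (cong₂ θ′ (f-mid cm) (f-end ct)) (trans (θ′-symm _ _) (even-mc par-even (not K)))
          where-is : ∀ i → i ≤ k → i ≤ s ⊎ d′ + s < i → cls (p i) ≢ kept → i ≡ s ⊎ i ≡ m ⊎ i ≡ t
          where-is i i≤k (inj₁ i≤s) c = inj₁ (≤-antisym i≤s (proj₁ (inside i i≤k c)))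
          where-is i i≤k (inj₂ m≤i) c with m≤n⇒m<n∨m≡n m≤i
          ... | inj₂ m≡i = inj₂ (inj₁ (sym m≡i))
          ... | inj₁ t≤i = inj₂ (inj₂ (≤-antisym (proj₂ (inside i i≤k c)) t≤i))
          s<m : s < m
          s<m = s≤s (m≤n+m s d′)
          both : ∀ {i j} → i < j → j ≤ k → i ≤ s ⊎ d′ + s < i → j ≤ s ⊎ d′ + s < j →
                 cls (p i) ≢ kept → cls (p j) ≢ kept →
                 f (p i) ≢ f (p j) × (j ≡ suc i → θ′ (f (p i)) (f (p j)) ≢ n)
                 × (suc i < j → i ≢ s ⊎ j ≢ m → θ′ (f (p i)) (f (p j)) ≢ y)
          both {i} {j} i<j j≤k ki kj ci cj
            with where-is i (≤-trans (<⇒≤ i<j) j≤k) ki ci | where-is j j≤k kj cj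
          ... | inj₁ refl | inj₁ refl = ⊥-elim (<-irrefl refl i<j)
          ... | inj₁ refl | inj₂ (inj₁ refl) =
              (λ q → even-mk≢mc par-even K (trans (sym (f-end cs)) (trans q (f-mid cm))))
            , (λ _ q → swi≢n sg (trans (sym θsm) q)) , λ _ _ q → swi≢y sg (trans (sym θsm) q)
          ... | inj₁ refl | inj₂ (inj₂ refl) = ff
            , (λ q → ⊥-elim (<⇒≢ s<m (sym (suc-injective q))))
            , λ _ _ q → mk-mk≢y K (trans (sym θst) q)
          ... | inj₂ (inj₁ refl) | inj₁ refl = ⊥-elim (<-asym i<j s<m)
          ... | inj₂ (inj₁ refl) | inj₂ (inj₁ refl) = ⊥-elim (<-irrefl refl i<j)
          ... | inj₂ (inj₁ refl) | inj₂ (inj₂ refl) =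
              (λ q → even-mk≢mc par-even (not K) (trans (sym (f-end ct)) (trans (sym q) (f-mid cm))))
            , (λ _ q → swi≢n sg (trans (sym θmt) q)) , λ _ _ q → swi≢y sg (trans (sym θmt) q)
          ... | inj₂ (inj₂ refl) | inj₁ refl = ⊥-elim (<-asym i<j (<-trans s<m (n<1+n _)))
          ... | inj₂ (inj₂ refl) | inj₂ (inj₁ refl) = ⊥-elim (<-asym i<j (n<1+n _))
          ... | inj₂ (inj₂ refl) | inj₂ (inj₂ refl) = ⊥-elim (<-irrefl refl i<j)

    -- The part of the path outside the kept side is delimited by p s and p t;
    -- either it is a link from end K to end K′, or it consists of p s and p t only.
    segment : ∀ s t → s ≤ t → t ≤ k → (∀ i → i ≤ k → cls (p i) ≢ kept → s ≤ i × i ≤ t) → ∀ K K′ →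
              cls (p s) ≡ end K → (∀ i → i ≤ k → cls (p i) ≡ end K → i ≡ s) →
              cls (p t) ≡ end K′ → (∀ i → i ≤ k → cls (p i) ≡ end K′ → i ≡ t) →
              0 < s ⊎ t < k → ⊥
    segment s t s≤t t≤k inside K K′ cs us ct ut one with m≤n⇒m<n∨m≡n s≤t
    ... | inj₂ s≡t = two-ends s t s≤t cs ct
            (λ i i≤k c → inj₁ (≤-antisym (subst (i ≤_) (sym s≡t) (proj₂ (inside i i≤k c))) (proj₁ (inside i i≤k c))))
            λ s<t → ⊥-elim (<-irrefl s≡t s<t)
    -- No kept vertex is adjacent to a `mid` vertex, so what `p (suc s)` is propagates to all
    -- positions strictly between `s` and `t`.
    ... | inj₁ s<t = by-next (kept? (p (suc s)))
      where
      K≢K′ : K′ ≢ K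
      K≢K′ refl = <-irrefl (ut s (≤-trans s≤t t≤k) cs) s<t
      ct′ : cls (p t) ≡ end (not K)
      ct′ = trans ct (cong end (¬-not K≢K′))
      inner-mid : ∀ i → s < i → i < t → cls (p i) ≢ kept → cls (p i) ≡ mid
      inner-mid i s<i i<t c with cls (p i) in eq
      ... | kept = ⊥-elim (c refl)
      ... | mid = refl
      ... | end K″ with K″ ≟ᵇ K
      ...   | yes refl = ⊥-elim (<-irrefl (sym (us i (≤-trans (<⇒≤ i<t) t≤k) eq)) s<i)
      ...   | no ne = ⊥-elim (<-irrefl (ut i (≤-trans (<⇒≤ i<t) t≤k)
                        (trans eq (cong end (trans (¬-not ne) (sym (¬-not K≢K′)))))) i<t)
      all-kept : cls (p (suc s)) ≡ kept → ∀ i → s < i → i < t → cls (p i) ≡ kept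
      all-kept c (suc i) (s≤s s≤i) i<t with m≤n⇒m<n∨m≡n s≤i
      ... | inj₂ refl = c
      ... | inj₁ s<i = decidable-stable (kept? _) λ c′ → adj (≤-trans (<⇒≤ i<t) t≤k)
              (θ-mid (all-kept c i s<i (<⇒≤ i<t)) (inner-mid (suc i) (s≤s s≤i) i<t c′))
      none-kept : cls (p (suc s)) ≢ kept → ∀ i → s < i → i < t → cls (p i) ≢ kept
      none-kept c (suc i) (s≤s s≤i) i<t with m≤n⇒m<n∨m≡n s≤i
      ... | inj₂ refl = c
      ... | inj₁ s<i = λ c′ → adj (≤-trans (<⇒≤ i<t) t≤k) (trans (θ-symm _ _)
              (θ-mid c′ (inner-mid i s<i (<⇒≤ i<t) (none-kept c i s<i (<⇒≤ i<t)))))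
      by-next : Dec (cls (p (suc s)) ≡ kept) → ⊥
      by-next (yes c) = two-ends s t s≤t cs ct only λ _ →
          (λ q → mk≢mk K (trans (sym (f-end cs)) (trans q (f-end ct′))))
        , (λ { refl → ⊥-elim (no-kept ct c) })
        , λ _ q → mk-mk≢y K (trans (sym (cong₂ θ′ (f-end cs) (f-end ct′))) q)
        where
        only : ∀ i → i ≤ k → cls (p i) ≢ kept → i ≡ s ⊎ i ≡ t
        only i i≤k ci with m≤n⇒m<n∨m≡n (proj₁ (inside i i≤k ci)) | m≤n⇒m<n∨m≡n (proj₂ (inside i i≤k ci))
        ... | inj₂ q | _ = inj₁ (sym q)
        ... | _ | inj₂ q = inj₂ q
        ... | inj₁ s<i | inj₁ i<t = ⊥-elim (ci (all-kept c i s<i i<t))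
      by-next (no c) = linked s (t ∸ suc s) (k ∸ t) (trans (cong (_+ (k ∸ t)) (sym t≡)) (m+[n∸m]≡n t≤k)) K cs
          (subst (λ i → cls (p i) ≡ end (not K)) t≡ ct′)
          (λ i i≤k ci → proj₁ (inside i i≤k ci) , subst (i ≤_) t≡ (proj₂ (inside i i≤k ci)))
          (λ i s<i i<t → let i<t′ = subst (i <_) (sym t≡) i<t in inner-mid i s<i i<t′ (none-kept c i s<i i<t′))
          (positive one)
        where
        t≡ : t ≡ suc ((t ∸ suc s) + s)
        t≡ = trans (sym (m∸n+n≡m s<t)) (+-suc (t ∸ suc s) s)
        positive : 0 < s ⊎ t < k → 0 < s + (k ∸ t)
        positive (inj₁ 0<s) = ≤-trans 0<s (m≤m+n s _)
        positive (inj₂ t<k) = ≤-trans (m<n⇒0<n∸m t<k) (m≤n+m _ s)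

    end₁-extreme : χ′ (mk (not K₀)) ≡ r → ∀ i → i ≤ k → cls (p i) ≡ end (not K₀) → i ≡ 0 ⊎ i ≡ k
    end₁-extreme χ₁ zero _ _ = inj₁ refl
    end₁-extreme χ₁ (suc i) i≤k c with m≤n⇒m<n∨m≡n i≤k
    ... | inj₁ i<k = ⊥-elim (l-r (χi (suc i) (s≤s z≤n) i<k) (trans (χ-end c) χ₁))
    ... | inj₂ q = inj₂ q

    -- A kept predecessor of `p s` sees one vertex of `end K`, hence all of them, which leaves only
    -- the positions beside it; minimality of `s` removes the earlier one. For `s = 0` the colour
    -- `r` puts `p 0` into `end (not K₀)`, which then meets the path only in path ends, and the
    -- other path end is kept.
    first-end : cls (p 0) ≡ kept ⊎ cls (p k) ≡ kept → ∀ s → s ≤ k → cls (p s) ≢ kept → (∀ i → i < s → ¬ ¬ cls (p i) ≡ kept) →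
           ∃ λ K → cls (p s) ≡ end K × (∀ i → i ≤ k → cls (p i) ≡ end K → i ≡ s)
    first-end ends zero _ c _ with r⇒kept⊎end₁ χ0 | ends
    ... | inj₁ c′ | _ = ⊥-elim (c c′)
    ... | inj₂ c′ | inj₁ c″ = ⊥-elim (c c″)
    ... | inj₂ c′ | inj₂ ck = not K₀ , c′ , uniq
      where
      uniq : ∀ i → i ≤ k → cls (p i) ≡ end (not K₀) → i ≡ 0
      uniq i i≤k ci with end₁-extreme (trans (sym (χ-end c′)) χ0) i i≤k ci
      ... | inj₁ q = q
      ... | inj₂ refl = ⊥-elim (no-kept ci ck)
    first-end ends (suc s) s<k c before with decidable-stable (kept? _) (before s ≤-refl) | cls (p (suc s)) in eq
    ... | cs | kept = ⊥-elim (c refl)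
    ... | cs | mid = ⊥-elim (adj s<k (θ-mid cs eq))
    ... | cs | end K = K , refl , uniq
      where
      uniq : ∀ i → i ≤ k → cls (p i) ≡ end K → i ≡ suc s
      uniq i i≤k ci with near θ-symm P (<⇒≤ s<k) i≤k (λ { refl → no-kept ci cs })
                           (θ-seen cs ci (≢n⇒sees cs eq (adj s<k)))
      ... | inj₁ q = q
      ... | inj₂ refl = ⊥-elim (no-kept ci (decidable-stable (kept? _) (before i (s≤s (n≤1+n i)))))
    last-end : cls (p 0) ≡ kept ⊎ cls (p k) ≡ kept → ∀ t → t ≤ k → cls (p t) ≢ kept → (∀ i → t < i → i ≤ k → ¬ ¬ cls (p i) ≡ kept) →
            ∃ λ K → cls (p t) ≡ end K × (∀ i → i ≤ k → cls (p i) ≡ end K → i ≡ t)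
    last-end ends t t≤k c after with m≤n⇒m<n∨m≡n t≤k
    last-end ends t t≤k c after | inj₂ refl with r⇒kept⊎end₁ χk | ends
    ... | inj₁ c′ | _ = ⊥-elim (c c′)
    ... | inj₂ c′ | inj₂ c″ = ⊥-elim (c c″)
    ... | inj₂ c′ | inj₁ c0 = not K₀ , c′ , uniq
      where
      uniq : ∀ i → i ≤ k → cls (p i) ≡ end (not K₀) → i ≡ k
      uniq i i≤k ci with end₁-extreme (trans (sym (χ-end c′)) χk) i i≤k ci
      ... | inj₂ q = q
      ... | inj₁ refl = ⊥-elim (no-kept ci c0)
    last-end ends t t≤k c after | inj₁ t<k with decidable-stable (kept? _) (after (suc t) ≤-refl t<k) | cls (p t) in eq
    ... | ct | kept = ⊥-elim (c refl)
    ... | ct | mid = ⊥-elim (adj t<k (trans (θ-symm _ _) (θ-mid ct eq)))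
    ... | ct | end K = K , refl , uniq
      where
      uniq : ∀ i → i ≤ k → cls (p i) ≡ end K → i ≡ t
      uniq i i≤k ci with near θ-symm P t<k i≤k (λ { refl → no-kept ci ct })
                           (θ-seen ct ci (≢n⇒sees ct eq (≢-symm (adj t<k))))
      ... | inj₂ q = sym (suc-injective q)
      ... | inj₁ refl = ⊥-elim (no-kept ci (decidable-stable (kept? _) (after (suc (suc t)) (m≤n⇒m≤1+n ≤-refl) i≤k)))

    one-kept : cls (p 0) ≡ kept ⊎ cls (p k) ≡ kept → ⊥
    one-kept ends with firstUpTo (¬? ∘ kept? ∘ p) k | lastUpTo (¬? ∘ kept? ∘ p) k
    ... | inj₁ none | _ = direct (λ i i≤k m → ⊥-elim (none i i≤k (λ e → clash m e λ ())))
                            (λ {i} i<j j≤k ci _ → ⊥-elim (none i (≤-trans (<⇒≤ i<j) j≤k) ci))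
    ... | inj₂ (s , s≤k , cs , before) | inj₁ none = none s s≤k cs
    ... | inj₂ (s , s≤k , cs , before) | inj₂ (t , t≤k , ct , after)
        with first-end ends s s≤k cs before | last-end ends t t≤k ct after
    ... | K , cs′ , us | K′ , ct′ , ut =
      segment s t (≮⇒≥ λ t<s → before t t<s ct) t≤k inside K K′ cs′ us ct′ ut (one ends)
      where
      inside : ∀ i → i ≤ k → cls (p i) ≢ kept → s ≤ i × i ≤ t
      inside i i≤k c = ≮⇒≥ (λ i<s → before i i<s c) , ≮⇒≥ (λ t<i → after i t<i i≤k c)
      -- A kept path end shows that the link is not the whole path, whose contraction could be a
      -- single edge.
      one : cls (p 0) ≡ kept ⊎ cls (p k) ≡ kept → 0 < s ⊎ t < k
      one (inj₁ c) = inj₁ (n≢0⇒n>0 λ { refl → cs c })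
      one (inj₂ c) = inj₂ (≤∧≢⇒< t≤k λ { refl → ct c })

    -- If the path has no kept vertex, a private neighbour of `end (not K₀)` closes it to an odd
    -- hole. Otherwise its kept vertices do not see that end, as seeing both path ends would force
    -- `k = 2`. They are thus entered and left through `end K₀`, which leaves a single kept vertex
    -- between two links of the same parity and makes `k` even.
    both-end₁ : cls (p 0) ≡ end (not K₀) → cls (p k) ≡ end (not K₀) → ⊥
    both-end₁ c0 ck with firstUpTo (kept? ∘ p) k | lastUpTo (kept? ∘ p) k
    ... | inj₁ none | _ = cap (private-neighbour (not K₀))
      where
      cap : (∃ λ z → cls z ≡ kept × sees z (not K₀) ≡ true × sees z (not (not K₀)) ≡ false) → ⊥
      cap (z , cz , sees₁ , sees₀) = noCap z P odd 1<k (λ { i i≤k refl → none i i≤k cz })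
        (λ q → y≢n sg (trans (sym (θ-seen cz c0 sees₁)) q))
        (λ q → y≢n sg (trans (sym (θ-seen cz ck sees₁)) q)) inner
        where
        inner : ∀ i → 0 < i → i < k → θ z (p i) ≢ y
        inner i 0<i i<k q with view (p i)
        ... | isKept c = none i (<⇒≤ i<k) c
        ... | isMid c = y≢n sg (trans (sym q) (θ-mid cz c))
        ... | isEnd₀ c = y≢n sg (trans (sym q) (θ-unseen cz c (trans (cong (sees z) (sym (not-involutive K₀))) sees₀)))
        ... | isEnd₁ c = l-r (χi i 0<i i<k) (trans (χ-end c) (trans (sym (χ-end c0)) χ0))
    ... | inj₂ (m , m≤k , cm , _) | inj₁ none = none m m≤k cm
    ... | inj₂ (zero , _ , cm , _) | _ = no-kept c0 cm
    ... | inj₂ (suc m , m≤k , cm , before) | inj₂ (m′ , m′≤k , cm′ , after) = parts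
      where
      k≢2 : k ≢ 2
      k≢2 refl = odd≢even odd refl
      m<k : suc m < k
      m<k = ≤∧≢⇒< m≤k λ { refl → no-kept ck cm }
      m′<k : m′ < k
      m′<k = ≤∧≢⇒< m′≤k λ { refl → no-kept ck cm′ }
      unseen₁ : ∀ i → i ≤ k → cls (p i) ≡ kept → sees (p i) (not K₀) ≢ true
      unseen₁ i i≤k ci q with near θ-symm P i≤k z≤n (λ { refl → no-kept c0 ci }) (θ-seen ci c0 q)
                            | near θ-symm P i≤k ≤-refl (λ { refl → no-kept ck ci }) (θ-seen ci ck q)
      ... | inj₂ refl | inj₁ e = k≢2 e
      ... | inj₂ refl | inj₂ e = n≮0 (subst (1 <_) (sym (suc-injective e)) 1<k)
      to-end₀ : ∀ {i j} → i ≤ k → cls (p i) ≡ kept → cls (p j) ≢ kept → θ (p i) (p j) ≢ n →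
                cls (p j) ≡ end K₀ × sees (p i) K₀ ≡ true
      to-end₀ {i} {j} i≤k ci cj ne with view (p j)
      ... | isKept c = ⊥-elim (cj c)
      ... | isMid c = ⊥-elim (ne (θ-mid ci c))
      ... | isEnd₀ c = c , ≢n⇒sees ci c ne
      ... | isEnd₁ c = ⊥-elim (unseen₁ i i≤k ci (≢n⇒sees ci c ne))
      before-m : cls (p m) ≡ end K₀ × sees (p (suc m)) K₀ ≡ true
      before-m = to-end₀ m≤k cm (before m ≤-refl) (≢-symm (adj m≤k))
      after-m′ : cls (p (suc m′)) ≡ end K₀
      after-m′ = proj₁ (to-end₀ m′≤k cm′ (after (suc m′) ≤-refl m′<k) (adj m′<k))
      end₀-near : ∀ i → i ≤ k → cls (p i) ≡ end K₀ → i ≡ suc (suc m) ⊎ i ≡ m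
      end₀-near i i≤k ci with near θ-symm P m≤k i≤k (λ { refl → no-kept ci cm }) (θ-seen cm ci (proj₂ before-m))
      ... | inj₁ q = inj₁ q
      ... | inj₂ q = inj₂ (sym (suc-injective q))
      m′≡ : m′ ≡ suc m
      m′≡ with end₀-near (suc m′) m′<k after-m′
      ... | inj₁ q = suc-injective q
      ... | inj₂ q = ⊥-elim (before m′ (subst (m′ <_) (cong suc q) (m≤n⇒m≤1+n ≤-refl)) cm′)
      mid-elsewhere : ∀ i → 0 < i → i < k → i ≢ m → i ≢ suc m → i ≢ suc (suc m) → cls (p i) ≡ mid
      mid-elsewhere i 0<i i<k i≢m i≢sm i≢ssm with view (p i)
      ... | isMid c = c
      ... | isEnd₁ c = ⊥-elim (l-r (χi i 0<i i<k) (trans (χ-end c) (trans (sym (χ-end c0)) χ0)))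
      ... | isEnd₀ c with end₀-near i (<⇒≤ i<k) c
      ...   | inj₁ q = ⊥-elim (i≢ssm q)
      ...   | inj₂ q = ⊥-elim (i≢m q)
      mid-elsewhere i 0<i i<k i≢m i≢sm i≢ssm | isKept c with <-cmp i (suc m)
      ... | tri< i<m _ _ = ⊥-elim (before i i<m c)
      ... | tri≈ _ q _ = ⊥-elim (i≢sm q)
      ... | tri> _ _ m<i = ⊥-elim (after i (subst (_< i) (sym m′≡) m<i) (<⇒≤ i<k) c)
      c₀-right : cls (p (suc (suc m))) ≡ end K₀
      c₀-right = subst (λ a → cls (p (suc a)) ≡ end K₀) m′≡ after-m′
      -- The two links have `m` and `e` edges, and the kept vertex between them accounts for the
      -- remaining two.
      e = k ∸ suc (suc m)
      k≡ : e + suc (suc m) ≡ k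
      k≡ = m∸n+n≡m m<k
      left-link : parity m ≡ par
      left-link = linkParity K₀ (reversePath θ-symm (subpath P 0 m (subst (_≤ k) (sym (+-identityʳ m)) (<⇒≤ (<⇒≤ m<k)))))
        (trans (cong (cls ∘ p) (+-identityʳ m)) (proj₁ before-m))
        (trans (cong (cls ∘ p) (trans (+-identityʳ (m ∸ m)) (n∸n≡0 m))) c0)
        λ i 0<i i<m → subst (λ a → cls (p a) ≡ mid) (sym (+-identityʳ (m ∸ i)))
          (mid-elsewhere (m ∸ i) (m<n⇒0<n∸m i<m) (≤-trans (s≤s (m∸n≤m m i)) (<⇒≤ m<k))
            (<⇒≢ (<m i 0<i i<m))
            (<⇒≢ (s≤s (m∸n≤m m i))) (<⇒≢ (s≤s (m≤n⇒m≤1+n (m∸n≤m m i)))))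
        where
        <m : ∀ i → 0 < i → i < m → m ∸ i < m
        <m i 0<i i<m = ∸-monoʳ-< 0<i (<⇒≤ i<m)
      right-link : parity e ≡ par
      right-link = linkParity K₀ (subpath P (suc (suc m)) e (≤-reflexive k≡)) c₀-right
        (trans (cong (cls ∘ p) k≡) ck)
        λ i 0<i i<e → mid-elsewhere (i + suc (suc m)) (≤-trans 0<i (m≤m+n i _)) (subst (i + suc (suc m) <_) k≡ (+-monoˡ-< (suc (suc m)) i<e))
          (≢-sym (<⇒≢ (<-trans (<-trans (n<1+n m) (n<1+n (suc m))) (+-monoˡ-≤ (suc (suc m)) 0<i))))
          (≢-sym (<⇒≢ (<-trans (n<1+n (suc m)) (+-monoˡ-≤ (suc (suc m)) 0<i))))
          (≢-sym (<⇒≢ (+-monoˡ-≤ (suc (suc m)) 0<i)))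
      parts : ⊥
      parts = odd≢even odd (trans (cong parity (trans (sym k≡) (trans (+-suc e (suc m)) (cong suc (+-suc e m)))))
                (parity-same-+ e m (trans right-link (sym left-link))))

    absurd : ⊥
    absurd with r⇒kept⊎end₁ χ0 | r⇒kept⊎end₁ χk
    ... | inj₁ c | _ = one-kept (inj₁ c)
    ... | inj₂ _ | inj₁ c = one-kept (inj₂ c)
    ... | inj₂ c | inj₂ c′ = both-end₁ c c′

  noPath-V : NoOddPath θ y n l r χ
  noPath-V P odd 1<k χ0 χk χi = PathHalf.absurd P odd 1<k χ0 χk χi

  -- Odd antipaths through a join, with ends coloured `l` and interior coloured `r`

  module AntipathHalf {k : ℕ} {q : ℕ → V} (Q : ℕPath θ n y k q) (odd : parity k ≡ oddP) (1<k : 1 < k)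
    (χ0 : χ (q 0) ≡ l) (χk : χ (q k) ≡ l) (χi : ∀ i → 0 < i → i < k → χ (q i) ≡ r) where
    open ℕPath Q

    2<k : 2 < k
    2<k = odd>1⇒≥3 k odd 1<k

    k≢2 : k ≢ 2
    k≢2 refl = odd≢even odd refl

    direct : (∀ i → i ≤ k → Faithful (q i)) →
             (∀ {i j} → i < j → j ≤ k → cls (q i) ≢ kept → cls (q j) ≢ kept → Fits Q i j) → ⊥
    direct ok both = noAntipath (image Q ok both) odd 1<k χ0 χk χi

    -- The end markers never have value `y`, which suffices for consecutive vertices.
    -- Non-consecutive vertices of an antipath are adjacent and form a link of length one, so the
    -- join is odd and the markers are switchable.
    ends-fit : ∀ {i j} K → j ≤ k → cls (q i) ≡ end K → cls (q j) ≡ end (not K) → Fits Q i j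
    ends-fit {i} {j} K j≤k ci cj =
        (λ e → mk≢mk K (trans (sym (f-end ci)) (trans e (f-end cj))))
      , (λ _ e → mk-mk≢y K (trans (sym θij) e))
      , λ far e → swi≢n sg (trans (sym (odd-mk (linked⇒odd K ci cj (ant far j≤k)) K)) (trans (sym θij) e))
      where
      θij : θ′ (f (q i)) (f (q j)) ≡ θ′ (mk K) (mk (not K))
      θij = cong₂ θ′ (f-end ci) (f-end cj)

    mid-end-fits : ∀ {i j} K → par ≡ evenP → cls (q i) ≡ mid → cls (q j) ≡ end K → Fits Q i j
    mid-end-fits {i} {j} K ev ci cj =
        (λ e → even-mk≢mc ev K (trans (sym (f-end cj)) (trans (sym e) (f-mid ci))))
      , (λ _ e → swi≢y sg (trans (sym θij) e)) , λ _ e → swi≢n sg (trans (sym θij) e)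
      where
      θij : θ′ (f (q i)) (f (q j)) ≡ swi
      θij = trans (cong₂ θ′ (f-mid ci) (f-end cj)) (trans (θ′-symm _ _) (even-mc ev K))

    extreme⊎inner : ∀ i → i ≤ k → i ≡ 0 ⊎ i ≡ k ⊎ (0 < i × i < k)
    extreme⊎inner zero _ = inj₁ refl
    extreme⊎inner (suc i) i≤k with m≤n⇒m<n∨m≡n i≤k
    ... | inj₁ i<k = inj₂ (inj₂ (s≤s z≤n , i<k))
    ... | inj₂ e = inj₂ (inj₁ e)

    -- With both end markers coloured `l` the interior is kept. Neither antipath end is `mid`, since
    -- each is adjacent to an interior vertex. They do not lie in the same end either: `q 1` does
    -- not see the end of `q 0`, yet it is adjacent to `q k`.
    end₁-left : χ′ (mk (not K₀)) ≡ l → ⊥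
    end₁-left χ₁ = direct faithful both
      where
      inner : ∀ i → 0 < i → i < k → cls (q i) ≡ kept
      inner i 0<i i<k with r⇒kept⊎end₁ (χi i 0<i i<k)
      ... | inj₁ c = c
      ... | inj₂ c = ⊥-elim (l-r (trans (χ-end c) χ₁) (χi i 0<i i<k))
      c1 : cls (q 1) ≡ kept
      c1 = inner 1 (s≤s z≤n) 1<k
      0≢mid : cls (q 0) ≢ mid
      0≢mid c = ant (s≤s (s≤s z≤n)) (<⇒≤ 2<k) (trans (θ-symm _ _) (θ-mid (inner 2 (s≤s z≤n) 2<k) c))
      k≢mid : cls (q k) ≢ mid
      k≢mid c = ant 2<k ≤-refl (θ-mid c1 c)
      faithful : ∀ i → i ≤ k → Faithful (q i)
      faithful i i≤k c with extreme⊎inner i i≤k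
      ... | inj₁ refl = ⊥-elim (0≢mid c)
      ... | inj₂ (inj₁ refl) = ⊥-elim (k≢mid c)
      ... | inj₂ (inj₂ (0<i , i<k)) = ⊥-elim (clash c (inner i 0<i i<k) λ ())
      0k-fits : cls (q 0) ≢ kept → cls (q k) ≢ kept → Fits Q 0 k
      0k-fits c c′ with cls (q 0) in e₀ | cls (q k) in eₖ
      ... | kept | _ = ⊥-elim (c refl)
      ... | mid | _ = ⊥-elim (0≢mid e₀)
      ... | end _ | kept = ⊥-elim (c′ refl)
      ... | end _ | mid = ⊥-elim (k≢mid eₖ)
      ... | end K | end K′ with K′ ≟ᵇ K
      ...   | yes refl = ⊥-elim (ant 2<k ≤-refl (θ-unseen c1 eₖ (≢y⇒¬sees c1 e₀ (≢-symm (adj (<⇒≤ 1<k))))))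
      ...   | no ne = ends-fit K ≤-refl e₀ (trans eₖ (cong end (¬-not ne)))
      both : ∀ {i j} → i < j → j ≤ k → cls (q i) ≢ kept → cls (q j) ≢ kept → Fits Q i j
      both {i} {j} i<j j≤k ci cj with extreme⊎inner i (≤-trans (<⇒≤ i<j) j≤k) | extreme⊎inner j j≤k
      ... | inj₂ (inj₁ refl) | _ = ⊥-elim (<⇒≱ i<j j≤k)
      ... | inj₂ (inj₂ (0<i , i<k)) | _ = ⊥-elim (ci (inner i 0<i i<k))
      ... | inj₁ refl | inj₁ refl = ⊥-elim (<-irrefl refl i<j)
      ... | inj₁ refl | inj₂ (inj₂ (0<j , j<k)) = ⊥-elim (cj (inner j 0<j j<k))
      ... | inj₁ refl | inj₂ (inj₁ refl) = 0k-fits ci cj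

    module _ (χ₁ : χ′ (mk (not K₀)) ≡ r) where

      inner : ∀ i → 0 < i → i < k → cls (q i) ≡ kept ⊎ cls (q i) ≡ end (not K₀)
      inner i 0<i i<k = r⇒kept⊎end₁ (χi i 0<i i<k)

      near-n : ∀ {i j} → i ≤ k → j ≤ k → i ≢ j → θ (q i) (q j) ≡ n → j ≡ suc i ⊎ i ≡ suc j
      near-n = near θ-symm Q

      kept≢end : ∀ {i j K} → cls (q i) ≡ kept → cls (q j) ≡ end K → i ≢ j
      kept≢end ci cj refl = clash ci cj λ ()

      -- The kept vertex `q k` is adjacent to `q 0`, so `q 0` is not `mid`. The last vertex of
      -- `end (not K₀)` is followed by a kept vertex that misses this whole end, hence it is the
      -- only one, and its sole possible partner outside the kept side is `q 0` in `end K₀`.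
      kept-last : cls (q k) ≡ kept → ⊥
      kept-last ck = direct (λ i i≤k c → ⊥-elim (no-mid i i≤k c)) both
        where
        no-mid : ∀ i → i ≤ k → cls (q i) ≢ mid
        no-mid i i≤k c with extreme⊎inner i i≤k
        ... | inj₁ refl = ant 1<k ≤-refl (trans (θ-symm _ _) (θ-mid ck c))
        ... | inj₂ (inj₁ refl) = clash c ck λ ()
        ... | inj₂ (inj₂ (0<i , i<k)) = l-r (χ-mid c) (χi i 0<i i<k)
        unique : ∀ {i j} → i ≤ k → j ≤ k → cls (q i) ≡ end (not K₀) → cls (q j) ≡ end (not K₀) → i ≡ j
        unique {i} {j} i≤k j≤k ci cj with lastUpTo (end? (not K₀) ∘ q) k
        ... | inj₁ none = ⊥-elim (none i i≤k ci)
        ... | inj₂ (t , t≤k , ct , after) = trans (at-t i≤k ci) (sym (at-t j≤k cj))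
          where
          t<k : t < k
          t<k = ≤∧≢⇒< t≤k λ { refl → clash ck ct λ () }
          cst : cls (q (suc t)) ≡ kept
          cst with m≤n⇒m<n∨m≡n t<k
          ... | inj₂ e = trans (cong (cls ∘ q) e) ck
          ... | inj₁ st<k with inner (suc t) (s≤s z≤n) st<k
          ...   | inj₁ c = c
          ...   | inj₂ c = ⊥-elim (after (suc t) ≤-refl t<k c)
          at-t : ∀ {i} → i ≤ k → cls (q i) ≡ end (not K₀) → i ≡ t
          at-t i≤k ci with near-n t<k i≤k (kept≢end cst ci)
                             (θ-unseen cst ci (≢y⇒¬sees cst ct (≢-symm (adj t<k))))
          ... | inj₂ e = sym (suc-injective e)
          ... | inj₁ refl = ⊥-elim (after (suc (suc t)) (m≤n⇒m≤1+n ≤-refl) i≤k ci)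
        both : ∀ {i j} → i < j → j ≤ k → cls (q i) ≢ kept → cls (q j) ≢ kept → Fits Q i j
        both {i} {j} i<j j≤k ci cj with extreme⊎inner j j≤k
        ... | inj₁ refl = ⊥-elim (n≮0 i<j)
        ... | inj₂ (inj₁ refl) = ⊥-elim (cj ck)
        ... | inj₂ (inj₂ (0<j , j<k)) with inner j 0<j j<k | view (q i)
        ...   | inj₁ c | _ = ⊥-elim (cj c)
        ...   | inj₂ c | isKept c′ = ⊥-elim (ci c′)
        ...   | inj₂ c | isMid c′ = ⊥-elim (no-mid i (≤-trans (<⇒≤ i<j) j≤k) c′)
        ...   | inj₂ c | isEnd₀ c′ = ends-fit K₀ j≤k c′ c
        ...   | inj₂ c | isEnd₁ c′ = ⊥-elim (<-irrefl (unique (≤-trans (<⇒≤ i<j) j≤k) j≤k c′ c) i<j)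

      -- A private neighbour of `end (not K₀)` sees the whole interior and misses both antipath
      -- ends, which closes an odd antihole.
      capped : cls (q 0) ≡ mid ⊎ cls (q 0) ≡ end K₀ → cls (q k) ≡ mid ⊎ cls (q k) ≡ end K₀ →
               (∀ i → 0 < i → i < k → cls (q i) ≡ end (not K₀)) → ⊥
      capped c0 ck ci with private-neighbour (not K₀)
      ... | z , cz , sees₁ , sees₀ = noAnticap z Q odd 1<k avoid (extreme c0) (extreme ck)
              λ i 0<i i<k e → y≢n sg (trans (sym (θ-seen cz (ci i 0<i i<k) sees₁)) e)
        where
        extreme : ∀ {v} → cls v ≡ mid ⊎ cls v ≡ end K₀ → θ z v ≢ y
        extreme (inj₁ c) e = y≢n sg (trans (sym e) (θ-mid cz c))
        extreme (inj₂ c) e = y≢n sg (trans (sym e)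
          (θ-unseen cz c (trans (cong (sees z) (sym (not-involutive K₀))) sees₀)))
        not-kept : ∀ {v} → cls v ≡ mid ⊎ cls v ≡ end K₀ → z ≢ v
        not-kept (inj₁ c) refl = clash c cz λ ()
        not-kept (inj₂ c) refl = clash c cz λ ()
        avoid : ∀ i → i ≤ k → z ≢ q i
        avoid i i≤k with extreme⊎inner i i≤k
        ... | inj₁ refl = not-kept c0
        ... | inj₂ (inj₁ refl) = not-kept ck
        ... | inj₂ (inj₂ (0<i , i<k)) = λ { refl → clash cz (ci i 0<i i<k) λ () }

      -- Kept vertices miss the `mid` vertex `q 0`, so `q 1` is the only interior vertex that may be
      -- kept. If it is not, `capped` applies. If it is, then `q k` is not `mid`, and `q 1` misses
      -- all of `end (not K₀)`, which confines that end to `q 2` and gives `k = 3`.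
      mid-first : cls (q 0) ≡ mid → cls (q k) ≡ mid ⊎ cls (q k) ≡ end K₀ → ⊥
      mid-first c0 ck with inner 1 (s≤s z≤n) 1<k
      ... | inj₂ c1 = capped (inj₁ c0) ck all-end₁
        where
        all-end₁ : ∀ i → 0 < i → i < k → cls (q i) ≡ end (not K₀)
        all-end₁ i 0<i i<k with inner i 0<i i<k
        ... | inj₂ c = c
        ... | inj₁ c with near-n (<⇒≤ i<k) z≤n (λ { refl → n≮0 0<i }) (θ-mid c c0)
        ...   | inj₂ refl = c1
      ... | inj₁ c1 = last-vertex ck
        where
        last-vertex : cls (q k) ≡ mid ⊎ cls (q k) ≡ end K₀ → ⊥
        last-vertex (inj₁ c) with near-n (<⇒≤ 1<k) ≤-refl (<⇒≢ 1<k) (θ-mid c1 c)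
        ... | inj₁ e = k≢2 e
        ... | inj₂ e = n≮0 (subst (1 <_) (sym (suc-injective e)) 1<k)
        last-vertex (inj₂ ck) = direct (λ _ _ _ → even) both
          where
          only-1 : ∀ i → 1 < i → i < k → cls (q i) ≡ end (not K₀)
          only-1 i 1<i i<k with inner i (<⇒≤ 1<i) i<k
          ... | inj₂ c = c
          ... | inj₁ c with near-n (<⇒≤ i<k) z≤n (λ { refl → n≮0 1<i }) (θ-mid c c0)
          ...   | inj₂ refl = ⊥-elim (<-irrefl refl 1<i)
          c2 : cls (q 2) ≡ end (not K₀)
          c2 = only-1 2 ≤-refl 2<k
          at-2 : ∀ i → i ≤ k → cls (q i) ≡ end (not K₀) → i ≡ 2
          at-2 i i≤k ci with near-n (<⇒≤ 1<k) i≤k (kept≢end c1 ci) (θ-unseen c1 ci (≢y⇒¬sees c1 c2 (adj 1<k)))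
          ... | inj₁ e = e
          ... | inj₂ refl = ⊥-elim (clash c0 ci λ ())
          k≡3 : k ≡ 3
          k≡3 with m≤n⇒m<n∨m≡n 2<k
          ... | inj₂ e = sym e
          ... | inj₁ 3<k with at-2 3 (<⇒≤ 3<k) (only-1 3 (s≤s (s≤s z≤n)) 3<k)
          ...   | ()
          -- The vertices `q k`, `q 0`, `q 2` form a link of length two through `mid`; the join is
          -- therefore even and `mc` is a marker of its own.
          even : par ≡ evenP
          even with cherryPath θ-symm {y = y} {n = n} {q k} {q 0} {q 2}
                      (λ e → dis (<⇒≤ 1<k) ≤-refl (sym e)) (dis (s≤s z≤n) (<⇒≤ 2<k)) (λ e → dis 2<k ≤-refl (sym e))
                      (≢-symm (ant 1<k ≤-refl)) (ant ≤-refl (<⇒≤ 2<k))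
                      (≢-symm (subst (λ a → θ (q 2) (q a) ≢ y) (sym k≡3) (adj 2<k)))
          ... | p , P , e₀ , e₁ , e₂ = sym (linkParity K₀ P (trans (cong cls e₀) ck) (trans (cong cls e₂) c2)
                  λ { (suc zero) _ _ → trans (cong cls e₁) c0 ; (suc (suc _)) _ (s≤s (s≤s ())) })
          both : ∀ {i j} → i < j → j ≤ k → cls (q i) ≢ kept → cls (q j) ≢ kept → Fits Q i j
          both {i} {j} i<j j≤k ci cj with view (q i) | extreme⊎inner j j≤k
          ... | _ | inj₁ refl = ⊥-elim (n≮0 i<j)
          ... | isKept c | _ = ⊥-elim (ci c)
          ... | isMid c | inj₂ (inj₁ refl) = mid-end-fits K₀ even c ck
          ... | isEnd₁ c | inj₂ (inj₁ refl) = ends-fit (not K₀) ≤-refl c (trans ck (cong end (sym (not-involutive K₀))))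
          ... | isEnd₀ c | _ with extreme⊎inner i (≤-trans (<⇒≤ i<j) j≤k)
          ...   | inj₁ refl = ⊥-elim (clash c c0 λ ())
          ...   | inj₂ (inj₁ refl) = ⊥-elim (<⇒≱ i<j j≤k)
          ...   | inj₂ (inj₂ (0<i , i<k)) = ⊥-elim (l-r (χ-end₀ c) (χi i 0<i i<k))
          both {i} {j} i<j j≤k ci cj | isMid c | inj₂ (inj₂ (0<j , j<k)) with inner j 0<j j<k
          ...   | inj₁ c′ = ⊥-elim (cj c′)
          ...   | inj₂ c′ = mid-end-fits (not K₀) even c c′
          both {i} {j} i<j j≤k ci cj | isEnd₁ c | inj₂ (inj₂ (0<j , j<k)) with inner j 0<j j<k
          ...   | inj₁ c′ = ⊥-elim (cj c′)
          ...   | inj₂ c′ = ⊥-elim (<-irrefl (trans (at-2 i (≤-trans (<⇒≤ i<j) j≤k) c) (sym (at-2 j j≤k c′))) i<j)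

      -- A kept interior vertex sees `end K₀`, since missing both antipath ends would force `k = 2`.
      -- So `q 1` and the vertex before `q k` lie in `end (not K₀)`. The first kept vertex misses
      -- that end, which confines it to the two positions beside this vertex; then `k` is 2 or 4.
      both-end₀ : cls (q 0) ≡ end K₀ → cls (q k) ≡ end K₀ → ⊥
      both-end₀ c0 ck with firstUpTo (kept? ∘ q) k
      ... | inj₁ none = capped (inj₂ c0) (inj₂ ck) λ i 0<i i<k → not-kept i 0<i i<k (none i (<⇒≤ i<k))
        where
        not-kept : ∀ i → 0 < i → i < k → cls (q i) ≢ kept → cls (q i) ≡ end (not K₀)
        not-kept i 0<i i<k c with inner i 0<i i<k
        ... | inj₁ c′ = ⊥-elim (c c′)
        ... | inj₂ c′ = c′
      ... | inj₂ (zero , _ , cm , _) = clash c0 cm λ ()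
      ... | inj₂ (suc m , m≤k , cm , before) = contradict (at-end₁ 1 (<⇒≤ 1<k) c1) last-near
        where
        m<k : suc m < k
        m<k = ≤∧≢⇒< m≤k λ { refl → clash ck cm λ () }
        sees₀ : ∀ i → i ≤ k → cls (q i) ≡ kept → sees (q i) K₀ ≡ true
        sees₀ i i≤k ci with sees (q i) K₀ in e
        ... | true = refl
        ... | false with near-n i≤k z≤n (kept≢end ci c0) (θ-unseen ci c0 e)
                       | near-n i≤k ≤-refl (kept≢end ci ck) (θ-unseen ci ck e)
        ...   | inj₂ refl | inj₁ e′ = ⊥-elim (k≢2 e′)
        ...   | inj₂ refl | inj₂ e′ = ⊥-elim (n≮0 (subst (1 <_) (sym (suc-injective e′)) 1<k))
        next-to-end₀ : ∀ i j → 0 < i → i < k → θ (q i) (q j) ≢ y → cls (q j) ≡ end K₀ → cls (q i) ≡ end (not K₀)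
        next-to-end₀ i j 0<i i<k ne cj with inner i 0<i i<k
        ... | inj₂ c = c
        ... | inj₁ c = ⊥-elim (ne (θ-seen c cj (sees₀ i (<⇒≤ i<k) c)))
        c1 : cls (q 1) ≡ end (not K₀)
        c1 = next-to-end₀ 1 0 (s≤s z≤n) 1<k (≢-symm (adj (<⇒≤ 1<k))) c0
        k₁ = k ∸ 1
        k≡ : suc k₁ ≡ k
        k≡ = m+[n∸m]≡n (<⇒≤ 1<k)
        k₁<k : k₁ < k
        k₁<k = ≤-reflexive k≡
        clast : cls (q k₁) ≡ end (not K₀)
        clast = next-to-end₀ k₁ k (≤-pred (subst (1 <_) (sym k≡) 1<k)) k₁<k
                  (subst (λ a → θ (q k₁) (q a) ≢ y) k≡ (adj k₁<k)) ck
        0<m : 0 < m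
        0<m = n≢0⇒n>0 λ { refl → clash cm c1 λ () }
        cm-1 : cls (q m) ≡ end (not K₀)
        cm-1 with inner m 0<m (<⇒≤ m<k)
        ... | inj₁ c = ⊥-elim (before m ≤-refl c)
        ... | inj₂ c = c
        at-end₁ : ∀ i → i ≤ k → cls (q i) ≡ end (not K₀) → i ≡ suc (suc m) ⊎ i ≡ m
        at-end₁ i i≤k ci with near-n m≤k i≤k (kept≢end cm ci)
                                (θ-unseen cm ci (≢y⇒¬sees cm cm-1 (≢-symm (adj m≤k))))
        ... | inj₁ e = inj₁ e
        ... | inj₂ e = inj₂ (sym (suc-injective e))
        last-near : k₁ ≡ suc (suc m) ⊎ k₁ ≡ m
        last-near = at-end₁ k₁ (<⇒≤ k₁<k) clast
        contradict : 1 ≡ suc (suc m) ⊎ 1 ≡ m → k₁ ≡ suc (suc m) ⊎ k₁ ≡ m → ⊥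
        contradict (inj₂ refl) (inj₁ e) = odd≢even (subst (λ a → parity a ≡ oddP) (trans (sym k≡) (cong suc e)) odd) refl
        contradict (inj₂ refl) (inj₂ e) = k≢2 (trans (sym k≡) (cong suc e))

  noAntipath-V : NoOddPath θ n y r l χ
  noAntipath-V {k} {q} Q odd 1<k χ0 χk χi with l⊎r sg (χ′ (mk (not K₀)))
  ... | inj₁ χ₁ = AntipathHalf.end₁-left Q odd 1<k χ0 χk χi χ₁
  ... | inj₂ χ₁ = by-ends (view (q 0)) (view (q k))
    where
    module Forward = AntipathHalf Q odd 1<k χ0 χk χi
    module Backward = AntipathHalf (reversePath θ-symm Q) odd 1<k χk (trans (cong (χ ∘ q) (n∸n≡0 k)) χ0)
      (λ i 0<i i<k → χi (k ∸ i) (m<n⇒0<n∸m i<k) (∸-monoʳ-< 0<i (<⇒≤ i<k)))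
    back : ∀ {c} → cls (q 0) ≡ c → cls (q (k ∸ k)) ≡ c
    back = trans (cong (cls ∘ q) (n∸n≡0 k))
    by-ends : View (q 0) → View (q k) → ⊥
    by-ends (isEnd₁ c) _ = l-r χ0 (trans (χ-end c) χ₁)
    by-ends _ (isEnd₁ c) = l-r χk (trans (χ-end c) χ₁)
    by-ends _ (isKept c) = Forward.kept-last χ₁ c
    by-ends (isKept c) _ = Backward.kept-last χ₁ (back c)
    by-ends (isMid c) (isMid c′) = Forward.mid-first χ₁ c (inj₁ c′)
    by-ends (isMid c) (isEnd₀ c′) = Forward.mid-first χ₁ c (inj₂ c′)
    by-ends (isEnd₀ c) (isMid c′) = Backward.mid-first χ₁ c′ (inj₂ (back c))
    by-ends (isEnd₀ c) (isEnd₀ c′) = Forward.both-end₀ χ₁ c c′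

  -- Separation and inhabitation of the pulled-back split of a join

  sepˡ : ∀ {u v} → cls u ≡ kept → χ u ≡ l → χ v ≡ l → ix u ≢ ix v → θ u v ≡ n
  sepˡ {u} {v} cu χu χv ne with cls v in cv
  ... | kept = trans (sym (θ′-kept cu cv)) (sepL χu χv ne)
  ... | mid = θ-mid cu cv
  ... | end K = trans (θ-end cu cv) (trans (sym (θ′-end K cu)) (trans (cong (θ′ (f u)) (sym (f-end cv))) (sepL χu χv ne)))

  sepʳ : ∀ {u v} → cls u ≡ kept → χ u ≡ r → χ v ≡ r → ix u ≢ ix v → θ u v ≡ y
  sepʳ {u} {v} cu χu χv ne with cls v in cv
  ... | kept = trans (sym (θ′-kept cu cv)) (sepR χu χv ne)
  ... | mid = ⊥-elim (l-r (χ-mid cv) χv)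
  ... | end K = trans (θ-end cu cv) (trans (sym (θ′-end K cu)) (trans (cong (θ′ (f u)) (sym (f-end cv))) (sepR χu χv ne)))

  -- All vertices outside the kept side with the same colour share one index, so nothing has to be
  -- separated among them.
  ix-l : ∀ {v} → cls v ≢ kept → χ v ≡ l → ix v ≡ ix′ (mk K₀)
  ix-l {v} nk χv with view v
  ... | isKept c = ⊥-elim (nk c)
  ... | isMid c = trans (cong ix′ (f-mid c)) ixmc
  ... | isEnd₀ c = cong ix′ (f-end c)
  ... | isEnd₁ c = trans (cong ix′ (f-end c)) (ixK₁ (trans (sym (χ-end c)) χv))

  ix-r : ∀ {v} → cls v ≢ kept → χ v ≡ r → ix v ≡ ix′ (mk (not K₀))
  ix-r {v} nk χv with r⇒kept⊎end₁ χv
  ... | inj₁ c = ⊥-elim (nk c)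
  ... | inj₂ c = cong ix′ (f-end c)

  lift : ∀ w → ∃ λ v → χ v ≡ χ′ w × ix v ≡ ix′ w
  lift w with cover w
  ... | inj₁ (v , _ , e) = v , cong χ′ (sym e) , cong ix′ (sym e)
  ... | inj₂ (inj₁ (K , e)) = let (v , c) = end-inhabited K ; e′ = trans (f-end c) (sym e)
                              in v , cong χ′ e′ , cong ix′ e′
  -- There may be no `mid` vertex, so `mc` is represented by a vertex of `end K₀`, which has the
  -- same colour and index.
  ... | inj₂ (inj₂ e) = let (v , c) = end-inhabited K₀
                        in v , trans (χ-end₀ c) (sym (trans (cong χ′ e) χmc))
                             , trans (cong ix′ (f-end c)) (sym (trans (cong ix′ e) ixmc))

  split : BalancedSplit θ y n l r χ ix
  split = record
    { sepL = sepL-V ; sepR = sepR-V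
    ; inhL = λ i → let (w , χw , ixw) = inhL i ; (v , e₁ , e₂) = lift w in v , trans e₁ χw , trans e₂ ixw
    ; inhR = λ i → let (w , χw , ixw) = inhR i ; (v , e₁ , e₂) = lift w in v , trans e₁ χw , trans e₂ ixw
    ; noPath = noPath-V ; noAntipath = noAntipath-V }
    where
    sepL-V : ∀ {u v} → χ u ≡ l → χ v ≡ l → ix u ≢ ix v → θ u v ≡ n
    sepL-V {u} {v} χu χv ne with kept? u | kept? v
    ... | yes c | _ = sepˡ c χu χv ne
    ... | no _ | yes c = trans (θ-symm _ _) (sepˡ c χv χu (≢-sym ne))
    ... | no c | no c′ = ⊥-elim (ne (trans (ix-l c χu) (sym (ix-l c′ χv))))
    sepR-V : ∀ {u v} → χ u ≡ r → χ v ≡ r → ix u ≢ ix v → θ u v ≡ y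
    sepR-V {u} {v} χu χv ne with kept? u | kept? v
    ... | yes c | _ = sepʳ c χu χv ne
    ... | no _ | yes c = trans (θ-symm _ _) (sepʳ c χv χu (≢-sym ne))
    ... | no c | no c′ = ⊥-elim (ne (trans (ix-r c χu) (sym (ix-r c′ χv))))

joinSplit : ∀ {V V′ : Set} {θ : V → V → Adj} {θ′ : V′ → V′ → Adj} {y n l r par} (sg : Sign y n l r)
  (J : Join θ θ′ y n par) → NoCap θ y n → NoCap θ n y → ∀ {χ′ ix′} → BalancedSplit θ′ y n l r χ′ ix′ →
  ∀ K → χ′ (Join.mk J K) ≡ l → χ′ (Join.mc J) ≡ l → ix′ (Join.mc J) ≡ ix′ (Join.mk J K) →
  ∃ λ χ → ∃ λ ix → BalancedSplit θ y n l r χ ix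
joinSplit sg J noCap noAnticap S K χK χmc ixmc =
  _ , _ , JoinTransfer.split sg J noCap noAnticap S K χK χmc ixmc (Markers.ix-mk sg J S χmc K χK)

-- Homogeneous pairs, keeping the pair

data PairCls : Set where
  in₀ in₁ out : PairCls

-- θ′ is the block of in₀ ∪ in₁, with markers m₀, m₁ complete to in₀, in₁;
-- a vertex outside is sent to m₁ if it is complete to in₁, and to m₀ otherwise.
record HomPair {V V′ : Set} (θ : V → V → Adj) (θ′ : V′ → V′ → Adj) (y n : Adj) : Set where
  field
    θ-symm : ∀ u v → θ u v ≡ θ v u
    θ′-symm : ∀ u v → θ′ u v ≡ θ′ v u
    cls : V → PairCls
    h₀ h₁ : V → Bool
    θ-in₀ : ∀ {u v} → cls u ≡ in₀ → cls v ≡ out → θ u v ≡ val y n (h₀ v)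
    θ-in₁ : ∀ {u v} → cls u ≡ in₁ → cls v ≡ out → θ u v ≡ val y n (h₁ v)
    f : V → V′
    m₀ m₁ : V′
    f-m₀ : ∀ {v} → cls v ≡ out → h₁ v ≡ false → f v ≡ m₀
    f-m₁ : ∀ {v} → cls v ≡ out → h₁ v ≡ true → f v ≡ m₁
    f-inj : ∀ {u v} → cls u ≢ out → cls v ≢ out → f u ≡ f v → u ≡ v
    f≢m₀ : ∀ {u} → cls u ≢ out → f u ≢ m₀
    f≢m₁ : ∀ {u} → cls u ≢ out → f u ≢ m₁
    m₀≢m₁ : m₀ ≢ m₁
    θ′-in : ∀ {u v} → cls u ≢ out → cls v ≢ out → θ′ (f u) (f v) ≡ θ u v
    θ′-in₀-m₀ : ∀ {u} → cls u ≡ in₀ → θ′ (f u) m₀ ≡ y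
    θ′-in₀-m₁ : ∀ {u} → cls u ≡ in₀ → θ′ (f u) m₁ ≡ n
    θ′-in₁-m₀ : ∀ {u} → cls u ≡ in₁ → θ′ (f u) m₀ ≡ n
    θ′-in₁-m₁ : ∀ {u} → cls u ≡ in₁ → θ′ (f u) m₁ ≡ y
    θ′-m₀-m₁ : θ′ m₀ m₁ ≡ swi
    inhabited₀ : ∃ λ v → cls v ≡ out × h₁ v ≡ false
    inhabited₁ : ∃ λ v → cls v ≡ out × h₁ v ≡ true
    cover : ∀ w → (∃ λ v → cls v ≢ out × w ≡ f v) ⊎ w ≡ m₀ ⊎ w ≡ m₁

val-not : ∀ y n b → val n y (not b) ≡ val y n b
val-not y n true = refl
val-not y n false = refl

-- In the complement each marker sees the other member of the pair. Exchanging the markers and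
-- negating both flags restores the description without changing `f`.
flipPair : ∀ {V V′ : Set} {θ : V → V → Adj} {θ′ : V′ → V′ → Adj} {y n} → HomPair θ θ′ y n → HomPair θ θ′ n y
flipPair {y = y} {n} H = record
  { θ-symm = θ-symm ; θ′-symm = θ′-symm ; cls = cls ; h₀ = not ∘ h₀ ; h₁ = not ∘ h₁
  ; θ-in₀ = λ cu cv → trans (θ-in₀ cu cv) (sym (val-not y n _))
  ; θ-in₁ = λ cu cv → trans (θ-in₁ cu cv) (sym (val-not y n _))
  ; f = f ; m₀ = m₁ ; m₁ = m₀
  ; f-m₀ = λ c e → f-m₁ c (trans (sym (not-involutive _)) (cong not e))
  ; f-m₁ = λ c e → f-m₀ c (trans (sym (not-involutive _)) (cong not e))
  ; f-inj = f-inj ; f≢m₀ = f≢m₁ ; f≢m₁ = f≢m₀ ; m₀≢m₁ = ≢-sym m₀≢m₁ ; θ′-in = θ′-in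
  ; θ′-in₀-m₀ = θ′-in₀-m₁ ; θ′-in₀-m₁ = θ′-in₀-m₀ ; θ′-in₁-m₀ = θ′-in₁-m₁ ; θ′-in₁-m₁ = θ′-in₁-m₀
  ; θ′-m₀-m₁ = trans (θ′-symm _ _) θ′-m₀-m₁
  ; inhabited₀ = let (v , c , e) = inhabited₁ in v , c , cong not e
  ; inhabited₁ = let (v , c , e) = inhabited₀ in v , c , cong not e
  ; cover = swapped ∘ cover }
  where
  open HomPair H
  swapped : ∀ {w} → (∃ λ v → cls v ≢ out × w ≡ f v) ⊎ w ≡ m₀ ⊎ w ≡ m₁ → (∃ λ v → cls v ≢ out × w ≡ f v) ⊎ w ≡ m₁ ⊎ w ≡ m₀
  swapped (inj₁ x) = inj₁ x
  swapped (inj₂ (inj₁ e)) = inj₂ (inj₂ e)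
  swapped (inj₂ (inj₂ e)) = inj₂ (inj₁ e)

-- Pulling a split back to a kept pair whose markers have different colours

module PairTransfer {V V′ : Set} {θ : V → V → Adj} {θ′ : V′ → V′ → Adj} {y n l r}
  (sg : Sign y n l r) (H : HomPair θ θ′ y n) (noCap : NoCap θ y n)
  {χ′ ix′ : V′ → Bool} (S : BalancedSplit θ′ y n l r χ′ ix′)
  (χm₀ : χ′ (HomPair.m₀ H) ≡ l) (χm₁ : χ′ (HomPair.m₁ H) ≡ r)
  where

  open HomPair H
  open BalancedSplit S

  χ ix : V → Bool
  χ = χ′ ∘ f
  ix = ix′ ∘ f

  out? : ∀ v → Dec (cls v ≡ out)
  out? v with cls v
  ... | in₀ = no λ ()
  ... | in₁ = no λ ()
  ... | out = yes refl

  in₀⊎in₁ : ∀ {v} → cls v ≢ out → cls v ≡ in₀ ⊎ cls v ≡ in₁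
  in₀⊎in₁ {v} c with cls v
  ... | in₀ = inj₁ refl
  ... | in₁ = inj₂ refl
  ... | out = ⊥-elim (c refl)

  clash : ∀ {v a b} → cls v ≡ a → cls v ≡ b → a ≢ b → ⊥
  clash e₁ e₂ a≢b = a≢b (trans (sym e₁) e₂)

  in₁≢out : ∀ {v} → cls v ≡ in₁ → cls v ≢ out
  in₁≢out c c′ = clash c c′ λ ()

  l-r : ∀ {b} → b ≡ l → b ≡ r → ⊥
  l-r e₁ e₂ = l≢r sg (trans (sym e₁) e₂)

  y-n : ∀ {a} → a ≡ y → a ≡ n → ⊥
  y-n e₁ e₂ = y≢n sg (trans (sym e₁) e₂)

  -- The image under `f` records completeness to `in₁` and nothing else. As the markers differ in
  -- colour, the colour of an outside vertex determines its value to `in₁`, though not to `in₀`.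
  out-l : ∀ {v} → cls v ≡ out → χ v ≡ l → h₁ v ≡ false
  out-l {v} c e with h₁ v in eq
  ... | false = refl
  ... | true = ⊥-elim (l-r e (trans (cong χ′ (f-m₁ c eq)) χm₁))

  out-r : ∀ {v} → cls v ≡ out → χ v ≡ r → h₁ v ≡ true
  out-r {v} c e with h₁ v in eq
  ... | true = refl
  ... | false = ⊥-elim (l-r (trans (cong χ′ (f-m₀ c eq)) χm₀) e)

  f-l : ∀ {v} → cls v ≡ out → χ v ≡ l → f v ≡ m₀
  f-l c e = f-m₀ c (out-l c e)

  f-r : ∀ {v} → cls v ≡ out → χ v ≡ r → f v ≡ m₁
  f-r c e = f-m₁ c (out-r c e)

  in₁-l : ∀ {u v} → cls u ≡ in₁ → cls v ≡ out → χ v ≡ l → θ u v ≡ n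
  in₁-l cu cv e = trans (θ-in₁ cu cv) (cong (val y n) (out-l cv e))

  in₁-r : ∀ {u v} → cls u ≡ in₁ → cls v ≡ out → χ v ≡ r → θ u v ≡ y
  in₁-r cu cv e = trans (θ-in₁ cu cv) (cong (val y n) (out-r cv e))

  -- Every vertex of `in₀` has value `y` to `m₀`, so what is separated from `m₀` lies in `in₁`,
  -- where `f` loses no information.
  same-or-n : ∀ {u} → cls u ≢ out → χ u ≡ l → ix u ≢ ix′ m₀ → cls u ≡ in₁
  same-or-n cu χu ne with in₀⊎in₁ cu
  ... | inj₂ c = c
  ... | inj₁ c = ⊥-elim (y-n (θ′-in₀-m₀ c) (sepL χu χm₀ ne))

  same-or-y : ∀ {u} → cls u ≢ out → χ u ≡ r → ix u ≢ ix′ m₁ → cls u ≡ in₁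
  same-or-y cu χu ne with in₀⊎in₁ cu
  ... | inj₂ c = c
  ... | inj₁ c = ⊥-elim (y-n (sepR χu χm₁ ne) (θ′-in₀-m₁ c))

  sepL-V : ∀ {u v} → χ u ≡ l → χ v ≡ l → ix u ≢ ix v → θ u v ≡ n
  sepL-V {u} {v} χu χv ne with out? u | out? v
  ... | no c | no c′ = trans (sym (θ′-in c c′)) (sepL χu χv ne)
  ... | no c | yes c′ = in₁-l (same-or-n c χu λ e → ne (trans e (sym (cong ix′ (f-l c′ χv))))) c′ χv
  ... | yes c | no c′ = trans (θ-symm _ _)
          (in₁-l (same-or-n c′ χv λ e → ne (trans (cong ix′ (f-l c χu)) (sym e))) c χu)
  ... | yes c | yes c′ = ⊥-elim (ne (cong ix′ (trans (f-l c χu) (sym (f-l c′ χv)))))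

  sepR-V : ∀ {u v} → χ u ≡ r → χ v ≡ r → ix u ≢ ix v → θ u v ≡ y
  sepR-V {u} {v} χu χv ne with out? u | out? v
  ... | no c | no c′ = trans (sym (θ′-in c c′)) (sepR χu χv ne)
  ... | no c | yes c′ = in₁-r (same-or-y c χu λ e → ne (trans e (sym (cong ix′ (f-r c′ χv))))) c′ χv
  ... | yes c | no c′ = trans (θ-symm _ _)
          (in₁-r (same-or-y c′ χv λ e → ne (trans (cong ix′ (f-r c χu)) (sym e))) c χu)
  ... | yes c | yes c′ = ⊥-elim (ne (cong ix′ (trans (f-r c χu) (sym (f-r c′ χv)))))

  lift : ∀ w → ∃ λ v → χ v ≡ χ′ w × ix v ≡ ix′ w
  lift w with cover w
  ... | inj₁ (v , _ , e) = v , cong χ′ (sym e) , cong ix′ (sym e)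
  ... | inj₂ (inj₁ e) = let (v , c , h) = inhabited₀ ; e′ = trans (f-m₀ c h) (sym e) in v , cong χ′ e′ , cong ix′ e′
  ... | inj₂ (inj₂ e) = let (v , c , h) = inhabited₁ ; e′ = trans (f-m₁ c h) (sym e) in v , cong χ′ e′ , cong ix′ e′

  -- This provides the apex of a hole: lying in `in₁`, it is complete to the outside vertices
  -- coloured `r`, and it misses everything coloured `l` in the part of `m₀`.
  far-l : ∃ λ v → cls v ≡ in₁ × χ v ≡ l × ix v ≢ ix′ m₀
  far-l = let (w , χw , ixw) = inhL (not (ix′ m₀)) ; (v , e , e′) = lift w ; χv = trans e χw
              ne = λ q → not-¬ refl (trans (sym q) (trans e′ ixw))
          in v , same-or-n (λ c → ne (cong ix′ (f-l c χv))) χv ne , χv , ne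

  far-r : ∃ λ v → cls v ≡ in₁ × χ v ≡ r × ix v ≢ ix′ m₁
  far-r = let (w , χw , ixw) = inhR (not (ix′ m₁)) ; (v , e , e′) = lift w ; χv = trans e χw
              ne = λ q → not-¬ refl (trans (sym q) (trans e′ ixw))
          in v , same-or-y (λ c → ne (cong ix′ (f-r c χv))) χv ne , χv , ne

  -- Each marker is complete to exactly one member of the pair, so values to `in₀` survive only for
  -- vertices that are also complete to exactly one.
  Faithful : V → Set
  Faithful v = cls v ≡ out → h₀ v ≡ not (h₁ v)

  transferˡ : ∀ {u v} → u ≢ v → cls u ≢ out → Faithful v → f u ≢ f v × θ′ (f u) (f v) ≡ θ u v
  transferˡ {u} {v} u≢v cu ok with out? v
  ... | no cv = (u≢v ∘ f-inj cu cv) , θ′-in cu cv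
  ... | yes cv with h₁ v in e₁ | in₀⊎in₁ cu
  ...   | false | inj₁ c = (λ e → f≢m₀ cu (trans e (f-m₀ cv e₁)))
            , trans (cong (θ′ (f u)) (f-m₀ cv e₁)) (trans (θ′-in₀-m₀ c) (sym (trans (θ-in₀ c cv) (cong (val y n) (ok cv)))))
  ...   | false | inj₂ c = (λ e → f≢m₀ cu (trans e (f-m₀ cv e₁)))
            , trans (cong (θ′ (f u)) (f-m₀ cv e₁)) (trans (θ′-in₁-m₀ c) (sym (trans (θ-in₁ c cv) (cong (val y n) e₁))))
  ...   | true | inj₁ c = (λ e → f≢m₁ cu (trans e (f-m₁ cv e₁)))
            , trans (cong (θ′ (f u)) (f-m₁ cv e₁)) (trans (θ′-in₀-m₁ c) (sym (trans (θ-in₀ c cv) (cong (val y n) (ok cv)))))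
  ...   | true | inj₂ c = (λ e → f≢m₁ cu (trans e (f-m₁ cv e₁)))
            , trans (cong (θ′ (f u)) (f-m₁ cv e₁)) (trans (θ′-in₁-m₁ c) (sym (trans (θ-in₁ c cv) (cong (val y n) e₁))))

  transfer : ∀ {u v} → u ≢ v → cls u ≢ out ⊎ cls v ≢ out → Faithful u → Faithful v →
             f u ≢ f v × θ′ (f u) (f v) ≡ θ u v
  transfer u≢v (inj₁ cu) _ ok = transferˡ u≢v cu ok
  transfer u≢v (inj₂ cv) ok _ with transferˡ (≢-sym u≢v) cv ok
  ... | ne , e = ≢-sym ne , trans (θ′-symm _ _) (trans e (θ-symm _ _))

  -- Odd paths through a kept pair

  module PathHalf {k : ℕ} {p : ℕ → V} (P : ℕPath θ y n k p) (odd : parity k ≡ oddP) (1<k : 1 < k)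
    (χ0 : χ (p 0) ≡ r) (χk : χ (p k) ≡ r) (χi : ∀ i → 0 < i → i < k → χ (p i) ≡ l) where
    open ℕPath P

    k≢2 : k ≢ 2
    k≢2 refl = odd≢even odd refl

    Fits : ℕ → ℕ → Set
    Fits i j = f (p i) ≢ f (p j)
             × (j ≡ suc i → θ′ (f (p i)) (f (p j)) ≢ n)
             × (suc i < j → θ′ (f (p i)) (f (p j)) ≢ y)

    direct : (∀ i → i ≤ k → Faithful (p i)) →
             (∀ {i j} → i < j → j ≤ k → cls (p i) ≡ out → cls (p j) ≡ out → Fits i j) → ⊥
    direct ok both = noPath image odd 1<k χ0 χk χi
      where
      fits : ∀ {i j} → i < j → j ≤ k → cls (p i) ≢ out ⊎ cls (p j) ≢ out → Fits i j
      fits {i} {j} i<j j≤k c with transfer (dis i<j j≤k) c (ok i (≤-trans (<⇒≤ i<j) j≤k)) (ok j j≤k)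
      ... | ne , e = ne , (λ { refl e′ → adj j≤k (trans (sym e) e′) }) , (λ far e′ → ant far j≤k (trans (sym e) e′))
      all : ∀ {i j} → i < j → j ≤ k → Fits i j
      all {i} {j} i<j j≤k with out? (p i) | out? (p j)
      ... | no c | _ = fits i<j j≤k (inj₁ c)
      ... | yes _ | no c = fits i<j j≤k (inj₂ c)
      ... | yes c | yes c′ = both i<j j≤k c c′
      image : ℕPath θ′ y n k (f ∘ p)
      image = record
        { dis = λ i<j j≤k → proj₁ (all i<j j≤k)
        ; adj = λ i<k → proj₁ (proj₂ (all ≤-refl i<k)) refl
        ; ant = λ far j≤k → proj₂ (proj₂ (all (<-trans (n<1+n _) far) j≤k)) far }

    at-in₀ : ∀ {i j} → cls (p i) ≢ out → cls (p j) ≡ out → χ (p j) ≡ l → θ (p i) (p j) ≢ n →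
             cls (p i) ≡ in₀ × h₀ (p j) ≡ true
    at-in₀ {i} {j} ci cj χj ne with in₀⊎in₁ ci
    ... | inj₂ c = ⊥-elim (ne (in₁-l c cj χj))
    ... | inj₁ c with h₀ (p j) in e
    ...   | true = c , refl
    ...   | false = ⊥-elim (ne (trans (θ-in₀ c cj) (cong (val y n) e)))

    in₀-out-y : ∀ {i j} → cls (p i) ≡ in₀ → cls (p j) ≡ out → h₀ (p j) ≡ true → θ (p i) (p j) ≡ y
    in₀-out-y ci cj e = trans (θ-in₀ ci cj) (cong (val y n) e)

    single : ∀ s → h₀ (p s) ≡ not (h₁ (p s)) → (∀ i → i ≤ k → cls (p i) ≡ out → i ≡ s) → ⊥
    single s hs only = direct (λ i i≤k c → subst (λ a → h₀ (p a) ≡ not (h₁ (p a))) (sym (only i i≤k c)) hs)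
      λ i<j j≤k ci cj → ⊥-elim (<-irrefl (trans (only _ (≤-trans (<⇒≤ i<j) j≤k) ci) (sym (only _ j≤k cj))) i<j)

    -- Outside vertices coloured `l` miss `in₁`, so the outside is entered and left through `in₀`,
    -- at vertices complete to `in₀`. The vertex before the first outside vertex is then strongly
    -- adjacent to the last one as well, so these two coincide.
    both-in : cls (p 0) ≢ out → cls (p k) ≢ out → ⊥
    both-in c0 ck with firstUpTo (out? ∘ p) k | lastUpTo (out? ∘ p) k
    ... | inj₁ none | _ = direct (λ i i≤k c → ⊥-elim (none i i≤k c))
                            (λ i<j j≤k c _ → ⊥-elim (none _ (≤-trans (<⇒≤ i<j) j≤k) c))
    ... | inj₂ (s , s≤k , cs , _) | inj₁ none = none s s≤k cs
    ... | inj₂ (zero , _ , cs , _) | _ = c0 cs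
    ... | inj₂ (suc s , s<k , cs , before) | inj₂ (t , t≤k , ct , after) =
        single (suc s) (trans (proj₂ left) (cong not (sym (out-l cs χs)))) only
      where
      χs : χ (p (suc s)) ≡ l
      χs = χi (suc s) (s≤s z≤n) (≤∧≢⇒< s<k λ { refl → ck cs })
      left : cls (p s) ≡ in₀ × h₀ (p (suc s)) ≡ true
      left = at-in₀ (before s ≤-refl) cs χs (adj s<k)
      t<k : t < k
      t<k = ≤∧≢⇒< t≤k λ { refl → ck ct }
      s<t : s < t
      s<t = ≮⇒≥ λ t≤s → before t t≤s ct
      right : cls (p (suc t)) ≡ in₀ × h₀ (p t) ≡ true
      right = at-in₀ (after (suc t) ≤-refl t<k) ct (χi t (≤-trans (s≤s z≤n) s<t) t<k)
                (λ e → adj t<k (trans (θ-symm _ _) e))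
      t≡ : t ≡ suc s
      t≡ with near θ-symm P (<⇒≤ s<k) t≤k (<⇒≢ s<t) (in₀-out-y (proj₁ left) ct (proj₂ right))
      ... | inj₁ e = e
      ... | inj₂ refl = ⊥-elim (<⇒≱ s<t (n≤1+n t))
      only : ∀ i → i ≤ k → cls (p i) ≡ out → i ≡ suc s
      only i i≤k c = ≤-antisym (subst (i ≤_) t≡ (≮⇒≥ λ t<i → after i t<i i≤k c)) (≮⇒≥ λ i<s → before i i<s c)

    -- A path vertex in `in₁` would be strongly adjacent to both path ends, forcing `k = 2`. The
    -- interior therefore lies in the part of `m₀`, and the vertex of `far-l` closes an odd hole.
    both-out : cls (p 0) ≡ out → cls (p k) ≡ out → ⊥
    both-out c0 ck with far-l
    ... | x , cx , χx , ix≢ = noCap x P odd 1<k avoid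
            (λ e → y-n (in₁-r cx c0 χ0) e) (λ e → y-n (in₁-r cx ck χk) e) inner
      where
      no-in₁ : ∀ i → i ≤ k → cls (p i) ≢ in₁
      no-in₁ i i≤k c with near θ-symm P i≤k z≤n (λ { refl → in₁≢out c c0 }) (in₁-r c c0 χ0)
                        | near θ-symm P i≤k ≤-refl (λ { refl → in₁≢out c ck }) (in₁-r c ck χk)
      ... | inj₂ refl | inj₁ e = k≢2 e
      ... | inj₂ refl | inj₂ e = n≮0 (subst (1 <_) (sym (suc-injective e)) 1<k)
      avoid : ∀ i → i ≤ k → x ≢ p i
      avoid i i≤k refl = no-in₁ i i≤k cx
      inner : ∀ i → 0 < i → i < k → θ x (p i) ≢ y
      inner i 0<i i<k e with out? (p i)
      ... | yes c = y-n e (in₁-l cx c (χi i 0<i i<k))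
      ... | no c with ix (p i) ≟ᵇ ix′ m₀
      ...   | no ne = no-in₁ i (<⇒≤ i<k) (same-or-n c (χi i 0<i i<k) ne)
      ...   | yes q = y-n e (sepL-V χx (χi i 0<i i<k) λ q′ → ix≢ (trans q′ q))

    -- Since `p k` is not strongly adjacent to `p 0`, it lies in `in₀` and `p 0` is not complete to
    -- `in₀`. An interior outside vertex complete to `in₀` is strongly adjacent to `p k`, so it
    -- immediately precedes it. Hence at most that interior vertex is outside, or all of them are
    -- and `far-r` gives an apex.
    out-in : cls (p 0) ≡ out → cls (p k) ≢ out → ⊥
    out-in c0 ck = by-last (lastUpTo (out? ∘ p) k)
      where
      k₀ : cls (p k) ≡ in₀
      k₀ with in₀⊎in₁ ck
      ... | inj₁ c = c
      ... | inj₂ c = ⊥-elim (ant 1<k ≤-refl (trans (θ-symm _ _) (in₁-r c c0 χ0)))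
      h0 : h₀ (p 0) ≡ not (h₁ (p 0))
      h0 with h₀ (p 0) in e
      ... | false = cong not (sym (out-r c0 χ0))
      ... | true = ⊥-elim (ant 1<k ≤-refl (trans (θ-symm _ _) (in₀-out-y k₀ c0 e)))
      last-out : ∀ i → i < k → cls (p i) ≡ out → h₀ (p i) ≡ true → k ≡ suc i
      last-out i i<k c e with near θ-symm P ≤-refl (<⇒≤ i<k) (≢-sym (<⇒≢ i<k)) (in₀-out-y k₀ c e)
      ... | inj₁ refl = ⊥-elim (<⇒≱ i<k (n≤1+n k))
      ... | inj₂ q = q

      module _ (t : ℕ) (t<k : suc t < k) (ct : cls (p (suc t)) ≡ out)
               (after : ∀ i → suc t < i → i ≤ k → cls (p i) ≢ out) where

        ht : h₀ (p (suc t)) ≡ true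
        ht = proj₂ (at-in₀ (after (suc (suc t)) ≤-refl t<k) ct (χi (suc t) (s≤s z≤n) t<k)
               (λ e → adj t<k (trans (θ-symm _ _) e)))
        k≡ : k ≡ suc (suc t)
        k≡ = last-out (suc t) t<k ct ht
        last≡t : ∀ i → i < k → cls (p i) ≡ out → h₀ (p i) ≡ true → i ≡ suc t
        last≡t i i<k c e = suc-injective (trans (sym (last-out i i<k c e)) k≡)

        all-in : cls (p 1) ≢ out → ∀ i → 0 < i → i < suc t → cls (p i) ≢ out
        all-in c (suc zero) _ _ = c
        all-in c (suc (suc i)) _ i<t c′ = <-irrefl (last≡t (suc (suc i)) i<k c′
            (proj₂ (at-in₀ (all-in c (suc i) (s≤s z≤n) (<⇒≤ i<t)) c′ (χi (suc (suc i)) (s≤s z≤n) i<k) (adj (<⇒≤ i<k))))) i<t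
          where
          i<k : suc (suc i) < k
          i<k = <-trans i<t t<k

        all-out : cls (p 1) ≡ out → ∀ i → 0 < i → i < k → cls (p i) ≡ out
        all-out c (suc zero) _ _ = c
        all-out c (suc (suc i)) _ i<k = decidable-stable (out? _) λ c′ →
          <-irrefl (trans (cong suc (last≡t (suc i) (<⇒≤ i<k) (all-out c (suc i) (s≤s z≤n) (<⇒≤ i<k))
            (proj₂ (at-in₀ c′ (all-out c (suc i) (s≤s z≤n) (<⇒≤ i<k)) (χi (suc i) (s≤s z≤n) (<⇒≤ i<k))
               (λ e → adj (<⇒≤ i<k) (trans (θ-symm _ _) e)))))) (sym k≡)) i<k

        two-outs : cls (p 1) ≢ out → ⊥
        two-outs c = direct faithful both
          where
          only : ∀ i → i ≤ k → cls (p i) ≡ out → i ≡ 0 ⊎ i ≡ suc t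
          only zero _ _ = inj₁ refl
          only (suc i) i≤k ci = inj₂ (≤-antisym (≮⇒≥ λ t<i → after (suc i) t<i i≤k ci)
                                               (≮⇒≥ λ i<t → all-in c (suc i) (s≤s z≤n) i<t ci))
          faithful : ∀ i → i ≤ k → Faithful (p i)
          faithful i i≤k ci with only i i≤k ci
          ... | inj₁ refl = h0
          ... | inj₂ refl = trans ht (cong not (sym (out-l ct (χi (suc t) (s≤s z≤n) t<k))))
          both : ∀ {i j} → i < j → j ≤ k → cls (p i) ≡ out → cls (p j) ≡ out → Fits i j
          both {i} {j} i<j j≤k ci cj with only i (≤-trans (<⇒≤ i<j) j≤k) ci | only j j≤k cj
          ... | _ | inj₁ refl = ⊥-elim (n≮0 i<j)
          ... | inj₂ refl | inj₂ refl = ⊥-elim (<-irrefl refl i<j)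
          ... | inj₁ refl | inj₂ refl =
              (λ e → m₀≢m₁ (trans (sym f-t) (trans (sym e) f-0)))
            , (λ _ e → swi≢n sg (trans (sym θ0t) e)) , λ _ e → swi≢y sg (trans (sym θ0t) e)
            where
            f-0 : f (p 0) ≡ m₁
            f-0 = f-r c0 χ0
            f-t : f (p (suc t)) ≡ m₀
            f-t = f-l ct (χi (suc t) (s≤s z≤n) t<k)
            θ0t : θ′ (f (p 0)) (f (p (suc t))) ≡ swi
            θ0t = trans (cong₂ θ′ f-0 f-t) (trans (θ′-symm _ _) θ′-m₀-m₁)

        capped : cls (p 1) ≡ out → ⊥
        capped c with far-r
        ... | x , cx , χx , ix≢ = noCap x P odd 1<k avoid (λ e → y-n (in₁-r cx c0 χ0) e) x-k
                λ i 0<i i<k e → y-n e (in₁-l cx (all-out c i 0<i i<k) (χi i 0<i i<k))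
          where
          x-k : θ x (p k) ≢ n
          -- The path ends are not strongly adjacent, so `p k` shares the part of `p 0` and `m₁`;
          -- the apex lies in the other part and is strongly adjacent to `p k`.
          x-k e with ix (p k) ≟ᵇ ix (p 0)
          ... | no ne = ant 1<k ≤-refl (trans (θ-symm _ _) (sepR-V χk χ0 ne))
          ... | yes q = y-n (sepR-V χx χk λ q′ → ix≢ (trans q′ (trans q (cong ix′ (f-r c0 χ0))))) e
          avoid : ∀ i → i ≤ k → x ≢ p i
          avoid zero _ refl = in₁≢out cx c0
          avoid (suc i) i≤k refl with m≤n⇒m<n∨m≡n i≤k
          ... | inj₁ i<k = in₁≢out cx (all-out c (suc i) (s≤s z≤n) i<k)
          ... | inj₂ refl = clash cx k₀ λ ()

      by-last : (∀ i → i ≤ k → ¬ cls (p i) ≡ out) ⊎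
                (∃ λ t → t ≤ k × cls (p t) ≡ out × (∀ i → t < i → i ≤ k → ¬ cls (p i) ≡ out)) → ⊥
      by-last (inj₁ none) = none 0 z≤n c0
      by-last (inj₂ (zero , _ , _ , after)) = single 0 h0 λ { zero _ _ → refl ; (suc i) i≤k c → ⊥-elim (after (suc i) (s≤s z≤n) i≤k c) }
      by-last (inj₂ (suc t , t≤k , ct , after)) with ≤∧≢⇒< t≤k (λ { refl → ck ct }) | out? (p 1)
      ... | t<k | yes c = capped t t<k ct after c
      ... | t<k | no c = two-outs t t<k ct after c

  noPath-V : NoOddPath θ y n l r χ
  noPath-V {k} {p} P odd 1<k χ0 χk χi with out? (p 0) | out? (p k)
  ... | no c | no c′ = PathHalf.both-in P odd 1<k χ0 χk χi c c′
  ... | yes c | yes c′ = PathHalf.both-out P odd 1<k χ0 χk χi c c′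
  ... | yes c | no c′ = PathHalf.out-in P odd 1<k χ0 χk χi c c′
  ... | no c | yes c′ = PathHalf.out-in (reversePath θ-symm P) odd 1<k χk (trans (cong (χ ∘ p) (n∸n≡0 k)) χ0)
        (λ i 0<i i<k → χi (k ∸ i) (m<n⇒0<n∸m i<k) (∸-monoʳ-< 0<i (<⇒≤ i<k)))
        c′ (λ c″ → c (trans (cong (cls ∘ p) (sym (n∸n≡0 k))) c″))

-- Antipaths are the path case for the complement, with colours and markers both exchanged.
pairSplit : ∀ {V V′ : Set} {θ : V → V → Adj} {θ′ : V′ → V′ → Adj} {y n l r} (sg : Sign y n l r)
  (H : HomPair θ θ′ y n) → NoCap θ y n → NoCap θ n y →
  ∀ {χ′ ix′} → BalancedSplit θ′ y n l r χ′ ix′ → χ′ (HomPair.m₀ H) ≡ l → χ′ (HomPair.m₁ H) ≡ r →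
  BalancedSplit θ y n l r (χ′ ∘ HomPair.f H) (ix′ ∘ HomPair.f H)
pairSplit sg H noCap noAnticap S χm₀ χm₁ = record
  { sepL = sepL-V ; sepR = sepR-V
  ; inhL = λ i → let (w , χw , ixw) = inhL i ; (v , e₁ , e₂) = lift w in v , trans e₁ χw , trans e₂ ixw
  ; inhR = λ i → let (w , χw , ixw) = inhR i ; (v , e₁ , e₂) = lift w in v , trans e₁ χw , trans e₂ ixw
  ; noPath = noPath-V
  ; noAntipath = PairTransfer.noPath-V (flipSign sg) (flipPair H) noAnticap (flipSplit S) χm₁ χm₀ }
  where
  open PairTransfer sg H noCap S χm₀ χm₁
  open BalancedSplit S using (inhL; inhR)

-- Balanced splits versus balanced skew-partitions

-- Double-negation shift: the reason why reachability may be treated as decidable when proving ⊥.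
Shift : Set → Set₁
Shift V = (Q : V → Set) → (∀ v → ¬ ¬ Q v) → ¬ ¬ (∀ v → Q v)

shift-Fin : ∀ n → Shift (Fin n)
shift-Fin zero Q q c = c λ ()
shift-Fin (suc n) Q q c = q zero λ q₀ → shift-Fin n (Q ∘ suc) (q ∘ suc) λ qₛ →
  c λ { zero → q₀ ; (suc i) → qₛ i }

shift-⊎ : ∀ {V W} → Shift V → Shift W → Shift (V ⊎ W)
shift-⊎ sV sW Q q c = sV (Q ∘ inj₁) (q ∘ inj₁) λ q₁ → sW (Q ∘ inj₂) (q ∘ inj₂) λ q₂ →
  c λ { (inj₁ v) → q₁ v ; (inj₂ w) → q₂ w }

-- Membership in `P v` need not be decidable. Under the assumption that the fibre statement fails,
-- one member yields its instance of `Q` doubly negated, and proof irrelevance carries that instance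
-- to every other member.
shift-Σ : ∀ {V} {P : V → Set} → (∀ {v} (a b : P v) → a ≡ b) → Shift V → Shift (Σ V P)
shift-Σ {P = P} irr sV Q q c = sV (λ v → ∀ a → Q (v , a)) fibre λ q′ → c λ { (v , a) → q′ v a }
  where
  fibre : ∀ v → ¬ ¬ (∀ a → Q (v , a))
  fibre v d = d λ a → ⊥-elim (q (v , a) λ x → d λ b → subst (λ b → Q (v , b)) (irr a b) x)

module _ {V : Set} {R : V → V → Set} {X : V → Set} where

  walk-snoc : ∀ {u v w} → Walk R X u v → R v w → X w → Walk R X u w
  walk-snoc (here x) e xw = step x e (here xw)
  walk-snoc (step x e′ W) e xw = step x e′ (walk-snoc W e xw)

  walk-start : ∀ {u v} → Walk R X u v → X u
  walk-start (here x) = x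
  walk-start (step x _ _) = x

  walk-invariant : (ix : V → Bool) → (∀ {u v} → X u → X v → R u v → ix u ≡ ix v) →
                   ∀ {u v} → Walk R X u v → ix u ≡ ix v
  walk-invariant ix inv (here _) = refl
  walk-invariant ix inv (step x e W) = trans (inv x (walk-start W) e) (walk-invariant ix inv W)

  -- The shift over both vertices reduces the claim to a fixed pair, and a third shift makes
  -- reachability from `u` decidable. The set reachable from `u` is then the separation.
  separate : Shift V → ¬ (∀ u v → X u → X v → Walk R X u v) →
    ¬ ¬ (Σ (V → Bool) λ ix → (∃ λ u → X u × ix u ≡ true) × (∃ λ v → X v × ix v ≡ false) ×
          (∀ {u v} → X u → X v → ix u ≡ true → ix v ≡ false → ¬ R u v))
  separate sh ¬conn c = sh _ (λ u → sh _ λ v → unconnected u v) λ conn → ¬conn conn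
    where
    unconnected : ∀ u v → ¬ ¬ (X u → X v → Walk R X u v)
    unconnected u v d = sh (λ w → Dec (Walk R X u w)) (λ w → ¬¬-excluded-middle) λ reach? → d λ xu xv → by-reach reach? xu xv
      where
      by-reach : (∀ w → Dec (Walk R X u w)) → X u → X v → Walk R X u v
      by-reach reach? xu xv with reach? v in eqv | reach? u in equ
      ... | yes W | _ = W
      ... | no _ | no ¬W = ⊥-elim (¬W (here xu))
      ... | no ¬W | yes _ = ⊥-elim (c (does ∘ reach? , (u , xu , cong does equ) , (v , xv , cong does eqv) , sep))
        where
        sep : ∀ {a b} → X a → X b → does (reach? a) ≡ true → does (reach? b) ≡ false → ¬ R a b
        sep {a} {b} xa xb ea eb e with reach? a | reach? b
        ... | yes W | no ¬W = ¬W (walk-snoc W e xb)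

module _ {V : Set} (T : Trigraph V) where

  toSplit : Shift V → HasBalancedSkewPartition T →
            ¬ ¬ (∃ λ χ → ∃ λ ix → BalancedSplit (θ T) pos neg true false χ ix)
  toSplit sh (A , (¬conn , ¬anti) , (noP , noA)) c =
    separate sh ¬conn λ { (i₁ , (u₁ , xu₁ , eu₁) , (v₁ , xv₁ , ev₁) , sep₁) →
    separate sh ¬anti λ { (i₂ , (u₂ , xu₂ , eu₂) , (v₂ , xv₂ , ev₂) , sep₂) →
    c (A , (λ v → if A v then i₁ v else i₂ v) , record
      { sepL = λ {u} {v} → sepˡ i₁ i₂ sep₁ {u} {v}
      ; sepR = λ {u} {v} → sepʳ i₁ i₂ sep₂ {u} {v}
      ; inhL = λ { true → u₁ , xu₁ , trans (cong (if_then i₁ u₁ else i₂ u₁) xu₁) eu₁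
                 ; false → v₁ , xv₁ , trans (cong (if_then i₁ v₁ else i₂ v₁) xv₁) ev₁ }
      ; inhR = λ { true → u₂ , xu₂ , trans (cong (if_then i₁ u₂ else i₂ u₂) xu₂) eu₂
                 ; false → v₂ , xv₂ , trans (cong (if_then i₁ v₂ else i₂ v₂) xv₂) ev₂ }
      ; noPath = λ {k} {p} P o 1<k a b d → noP k (fromℕPath {T = T} P) o 1<k a
                   (trans (cong (A ∘ p) (toℕ-fromℕ k)) b) λ i → d (toℕ i)
      ; noAntipath = λ {k} {p} P o 1<k a b d → noA k (fromℕPath {T = complement T} (complementPath P)) o 1<k a
                   (trans (cong (A ∘ p) (toℕ-fromℕ k)) b) λ i → d (toℕ i) }) } }
    where
    module _ (i₁ i₂ : V → Bool) where
      ix : V → Bool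
      ix v = if A v then i₁ v else i₂ v
      sepˡ : (∀ {u v} → InA A u → InA A v → i₁ u ≡ true → i₁ v ≡ false → ¬ Adjacent T u v) →
             ∀ {u v} → A u ≡ true → A v ≡ true → ix u ≢ ix v → θ T u v ≡ neg
      sepˡ sep {u} {v} au av ne rewrite au | av with i₁ u in iu | i₁ v in iv | θ T u v in e
      ... | _ | _ | neg = refl
      ... | true | true | _ = ⊥-elim (ne refl)
      ... | false | false | _ = ⊥-elim (ne refl)
      ... | true | false | pos = ⊥-elim (sep au av iu iv (inj₁ e))
      ... | true | false | swi = ⊥-elim (sep au av iu iv (inj₂ e))
      ... | false | true | pos = ⊥-elim (sep av au iv iu (inj₁ (trans (θ-sym T v u) e)))
      ... | false | true | swi = ⊥-elim (sep av au iv iu (inj₂ (trans (θ-sym T v u) e)))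
      sepʳ : (∀ {u v} → InB A u → InB A v → i₂ u ≡ true → i₂ v ≡ false → ¬ Adjacent (complement T) u v) →
             ∀ {u v} → A u ≡ false → A v ≡ false → ix u ≢ ix v → θ T u v ≡ pos
      sepʳ sep {u} {v} au av ne rewrite au | av with i₂ u in iu | i₂ v in iv | θ T u v in e
      ... | _ | _ | pos = refl
      ... | true | true | _ = ⊥-elim (ne refl)
      ... | false | false | _ = ⊥-elim (ne refl)
      ... | true | false | neg = ⊥-elim (sep au av iu iv (inj₁ (cong negA e)))
      ... | true | false | swi = ⊥-elim (sep au av iu iv (inj₂ (cong negA e)))
      ... | false | true | neg = ⊥-elim (sep av au iv iu (inj₁ (cong negA (trans (θ-sym T v u) e))))
      ... | false | true | swi = ⊥-elim (sep av au iv iu (inj₂ (cong negA (trans (θ-sym T v u) e))))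

  fromSplit : ∀ {χ ix} → BalancedSplit (θ T) pos neg true false χ ix → HasBalancedSkewPartition T
  fromSplit {χ} {ix} S = χ , (¬conn , ¬anti) ,
      (λ k P o 1<k a b d → noPath (toℕPath P) o 1<k a (trans (cong (χ ∘ vtx P) (at-last k)) b) (inner P d))
    , (λ k P o 1<k a b d → noAntipath (uncomplementPath (toℕPath P)) o 1<k a
         (trans (cong (χ ∘ vtx P) (at-last k)) b) (inner P d))
    where
    open BalancedSplit S
    inner : ∀ {T′ : Trigraph V} {k b} (P : Path T′ k) → InteriorIn P (λ v → χ v ≡ b) →
            ∀ i → 0 < i → i < k → χ (vtx P (at k i)) ≡ b
    inner P d i 0<i i<k = d (at _ i) (subst (0 <_) (sym (toℕ-at (<⇒≤ i<k))) 0<i) (subst (_< _) (sym (toℕ-at (<⇒≤ i<k))) i<k)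
    ¬conn : ¬ Connected T (InA χ)
    ¬conn conn with inhL true | inhL false
    ... | u , χu , iu | v , χv , iv with trans (sym iu) (trans (walk-invariant ix inv (conn u v χu χv)) iv)
      where
      inv : ∀ {a b} → χ a ≡ true → χ b ≡ true → Adjacent T a b → ix a ≡ ix b
      inv {a} {b} xa xb e with ix a ≟ᵇ ix b
      ... | yes q = q
      ... | no ne = ⊥-elim (adjacent⇒≢neg e (sepL xa xb ne))
    ...   | ()
    ¬anti : ¬ Anticonnected T (InB χ)
    ¬anti conn with inhR true | inhR false
    ... | u , χu , iu | v , χv , iv with trans (sym iu) (trans (walk-invariant ix inv (conn u v χu χv)) iv)
      where
      inv : ∀ {a b} → χ a ≡ false → χ b ≡ false → Adjacent (complement T) a b → ix a ≡ ix b
      inv {a} {b} xa xb e with ix a ≟ᵇ ix b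
      ... | yes q = q
      ... | no ne = ⊥-elim (adjacent⇒≢neg e (cong negA (sepR xa xb ne)))
    ...   | ()

-- Blocks of 2-joins

uip : ∀ {A : Set} {a b : A} (p q : a ≡ b) → p ≡ q
uip refl refl = refl

inj₁-injective-fst : ∀ {V W : Set} {P : V → Set} {u v : V} {a : P u} {b : P v} →
                     _≡_ {A = Σ V P ⊎ W} (inj₁ (u , a)) (inj₁ (v , b)) → u ≡ v
inj₁-injective-fst refl = refl

inj₁≢inj₂ : ∀ {A B : Set} {a : A} {b : B} → inj₁ a ≢ inj₂ b
inj₁≢inj₂ ()

kindOf : Bool → Kind
kindOf true = kA
kindOf false = kB

meets : Kind → Bool → Bool
meets kA true = true
meets kB false = true
meets _ _ = false

crossVal-end : ∀ κ K → crossVal κ (kindOf K) ≡ val pos neg (meets κ K)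
crossVal-end kA true = refl
crossVal-end kA false = refl
crossVal-end kB true = refl
crossVal-end kB false = refl
crossVal-end kC true = refl
crossVal-end kC false = refl

crossVal-mid : ∀ κ → crossVal κ kC ≡ neg
crossVal-mid kA = refl
crossVal-mid kB = refl
crossVal-mid kC = refl

meets-exclusive : ∀ κ → meets κ true ≡ true → meets κ false ≡ true → ⊥
meets-exclusive kA _ ()
meets-exclusive kB () _
meets-exclusive kC () _

sideCls : Side × Kind → Cls
sideCls (s₁ , _) = kept
sideCls (s₂ , kA) = end true
sideCls (s₂ , kB) = end false
sideCls (s₂ , kC) = mid

sideCls-kept : ∀ w → sideCls w ≡ kept → proj₁ w ≡ s₁
sideCls-kept (s₁ , _) _ = refl
sideCls-kept (s₂ , kA) ()
sideCls-kept (s₂ , kB) ()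
sideCls-kept (s₂ , kC) ()

sideCls-mid : ∀ w → sideCls w ≡ mid → w ≡ (s₂ , kC)
sideCls-mid (s₁ , _) ()
sideCls-mid (s₂ , kA) ()
sideCls-mid (s₂ , kB) ()
sideCls-mid (s₂ , kC) _ = refl

sideCls-end : ∀ w K → sideCls w ≡ end K → w ≡ (s₂ , kindOf K)
sideCls-end (s₁ , _) _ ()
sideCls-end (s₂ , kA) true _ = refl
sideCls-end (s₂ , kA) false ()
sideCls-end (s₂ , kB) true ()
sideCls-end (s₂ , kB) false _ = refl
sideCls-end (s₂ , kC) _ ()

end-sideCls : ∀ K → sideCls (s₂ , kindOf K) ≡ end K
end-sideCls true = refl
end-sideCls false = refl

-- ia true, ia false index the markers attached to A₁, B₁, and ic the third marker of an even join;
-- an odd join has none, and ic then repeats one of the first two, to receive the vertices of C₂.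
module TwoJoinBlock {V : Set} {T : Trigraph V} {sp : Split V} {y n par}
  (end-nonempty : ∀ s K → ∃ λ v → sp v ≡ (s , kindOf K))
  (cross-end : ∀ {u v} K → proj₁ (sp u) ≡ s₁ → sp v ≡ (s₂ , kindOf K) → θ T u v ≡ val y n (meets (proj₂ (sp u)) K))
  (cross-mid : ∀ {u v} → proj₁ (sp u) ≡ s₁ → sp v ≡ (s₂ , kC) → θ T u v ≡ n)
  (link : ∀ {k p} → ℕPath (θ T) y n k p → sp (p 0) ≡ (s₂ , kA) → sp (p k) ≡ (s₂ , kB) →
          (∀ i → 0 < i → i < k → sp (p i) ≡ (s₂ , kC)) → parity k ≡ par)
  {k : ℕ} (fm : Kind → Fin k → Adj) (m : Fin k → Fin k → Adj) (m-sym : ∀ i j → m i j ≡ m j i)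
  (ia : Bool → Fin k) (ic : Fin k)
  (fm-end : ∀ κ K → fm κ (ia K) ≡ val y n (meets κ K))
  (ia≢ia : ∀ K → ia K ≢ ia (not K))
  (odd-m : par ≡ oddP → ∀ K → m (ia K) (ia (not K)) ≡ swi)
  (even-m : par ≡ evenP → ∀ K → m (ia K) (ia (not K)) ≡ n)
  (even-c : par ≡ evenP → ∀ K → m (ia K) ic ≡ swi)
  (even-ia≢ic : par ≡ evenP → ∀ K → ia K ≢ ic)
  (even-fm : par ≡ evenP → ∀ κ → fm κ ic ≡ n)
  (exhaust : ∀ i → (∃ λ K → i ≡ ia K) ⊎ i ≡ ic)
  where

  T′ : Trigraph (Σ V (λ v → proj₁ (sp v) ≡ s₁) ⊎ Fin k)
  T′ = extend T (λ v → proj₁ (sp v) ≡ s₁) k (λ v → fm (proj₂ (sp v))) m m-sym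

  -- Matching on `w` beside an explicit equation keeps the membership proof at hand; `place-kept`
  -- then replaces it by any other proof.
  place : ∀ v w → sp v ≡ w → Σ V (λ v → proj₁ (sp v) ≡ s₁) ⊎ Fin k
  place v (s₁ , _) e = inj₁ (v , cong proj₁ e)
  place v (s₂ , kA) e = inj₂ (ia true)
  place v (s₂ , kB) e = inj₂ (ia false)
  place v (s₂ , kC) e = inj₂ ic

  retract : V → Σ V (λ v → proj₁ (sp v) ≡ s₁) ⊎ Fin k
  retract v = place v (sp v) refl

  place-kept : ∀ v w (e : sp v ≡ w) (q : proj₁ (sp v) ≡ s₁) → place v w e ≡ inj₁ (v , q)
  place-kept v (s₁ , _) e q = cong (λ x → inj₁ (v , x)) (uip _ _)
  place-kept v (s₂ , _) e q with trans (sym (cong proj₁ e)) q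
  ... | ()

  place-end : ∀ v w (e : sp v ≡ w) K → w ≡ (s₂ , kindOf K) → place v w e ≡ inj₂ (ia K)
  place-end v _ e true refl = refl
  place-end v _ e false refl = refl

  place-mid : ∀ v w (e : sp v ≡ w) → w ≡ (s₂ , kC) → place v w e ≡ inj₂ ic
  place-mid v _ e refl = refl

  cls′ : V → Cls
  cls′ = sideCls ∘ sp

  on₁ : ∀ {v} → cls′ v ≡ kept → proj₁ (sp v) ≡ s₁
  on₁ {v} = sideCls-kept (sp v)

  kept-on₁ : ∀ w → proj₁ w ≡ s₁ → sideCls w ≡ kept
  kept-on₁ (s₁ , _) refl = refl

  retract-kept : ∀ {v} (c : cls′ v ≡ kept) → retract v ≡ inj₁ (v , on₁ c)
  retract-kept {v} c = place-kept v (sp v) refl (on₁ c)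

  retract-end : ∀ {v K} → cls′ v ≡ end K → retract v ≡ inj₂ (ia K)
  retract-end {v} {K} c = place-end v (sp v) refl K (sideCls-end (sp v) K c)

  retract-mid : ∀ {v} → cls′ v ≡ mid → retract v ≡ inj₂ ic
  retract-mid {v} c = place-mid v (sp v) refl (sideCls-mid (sp v) c)

  kept-marker : ∀ {u} i → cls′ u ≡ kept → θ T′ (retract u) (inj₂ i) ≡ fm (proj₂ (sp u)) i
  kept-marker i c = cong (λ x → θ T′ x (inj₂ i)) (retract-kept c)

  kept≢marker : ∀ {u i} → cls′ u ≡ kept → retract u ≢ inj₂ i
  kept≢marker c e = inj₁≢inj₂ (trans (sym (retract-kept c)) e)

  join : Join (θ T) (θ T′) y n par
  join = record
    { θ-symm = θ-sym T ; θ′-symm = θ-sym T′ ; cls = cls′ ; sees = λ u → meets (proj₂ (sp u))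
    ; θ-end = λ {u} {v} {K} cu cv → cross-end K (on₁ cu) (sideCls-end (sp v) K cv)
    ; θ-mid = λ {u} {v} cu cv → cross-mid (on₁ cu) (sideCls-mid (sp v) cv)
    ; f = retract ; mk = inj₂ ∘ ia ; mc = inj₂ ic
    ; f-end = retract-end ; f-mid = retract-mid
    ; f-inj = λ cu cv e → inj₁-injective-fst (trans (sym (retract-kept cu)) (trans e (retract-kept cv)))
    ; f≢mk = λ K c → kept≢marker c
    ; mk≢mk = λ K e → ia≢ia K (inj₂-injective e)
    ; θ′-kept = λ cu cv → cong₂ (θ T′) (retract-kept cu) (retract-kept cv)
    ; θ′-end = λ {u} K c → trans (kept-marker (ia K) c) (fm-end (proj₂ (sp u)) K)
    ; odd-mk = odd-m ; even-mk = even-m ; even-mc = even-c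
    ; even-mk≢mc = λ ev K e → even-ia≢ic ev K (inj₂-injective e)
    ; even-kept = λ {u} ev c → trans (kept-marker ic c) (even-fm ev (proj₂ (sp u)))
    ; even-f≢mc = λ _ c → kept≢marker c
    ; linkParity = linkParity
    -- Any vertex of `A₁` sees `A₂` and misses `B₂`, and symmetrically for `B₁`.
    ; private-neighbour = λ K → let (z , e) = end-nonempty s₁ K in
        z , kept-on₁ (sp z) (cong proj₁ e) , trans (cong (λ w → meets (proj₂ w) K) e) (meets-own K)
          , trans (cong (λ w → meets (proj₂ w) (not K)) e) (meets-other K)
    ; end-inhabited = λ K → let (v , e) = end-nonempty s₂ K in v , trans (cong sideCls e) (end-sideCls K)
    ; cover = cover }
    where
    meets-own : ∀ K → meets (kindOf K) K ≡ true
    meets-own true = refl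
    meets-own false = refl
    meets-other : ∀ K → meets (kindOf K) (not K) ≡ false
    meets-other true = refl
    meets-other false = refl
    linkParity : ∀ {k p} K → ℕPath (θ T) y n k p → cls′ (p 0) ≡ end K → cls′ (p k) ≡ end (not K) →
                 (∀ i → 0 < i → i < k → cls′ (p i) ≡ mid) → parity k ≡ par
    linkParity {k} {p} true P c0 ck ci = link P (sideCls-end _ true c0) (sideCls-end _ false ck)
      λ i 0<i i<k → sideCls-mid _ (ci i 0<i i<k)
    linkParity {k} {p} false P c0 ck ci = link (reversePath (θ-sym T) P) (sideCls-end _ true ck)
      (trans (cong (sp ∘ p) (n∸n≡0 k)) (sideCls-end _ false c0))
      λ i 0<i i<k → sideCls-mid _ (ci (k ∸ i) (m<n⇒0<n∸m i<k) (∸-monoʳ-< 0<i (<⇒≤ i<k)))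
    cover : ∀ w → (∃ λ v → cls′ v ≡ kept × w ≡ retract v) ⊎ (∃ λ K → w ≡ inj₂ (ia K)) ⊎ w ≡ inj₂ ic
    cover (inj₁ (v , e)) = inj₁ (v , kept-on₁ (sp v) e , sym (place-kept v (sp v) refl e))
    cover (inj₂ i) with exhaust i
    ... | inj₁ (K , e) = inj₂ (inj₁ (K , cong inj₂ e))
    ... | inj₂ e = inj₂ (inj₂ (cong inj₂ e))

  exclusive : ∀ {u} → cls′ u ≡ kept → meets (proj₂ (sp u)) true ≡ true → meets (proj₂ (sp u)) false ≡ true → ⊥
  exclusive {u} _ = meets-exclusive (proj₂ (sp u))

-- Odd and even 2-joins: choosing the end marker coloured `l`

ends₂ : Bool → Fin 2
ends₂ true = zero
ends₂ false = suc zero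

ends₃ : Bool → Fin 3
ends₃ true = zero
ends₃ false = suc zero

c₃ : Fin 3
c₃ = suc (suc zero)

ends₂-m2 : ∀ K → m2 (ends₂ K) (ends₂ (not K)) ≡ swi
ends₂-m2 true = refl
ends₂-m2 false = refl

ends₂≢ : ∀ K → ends₂ K ≢ ends₂ (not K)
ends₂≢ true ()
ends₂≢ false ()

ends₂-exhaust : (i : Fin 2) → ∃ λ K → i ≡ ends₂ K
ends₂-exhaust zero = true , refl
ends₂-exhaust (suc zero) = false , refl

ends₃-m3 : ∀ a K → m3 a (ends₃ K) (ends₃ (not K)) ≡ a
ends₃-m3 a true = refl
ends₃-m3 a false = refl

ends₃-c : ∀ a K → m3 a (ends₃ K) c₃ ≡ swi
ends₃-c a true = refl
ends₃-c a false = refl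

ends₃≢ : ∀ K → ends₃ K ≢ ends₃ (not K)
ends₃≢ true ()
ends₃≢ false ()

ends₃≢c : ∀ K → ends₃ K ≢ c₃
ends₃≢c true ()
ends₃≢c false ()

ends₃-exhaust : (i : Fin 3) → (∃ λ K → i ≡ ends₃ K) ⊎ i ≡ c₃
ends₃-exhaust zero = inj₁ (true , refl)
ends₃-exhaust (suc zero) = inj₁ (false , refl)
ends₃-exhaust (suc (suc zero)) = inj₂ refl

module TwoJoinCases {V : Set} {T : Trigraph V} {sp : Split V} {y n l r par} (sg : Sign y n l r)
  (noCap : NoCap (θ T) y n) (noAnticap : NoCap (θ T) n y)
  (end-nonempty : ∀ s K → ∃ λ v → sp v ≡ (s , kindOf K))
  (cross-end : ∀ {u v} K → proj₁ (sp u) ≡ s₁ → sp v ≡ (s₂ , kindOf K) → θ T u v ≡ val y n (meets (proj₂ (sp u)) K))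
  (cross-mid : ∀ {u v} → proj₁ (sp u) ≡ s₁ → sp v ≡ (s₂ , kC) → θ T u v ≡ n)
  (link : ∀ {k p} → ℕPath (θ T) y n k p → sp (p 0) ≡ (s₂ , kA) → sp (p k) ≡ (s₂ , kB) →
          (∀ i → 0 < i → i < k → sp (p i) ≡ (s₂ , kC)) → parity k ≡ par)
  where

  odd-split : par ≡ oddP → (fm : Kind → Fin 2 → Adj) → (∀ κ K → fm κ (ends₂ K) ≡ val y n (meets κ K)) →
    ∀ {χ′ ix′} → BalancedSplit (θ (extend T (λ v → proj₁ (sp v) ≡ s₁) 2 (λ v → fm (proj₂ (sp v))) m2 m2-sym)) y n l r χ′ ix′ →
    ∃ λ χ → ∃ λ ix → BalancedSplit (θ T) y n l r χ ix
  odd-split od fm fm-end {χ′} S = by-colour (l⊎r sg (χ′ (inj₂ zero))) (l⊎r sg (χ′ (inj₂ (suc zero))))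
    where
    no-even : par ≡ evenP → ⊥
    no-even = odd≢even od
    -- The block is described for both choices of the marker doubling as `mc`, because that marker
    -- must be coloured `l` and the colours are known only later.
    module B (K : Bool) = TwoJoinBlock {T = T} {sp} end-nonempty cross-end cross-mid link fm m2 m2-sym ends₂ (ends₂ K) fm-end
      ends₂≢ (λ _ → ends₂-m2) (⊥-elim ∘ no-even) (⊥-elim ∘ no-even) (⊥-elim ∘ no-even) (⊥-elim ∘ no-even) (inj₁ ∘ ends₂-exhaust)
    by-colour : χ′ (inj₂ zero) ≡ l ⊎ χ′ (inj₂ zero) ≡ r → χ′ (inj₂ (suc zero)) ≡ l ⊎ χ′ (inj₂ (suc zero)) ≡ r →
                ∃ λ χ → ∃ λ ix → BalancedSplit (θ T) y n l r χ ix
    by-colour (inj₁ e) _ = joinSplit sg (B.join true) noCap noAnticap S true e e refl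
    by-colour _ (inj₁ e) = joinSplit sg (B.join false) noCap noAnticap S false e e refl
    by-colour (inj₂ e) (inj₂ e′) =
      ⊥-elim (Markers.not-both-right sg (B.join true) S (λ {u} → B.exclusive true {u}) (inj₂ (true , refl)) e e′)

  even-split : par ≡ evenP → (fm : Kind → Fin 3 → Adj) → (∀ κ K → fm κ (ends₃ K) ≡ val y n (meets κ K)) →
    (∀ κ → fm κ c₃ ≡ n) →
    ∀ {χ′ ix′} → BalancedSplit (θ (extend T (λ v → proj₁ (sp v) ≡ s₁) 3 (λ v → fm (proj₂ (sp v))) (m3 n) (m3-sym n))) y n l r χ′ ix′ →
    ∃ λ χ → ∃ λ ix → BalancedSplit (θ T) y n l r χ ix
  even-split ev fm fm-end fm-c {χ′} S = by-colour (l⊎r sg (χ′ (inj₂ zero))) (l⊎r sg (χ′ (inj₂ (suc zero))))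
    where
    module B = TwoJoinBlock {T = T} {sp} end-nonempty cross-end cross-mid link fm (m3 n) (m3-sym n) ends₃ c₃ fm-end
      ends₃≢ (λ od → ⊥-elim (odd≢even od ev)) (λ _ → ends₃-m3 n) (λ _ → ends₃-c n) (λ _ → ends₃≢c) (λ _ → fm-c)
      ends₃-exhaust
    open Markers sg B.join S
    χc : χ′ (inj₂ c₃) ≡ l
    χc = mc-left ev
    by-colour : χ′ (inj₂ zero) ≡ l ⊎ χ′ (inj₂ zero) ≡ r → χ′ (inj₂ (suc zero)) ≡ l ⊎ χ′ (inj₂ (suc zero)) ≡ r →
                ∃ λ χ → ∃ λ ix → BalancedSplit (θ T) y n l r χ ix
    by-colour (inj₁ e) _ = joinSplit sg B.join noCap noAnticap S true e χc (ix-mc ev χc true e)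
    by-colour _ (inj₁ e) = joinSplit sg B.join noCap noAnticap S false e χc (ix-mc ev χc false e)
    by-colour (inj₂ e) (inj₂ e′) = ⊥-elim (not-both-right (λ {u} → B.exclusive {u}) (inj₁ χc) e e′)

-- Blocks of homogeneous pairs

completeTo : HClass → Bool → Bool
completeTo hC true = true
completeTo hD false = true
completeTo hE _ = true
completeTo _ _ = false

-- The outside of a homogeneous pair, seen as an odd join

module OuterBlock {V : Set} {T : Trigraph V} {cls : V → HClass} (H : IsProperHomogeneousPair T cls) where

  open IsProperHomogeneousPair H

  T′ : Trigraph (Σ V (InCDEF ∘ cls) ⊎ Fin 2)
  T′ = extend T (InCDEF ∘ cls) 2 (fOuter ∘ cls) m2 m2-sym

  outerCls : HClass → Cls
  outerCls hA = end true
  outerCls hB = end false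
  outerCls _ = kept

  place : ∀ v h → cls v ≡ h → Σ V (InCDEF ∘ cls) ⊎ Fin 2
  place v hA e = inj₂ zero
  place v hB e = inj₂ (suc zero)
  place v hC e = inj₁ (v , subst InCDEF (sym e) tt)
  place v hD e = inj₁ (v , subst InCDEF (sym e) tt)
  place v hE e = inj₁ (v , subst InCDEF (sym e) tt)
  place v hF e = inj₁ (v , subst InCDEF (sym e) tt)

  irr : ∀ h (a b : InCDEF h) → a ≡ b
  irr hC _ _ = refl
  irr hD _ _ = refl
  irr hE _ _ = refl
  irr hF _ _ = refl

  kept-in : ∀ h → outerCls h ≡ kept → InCDEF h
  kept-in hC _ = tt
  kept-in hD _ = tt
  kept-in hE _ = tt
  kept-in hF _ = tt

  in-kept : ∀ h → InCDEF h → outerCls h ≡ kept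
  in-kept hC _ = refl
  in-kept hD _ = refl
  in-kept hE _ = refl
  in-kept hF _ = refl

  place-kept : ∀ v h (e : cls v ≡ h) (a : InCDEF (cls v)) → place v h e ≡ inj₁ (v , a)
  place-kept v hA e a = ⊥-elim (subst InCDEF e a)
  place-kept v hB e a = ⊥-elim (subst InCDEF e a)
  place-kept v hC e a = cong (λ x → inj₁ (v , x)) (irr (cls v) _ _)
  place-kept v hD e a = cong (λ x → inj₁ (v , x)) (irr (cls v) _ _)
  place-kept v hE e a = cong (λ x → inj₁ (v , x)) (irr (cls v) _ _)
  place-kept v hF e a = cong (λ x → inj₁ (v , x)) (irr (cls v) _ _)

  place-end : ∀ v h (e : cls v ≡ h) K → outerCls h ≡ end K → place v h e ≡ inj₂ (ends₂ K)
  place-end v hA e true refl = refl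
  place-end v hB e false refl = refl

  retract : V → Σ V (InCDEF ∘ cls) ⊎ Fin 2
  retract v = place v (cls v) refl

  retract-kept : ∀ {v} (c : outerCls (cls v) ≡ kept) → retract v ≡ inj₁ (v , kept-in (cls v) c)
  retract-kept {v} c = place-kept v (cls v) refl _

  θ-end : ∀ {u v K} → outerCls (cls u) ≡ kept → outerCls (cls v) ≡ end K → θ T u v ≡ val pos neg (completeTo (cls u) K)
  θ-end {u} {v} {K} cu cv with cls u in eu | cls v in ev
  θ-end {u} {v} refl refl | hC | hA = A₁ u v ev (inj₁ eu)
  θ-end {u} {v} refl refl | hD | hA = A₂ u v ev (inj₁ eu)
  θ-end {u} {v} refl refl | hE | hA = A₁ u v ev (inj₂ eu)
  θ-end {u} {v} refl refl | hF | hA = A₂ u v ev (inj₂ eu)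
  θ-end {u} {v} refl refl | hC | hB = B₂ u v ev (inj₁ eu)
  θ-end {u} {v} refl refl | hD | hB = B₁ u v ev (inj₁ eu)
  θ-end {u} {v} refl refl | hE | hB = B₁ u v ev (inj₂ eu)
  θ-end {u} {v} refl refl | hF | hB = B₂ u v ev (inj₂ eu)

  θ′-end : ∀ h K → outerCls h ≡ kept → fOuter h (ends₂ K) ≡ val pos neg (completeTo h K)
  θ′-end hC true _ = refl
  θ′-end hC false _ = refl
  θ′-end hD true _ = refl
  θ′-end hD false _ = refl
  θ′-end hE true _ = refl
  θ′-end hE false _ = refl
  θ′-end hF true _ = refl
  θ′-end hF false _ = refl

  kept-marker : ∀ {u} i → outerCls (cls u) ≡ kept → θ T′ (retract u) (inj₂ i) ≡ fOuter (cls u) i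
  kept-marker i c = cong (λ x → θ T′ x (inj₂ i)) (retract-kept c)

  no-mid : ∀ h → outerCls h ≢ mid
  no-mid hA ()
  no-mid hB ()
  no-mid hC ()
  no-mid hD ()
  no-mid hE ()
  no-mid hF ()

  module _ {y n} (sees : HClass → Bool → Bool)
    (sees-val : ∀ h K → val pos neg (completeTo h K) ≡ val y n (sees h K))
    (private-nbr : ∀ K → ∃ λ z → outerCls (cls z) ≡ kept × sees (cls z) K ≡ true × sees (cls z) (not K) ≡ false)
    (K₀ : Bool) where

    join : Join (θ T) (θ T′) y n oddP
    join = record
      { θ-symm = θ-sym T ; θ′-symm = θ-sym T′ ; cls = outerCls ∘ cls ; sees = sees ∘ cls
      ; θ-end = λ {u} {v} {K} cu cv → trans (θ-end cu cv) (sees-val (cls u) K)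
      ; θ-mid = λ {u} {v} _ c → ⊥-elim (no-mid (cls v) c)
      ; f = retract ; mk = inj₂ ∘ ends₂ ; mc = inj₂ (ends₂ K₀)
      ; f-end = λ {v} {K} c → place-end v (cls v) refl K c
      ; f-mid = λ {v} c → ⊥-elim (no-mid (cls v) c)
      ; f-inj = λ cu cv e → inj₁-injective-fst (trans (sym (retract-kept cu)) (trans e (retract-kept cv)))
      ; f≢mk = λ K c e → inj₁≢inj₂ (trans (sym (retract-kept c)) e)
      ; mk≢mk = λ { true () ; false () }
      ; θ′-kept = λ cu cv → cong₂ (θ T′) (retract-kept cu) (retract-kept cv)
      ; θ′-end = λ {u} K c → trans (kept-marker (ends₂ K) c) (trans (θ′-end (cls u) K c) (sees-val (cls u) K))
      ; odd-mk = λ _ → ends₂-m2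
      ; even-mk = λ () ; even-mc = λ () ; even-mk≢mc = λ () ; even-kept = λ () ; even-f≢mc = λ ()
      ; linkParity = linkParity
      ; private-neighbour = private-nbr
      ; end-inhabited = λ { true → let (v , _ , e , _) = A-big in v , cong outerCls e
                          ; false → let (v , _ , e , _) = B-big in v , cong outerCls e }
      ; cover = cover }
      where
      linkParity : ∀ {k p} K → ℕPath (θ T) y n k p → outerCls (cls (p 0)) ≡ end K → outerCls (cls (p k)) ≡ end (not K) →
                   (∀ i → 0 < i → i < k → outerCls (cls (p i)) ≡ mid) → parity k ≡ oddP
      -- No vertex is `mid`, so a link is a single edge; this is why the parity is odd.
      linkParity {zero} K _ c0 ck _ = ⊥-elim (not-¬ refl (end-injective (trans (sym c0) ck)))
      linkParity {suc zero} _ _ _ _ _ = refl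
      linkParity {suc (suc k)} _ _ _ _ ci = ⊥-elim (no-mid _ (ci 1 (s≤s z≤n) (s≤s (s≤s z≤n))))
      cover : ∀ w → (∃ λ v → outerCls (cls v) ≡ kept × w ≡ retract v) ⊎ (∃ λ K → w ≡ inj₂ (ends₂ K)) ⊎ w ≡ inj₂ (ends₂ K₀)
      cover (inj₁ (v , a)) = inj₁ (v , in-kept (cls v) a , sym (place-kept v (cls v) refl a))
      cover (inj₂ i) with ends₂-exhaust i
      ... | K , e = inj₂ (inj₁ (K , cong inj₂ e))

  split : NoCap (θ T) pos neg → NoCap (θ T) neg pos → ∀ {χ′ ix′} → BalancedSplit (θ T′) pos neg true false χ′ ix′ →
          ∃ λ χ → ∃ λ ix → BalancedSplit (θ T) pos neg true false χ ix
  split noCap noAnticap {χ′} S = by-colour (l⊎r plain (χ′ (inj₂ zero))) (l⊎r plain (χ′ (inj₂ (suc zero))))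
    where
    -- Vertices of `C` see only `A` and those of `D` only `B`; in the complement they exchange
    -- roles.
    nbr : ∀ K → ∃ λ z → outerCls (cls z) ≡ kept × completeTo (cls z) K ≡ true × completeTo (cls z) (not K) ≡ false
    nbr true = let (z , e) = C-nonempty in z , cong outerCls e , cong (λ h → completeTo h true) e , cong (λ h → completeTo h false) e
    nbr false = let (z , e) = D-nonempty in z , cong outerCls e , cong (λ h → completeTo h false) e , cong (λ h → completeTo h true) e
    conbr : ∀ K → ∃ λ z → outerCls (cls z) ≡ kept × not (completeTo (cls z) K) ≡ true × not (completeTo (cls z) (not K)) ≡ false
    conbr true = let (z , c , e , e′) = nbr false in z , c , cong not e′ , cong not e
    conbr false = let (z , c , e , e′) = nbr true in z , c , cong not e′ , cong not e
    by-colour : χ′ (inj₂ zero) ≡ true ⊎ χ′ (inj₂ zero) ≡ false → χ′ (inj₂ (suc zero)) ≡ true ⊎ χ′ (inj₂ (suc zero)) ≡ false →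
                ∃ λ χ → ∃ λ ix → BalancedSplit (θ T) pos neg true false χ ix
    by-colour (inj₁ e) _ = joinSplit plain (join completeTo (λ _ _ → refl) nbr true) noCap noAnticap S true e e refl
    by-colour _ (inj₁ e) = joinSplit plain (join completeTo (λ _ _ → refl) nbr false) noCap noAnticap S false e e refl
    -- Vertices of `E` see both ends, so this colouring is possible. In the complement the same
    -- block is again a join, and there these markers lie on the side that is not connected.
    by-colour (inj₂ e) (inj₂ _) =
      let (χ , ix , S′) = joinSplit complemented
            (join (λ h K → not (completeTo h K)) (λ h K → sym (val-not pos neg (completeTo h K))) conbr true)
            noAnticap noCap (flipSplit S) true e e refl
      in χ , ix , flipSplit S′

-- The homogeneous pair itself, with its outside replaced by two markers

module InnerBlock {V : Set} {T : Trigraph V} {cls : V → HClass} (H : IsProperHomogeneousPair T cls) where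

  open IsProperHomogeneousPair H
  open OuterBlock H using (outerCls; θ-end)

  T′ : Trigraph (Σ V (InAB ∘ cls) ⊎ Fin 2)
  T′ = extend T (InAB ∘ cls) 2 (fInner ∘ cls) m2 m2-sym

  irr : ∀ h (a b : InAB h) → a ≡ b
  irr hA _ _ = refl
  irr hB _ _ = refl

  -- `K` names the member of the pair whose marker will be coloured `true`; it plays `in₀`, so that
  -- `m₀` is on the side that is not connected.
  innerCls : Bool → HClass → PairCls
  innerCls K hA = if K then in₀ else in₁
  innerCls K hB = if K then in₁ else in₀
  innerCls K _ = out

  innerCls-in₀ : ∀ K h → innerCls K h ≡ in₀ → outerCls h ≡ end K
  innerCls-in₀ true hA refl = refl
  innerCls-in₀ false hB refl = refl

  innerCls-in₁ : ∀ K h → innerCls K h ≡ in₁ → outerCls h ≡ end (not K)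
  innerCls-in₁ true hB refl = refl
  innerCls-in₁ false hA refl = refl

  innerCls-out : ∀ K h → innerCls K h ≡ out → outerCls h ≡ kept
  innerCls-out _ hC _ = refl
  innerCls-out _ hD _ = refl
  innerCls-out _ hE _ = refl
  innerCls-out _ hF _ = refl
  innerCls-out true hA ()
  innerCls-out true hB ()
  innerCls-out false hA ()
  innerCls-out false hB ()

  in-pair : ∀ K h → innerCls K h ≢ out → InAB h
  in-pair _ hA _ = tt
  in-pair _ hB _ = tt
  in-pair _ hC c = ⊥-elim (c refl)
  in-pair _ hD c = ⊥-elim (c refl)
  in-pair _ hE c = ⊥-elim (c refl)
  in-pair _ hF c = ⊥-elim (c refl)

  pair-in : ∀ K h → InAB h → innerCls K h ≢ out
  pair-in true hA _ ()
  pair-in true hB _ ()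
  pair-in false hA _ ()
  pair-in false hB _ ()

  fInner-end : ∀ h K K′ → outerCls h ≡ end K → fInner h (ends₂ K′) ≡ val pos neg (not (K xor K′))
  fInner-end hA true true refl = refl
  fInner-end hA true false refl = refl
  fInner-end hB false true refl = refl
  fInner-end hB false false refl = refl

  outside : Bool → HClass → Fin 2
  outside K h = ends₂ (if completeTo h (not K) then not K else K)

  place : ∀ (K : Bool) v h → cls v ≡ h → Σ V (InAB ∘ cls) ⊎ Fin 2
  place K v hA e = inj₁ (v , subst InAB (sym e) tt)
  place K v hB e = inj₁ (v , subst InAB (sym e) tt)
  place K v h e = inj₂ (outside K h)

  place-in : ∀ K v h (e : cls v ≡ h) (a : InAB (cls v)) → place K v h e ≡ inj₁ (v , a)
  place-in K v hA e a = cong (λ x → inj₁ (v , x)) (irr (cls v) _ _)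
  place-in K v hB e a = cong (λ x → inj₁ (v , x)) (irr (cls v) _ _)
  place-in K v hC e a = ⊥-elim (subst InAB e a)
  place-in K v hD e a = ⊥-elim (subst InAB e a)
  place-in K v hE e a = ⊥-elim (subst InAB e a)
  place-in K v hF e a = ⊥-elim (subst InAB e a)

  place-out : ∀ K v h (e : cls v ≡ h) → outerCls h ≡ kept → place K v h e ≡ inj₂ (outside K h)
  place-out K v hC e _ = refl
  place-out K v hD e _ = refl
  place-out K v hE e _ = refl
  place-out K v hF e _ = refl

  module _ (K : Bool) where

    retract : V → Σ V (InAB ∘ cls) ⊎ Fin 2
    retract v = place K v (cls v) refl

    retract-in : ∀ {v} (c : innerCls K (cls v) ≢ out) → retract v ≡ inj₁ (v , in-pair K (cls v) c)
    retract-in {v} c = place-in K v (cls v) refl _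

    retract-out : ∀ {v b} → innerCls K (cls v) ≡ out → completeTo (cls v) (not K) ≡ b →
                  retract v ≡ inj₂ (ends₂ (if b then not K else K))
    retract-out {v} c refl = place-out K v (cls v) refl (innerCls-out K (cls v) c)

    in-marker : ∀ {v} K₁ K₂ → outerCls (cls v) ≡ end K₁ → innerCls K (cls v) ≢ out →
                θ T′ (retract v) (inj₂ (ends₂ K₂)) ≡ val pos neg (not (K₁ xor K₂))
    in-marker {v} K₁ K₂ c c′ = trans (cong (λ x → θ T′ x (inj₂ (ends₂ K₂))) (retract-in c′)) (fInner-end (cls v) K₁ K₂ c)

    in₀≢ : ∀ {v} → innerCls K (cls v) ≡ in₀ → innerCls K (cls v) ≢ out
    in₀≢ c c′ with trans (sym c) c′
    ... | ()

    in₁≢ : ∀ {v} → innerCls K (cls v) ≡ in₁ → innerCls K (cls v) ≢ out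
    in₁≢ c c′ with trans (sym c) c′
    ... | ()

    homPair : HomPair (θ T) (θ T′) pos neg
    homPair = record
      { θ-symm = θ-sym T ; θ′-symm = θ-sym T′ ; cls = innerCls K ∘ cls
      ; h₀ = λ v → completeTo (cls v) K ; h₁ = λ v → completeTo (cls v) (not K)
      ; θ-in₀ = λ {u} {v} cu cv → trans (θ-sym T u v) (θ-end (innerCls-out K (cls v) cv) (innerCls-in₀ K (cls u) cu))
      ; θ-in₁ = λ {u} {v} cu cv → trans (θ-sym T u v) (θ-end (innerCls-out K (cls v) cv) (innerCls-in₁ K (cls u) cu))
      ; f = retract ; m₀ = inj₂ (ends₂ K) ; m₁ = inj₂ (ends₂ (not K))
      ; f-m₀ = retract-out ; f-m₁ = retract-out
      ; f-inj = λ cu cv e → inj₁-injective-fst (trans (sym (retract-in cu)) (trans e (retract-in cv)))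
      ; f≢m₀ = λ c e → inj₁≢inj₂ (trans (sym (retract-in c)) e)
      ; f≢m₁ = λ c e → inj₁≢inj₂ (trans (sym (retract-in c)) e)
      ; m₀≢m₁ = markers-differ K
      ; θ′-in = λ cu cv → cong₂ (θ T′) (retract-in cu) (retract-in cv)
      ; θ′-in₀-m₀ = λ {u} c → trans (in-marker K K (innerCls-in₀ K (cls u) c) (in₀≢ {u} c)) (cong (val pos neg ∘ not) (xor-same K))
      ; θ′-in₀-m₁ = λ {u} c → trans (in-marker K (not K) (innerCls-in₀ K (cls u) c) (in₀≢ {u} c)) (same-other K)
      ; θ′-in₁-m₀ = λ {u} c → trans (in-marker (not K) K (innerCls-in₁ K (cls u) c) (in₁≢ {u} c)) (other-same K)
      ; θ′-in₁-m₁ = λ {u} c → trans (in-marker (not K) (not K) (innerCls-in₁ K (cls u) c) (in₁≢ {u} c)) (cong (val pos neg ∘ not) (xor-same (not K)))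
      ; θ′-m₀-m₁ = ends₂-m2 K
      ; inhabited₀ = inhabited₀ K ; inhabited₁ = inhabited₁ K
      ; cover = cover }
      where
      markers-differ : ∀ K → _≢_ {A = Σ V (InAB ∘ cls) ⊎ Fin 2} (inj₂ (ends₂ K)) (inj₂ (ends₂ (not K)))
      markers-differ true ()
      markers-differ false ()
      same-other : ∀ K → val pos neg (not (K xor not K)) ≡ neg
      same-other true = refl
      same-other false = refl
      other-same : ∀ K → val pos neg (not (not K xor K)) ≡ neg
      other-same true = refl
      other-same false = refl
      -- `F` misses both members of the pair and `E` is complete to both, so these witnesses suit
      -- either choice of `K`.
      inhabited₀ : ∀ K → ∃ λ v → innerCls K (cls v) ≡ out × completeTo (cls v) (not K) ≡ false
      inhabited₀ K = let (v , e) = F-nonempty in v , cong (innerCls K) e , cong (λ h → completeTo h (not K)) e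
      inhabited₁ : ∀ K → ∃ λ v → innerCls K (cls v) ≡ out × completeTo (cls v) (not K) ≡ true
      inhabited₁ K = let (v , e) = E-nonempty in v , cong (innerCls K) e , cong (λ h → completeTo h (not K)) e
      markers : ∀ K i → i ≡ ends₂ K ⊎ i ≡ ends₂ (not K)
      markers true zero = inj₁ refl
      markers true (suc zero) = inj₂ refl
      markers false zero = inj₂ refl
      markers false (suc zero) = inj₁ refl
      cover : ∀ w → (∃ λ v → innerCls K (cls v) ≢ out × w ≡ retract v) ⊎ w ≡ inj₂ (ends₂ K) ⊎ w ≡ inj₂ (ends₂ (not K))
      cover (inj₁ (v , a)) = inj₁ (v , pair-in K (cls v) a , sym (place-in K v (cls v) refl a))
      cover (inj₂ i) with markers K i
      ... | inj₁ e = inj₂ (inj₁ (cong inj₂ e))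
      ... | inj₂ e = inj₂ (inj₂ (cong inj₂ e))

  -- Equally coloured markers lie in one part, being switchable. A vertex of the other part has the
  -- same value to both, whereas each vertex of the pair sees exactly one of them. The two signs
  -- cover the two colours.
  markers-split : ∀ {y n l r χ′ ix′} → Sign y n l r → BalancedSplit (θ T′) y n l r χ′ ix′ →
                  χ′ (inj₂ zero) ≡ l → χ′ (inj₂ (suc zero)) ≡ l → ⊥
  markers-split {y} {n} {l} {χ′ = χ′} {ix′} sg S χc χd = no-vertex (inhL (not (ix′ (inj₂ zero))))
    where
    open BalancedSplit S
    same : ix′ (inj₂ zero) ≡ ix′ (inj₂ (suc zero))
    same with ix′ (inj₂ zero) ≟ᵇ ix′ (inj₂ (suc zero))
    ... | yes e = e
    ... | no ne = ⊥-elim (swi≢n sg (sepL χc χd ne))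
    distinguished : ∀ h → InAB h → fInner h zero ≢ fInner h (suc zero)
    distinguished hA _ ()
    distinguished hB _ ()
    no-vertex : (∃ λ w → χ′ w ≡ l × ix′ w ≡ not (ix′ (inj₂ zero))) → ⊥
    no-vertex (inj₂ zero , _ , e) = not-¬ refl e
    no-vertex (inj₂ (suc zero) , _ , e) = not-¬ refl (trans same e)
    no-vertex (inj₁ (v , a) , χw , e) = distinguished (cls v) a
      (trans (sepL χw χc λ q → not-¬ refl (trans (sym q) e))
             (sym (sepL χw χd λ q → not-¬ refl (trans (trans same (sym q)) e))))

  split : NoCap (θ T) pos neg → NoCap (θ T) neg pos → ∀ {χ′ ix′} → BalancedSplit (θ T′) pos neg true false χ′ ix′ →
          ∃ λ χ → ∃ λ ix → BalancedSplit (θ T) pos neg true false χ ix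
  split noCap noAnticap {χ′} S with χ′ (inj₂ zero) in ec | χ′ (inj₂ (suc zero)) in ed
  ... | true | true = ⊥-elim (markers-split plain S ec ed)
  ... | false | false = ⊥-elim (markers-split complemented (flipSplit S) ec ed)
  ... | true | false = _ , _ , pairSplit plain (homPair true) noCap noAnticap S ec ed
  ... | false | true = _ , _ , pairSplit plain (homPair false) noCap noAnticap S ed ec

-- From fragments to the abstract joins and pairs

crossVal-negated : ∀ {a} κ K → negA a ≡ crossVal κ (kindOf K) → a ≡ val neg pos (meets κ K)
crossVal-negated {a} κ K e = uncomplement (trans e (crossVal-end κ K))
  where
  uncomplement : ∀ {b} → negA a ≡ val pos neg b → a ≡ val neg pos b
  uncomplement {true} = negA-pos
  uncomplement {false} = negA-neg

joinEnds : ∀ {V} {T′ : Trigraph V} {sp} → IsTwoJoin T′ sp → ∀ s K → ∃ λ v → sp v ≡ (s , kindOf K)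
joinEnds J s true = IsTwoJoin.A-nonempty J s
joinEnds J s false = IsTwoJoin.B-nonempty J s

joinCross : ∀ {V} {T′ : Trigraph V} {sp} → IsTwoJoin T′ sp → ∀ {u v κ} → proj₁ (sp u) ≡ s₁ → sp v ≡ (s₂ , κ) →
        θ T′ u v ≡ crossVal (proj₂ (sp u)) κ
joinCross {sp = sp} J {u} {v} cu cv = trans (IsTwoJoin.cross J u v cu (cong proj₁ cv)) (cong (crossVal (proj₂ (sp u)) ∘ proj₂) cv)

joinLink : ∀ {V} {T′ : Trigraph V} {sp par} → TwoJoinParity T′ sp par → ∀ {k p} → ℕPath (θ T′) pos neg k p →
       sp (p 0) ≡ (s₂ , kA) → sp (p k) ≡ (s₂ , kB) → (∀ i → 0 < i → i < k → sp (p i) ≡ (s₂ , kC)) → parity k ≡ par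
joinLink {T′ = T′} {sp} tp {k} {p} P c0 ck ci = tp s₂ k (fromℕPath {T = T′} P) c0 (trans (cong (sp ∘ p) (toℕ-fromℕ k)) ck) λ i → ci (toℕ i)

theorem9p2 : (n : ℕ) (T : Trigraph (Fin n)) → InF T →
    ¬ HasBalancedSkewPartition T →
    (φ : Fragment T) → ¬ HasBalancedSkewPartition (block T φ)
theorem9p2 n T (berge , _) noBSP φ bsp = toSplit (block T φ) (shift φ) bsp λ { (_ , _ , S) → refute φ S }
  where
  noCap : NoCap (θ T) pos neg
  noCap = berge⇒noCap T berge
  noAnticap : NoCap (θ T) neg pos
  noAnticap = berge⇒noAnticap T berge
  shift : ∀ (φ : Fragment T) → Shift (BlockV φ)
  shift φ = shift-⊎ (shift-Σ (irrelevant φ) (shift-Fin n)) (shift-Fin (nMarkers φ))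
    where
    irrelevant : ∀ (φ : Fragment T) {v} (a b : FragmentSet φ v) → a ≡ b
    irrelevant (twoJoin _ _ _ _) = uip
    irrelevant (coTwoJoin _ _ _ _) = uip
    irrelevant (hpInner cls H) {v} = InnerBlock.irr H (cls v)
    irrelevant (hpOuter cls H) {v} = OuterBlock.irr H (cls v)
  done : (∃ λ χ → ∃ λ ix → BalancedSplit (θ T) pos neg true false χ ix) → ⊥
  done (_ , _ , S) = noBSP (fromSplit T S)
  done′ : (∃ λ χ → ∃ λ ix → BalancedSplit (θ T) neg pos false true χ ix) → ⊥
  done′ (_ , _ , S) = noBSP (fromSplit T (flipSplit S))
  module Plain {sp par} (J : IsProperTwoJoin T sp) (tp : TwoJoinParity T sp par) = TwoJoinCases {T = T} {sp} {par = par} plain noCap noAnticap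
    (joinEnds (proj₁ J)) (λ {u} {v} K cu cv → trans (joinCross (proj₁ J) cu cv) (crossVal-end (proj₂ (sp u)) K))
    (λ {u} {v} cu cv → trans (joinCross (proj₁ J) cu cv) (crossVal-mid (proj₂ (sp u)))) (joinLink {T′ = T} {sp} tp)

  -- A complement 2-join is treated on `T` itself with the two values exchanged, so the conditions
  -- excluding odd holes and odd antiholes exchange places too.
  module Complemented {sp par} (J : IsProperTwoJoin (complement T) sp) (tp : TwoJoinParity (complement T) sp par) =
    TwoJoinCases {T = T} {sp} {par = par} complemented noAnticap noCap
      (joinEnds (proj₁ J)) (λ {u} {v} K cu cv → crossVal-negated (proj₂ (sp u)) K (joinCross (proj₁ J) cu cv))
      (λ {u} {v} cu cv → negA-neg (trans (joinCross (proj₁ J) cu cv) (crossVal-mid (proj₂ (sp u))))) (λ P → joinLink {T′ = complement T} {sp} tp (complementPath P))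

  refute : ∀ (φ : Fragment T) {χ ix} → BalancedSplit (θ (block T φ)) pos neg true false χ ix → ⊥
  refute (twoJoin sp J evenP tp) S = done (Plain.even-split J tp refl fEven
    (λ { kA true → refl ; kA false → refl ; kB true → refl ; kB false → refl ; kC true → refl ; kC false → refl })
    (λ { kA → refl ; kB → refl ; kC → refl }) S)
  refute (twoJoin sp J oddP tp) S = done (Plain.odd-split J tp refl fOdd
    (λ { kA true → refl ; kA false → refl ; kB true → refl ; kB false → refl ; kC true → refl ; kC false → refl }) S)
  refute (coTwoJoin sp J evenP tp) S = done′ (Complemented.even-split J tp refl fCoEven
    (λ { kA true → refl ; kA false → refl ; kB true → refl ; kB false → refl ; kC true → refl ; kC false → refl })
    (λ { kA → refl ; kB → refl ; kC → refl }) (flipSplit S))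
  refute (coTwoJoin sp J oddP tp) S = done′ (Complemented.odd-split J tp refl fCoOdd
    (λ { kA true → refl ; kA false → refl ; kB true → refl ; kB false → refl ; kC true → refl ; kC false → refl }) (flipSplit S))
  refute (hpInner cls H) S = done (InnerBlock.split H noCap noAnticap S)
  refute (hpOuter cls H) S = done (OuterBlock.split H noCap noAnticap S)
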